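{- Let $n\equiv 1\pmod 4$ be a positive integer and let $a$ be an indeterminate. Then, modulo $[n]_{q^2}(1-aq^{2n})(a-q^{2n})$, \[ \sum_{k=0}^{(n-1)/4}[8k+1]_{q^2}[8k+1]^2\frac{(q^2;q^8)_k^2(aq^2;q^8)_k(q^2/a;q^8)_k}{(q^8;q^8)_k^2(aq^8;q^8)_k(q^8/a;q^8)_k}q^{ -4k} \equiv [n]_{q^2}\frac{(q^4;q^8)_{(n-1)/4}}{(q^8;q^8)_{(n-1)/4}}q^{ -(n-1)/2}\left(1-\frac{(1-aq^2)(1-q^2/a)}{(1-q)^2(1+q^2)}\right). \]
   Context: For an indeterminate $q$, $(x;q)_k=(1-x)(1-xq)\cdots(1-xq^{k-1})$ (with $(x;q)_0=1$). For an integer $m$, $[m]=(1-q^m)/(1-q)$ and $[m]_{q^2}=(1-q^{2m})/(1-q^2)$. A congruence $A\equiv B\pmod{P}$ between rational functions in $q$ and $a$ means that $A-B$, written as a quotient of polynomials with denominator coprime to $P$, has numerator divisible by $P$. -}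

module Defs where

open import Level using (Level; _⊔_; 0ℓ) renaming (suc to lsuc)
open import Algebra.Bundles using (CommutativeRing)
open import Algebra.Structures using (IsCommutativeRing)
open import Data.Fin.Base using (toℕ)
open import Data.List.Base using (List; []; _∷_; map)
open import Data.Nat.Base as ℕ using (ℕ; zero; suc)
open import Data.Product.Base using (_×_; _,_; ∃-syntax)
open import Data.Rational.Base as ℚ using (ℚ; 0ℚ)
import Data.Rational.Properties as ℚ
open import Data.Sum.Base as Sum using (_⊎_; inj₁; inj₂)
open import Relation.Binary.Definitions using (Decidable)
open import Relation.Binary.Structures using (IsEquivalence)
open import Relation.Binary.PropositionalEquality as ≡ using (_≡_)
open import Relation.Nullary using (¬_; yes; no; contradiction)
open import Relation.Nullary.Decidable using (map′; _×-dec_)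

private
  variable
    c ℓ : Level

-- Decidable equality is what makes a total inverse of fractions definable.
record IntegralDomain c ℓ : Set (lsuc (c ⊔ ℓ)) where
  field
    commutativeRing : CommutativeRing c ℓ

  open CommutativeRing commutativeRing public

  field
    _≟_           : Decidable _≈_
    1≉0           : 1# ≉ 0#
    noZeroDivisor : ∀ x y → x * y ≈ 0# → x ≈ 0# ⊎ y ≈ 0#

-- A polynomial is the list of its coefficients, constant term first; trailing
-- zeros are allowed, and polynomials are equal when all their coefficients are.
module Polynomials (R : CommutativeRing c ℓ) where

  private module R = CommutativeRing R
  open R using (Carrier; 0#; 1#)
  open import Relation.Binary.Reasoning.Setoid R.setoid
  open import Algebra.Properties.CommutativeSemigroup R.+-commutativeSemigroup
    using (interchange)
  open import Algebra.Properties.Ring R.ring using (-0#≈0#)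

  Polynomial : Set c
  Polynomial = List Carrier

  infix  4 _≈_
  infix  8 -_
  infixl 7 _*_ _·_
  infixl 6 _+_

  coeff : Polynomial → ℕ → Carrier
  coeff []      _       = 0#
  coeff (x ∷ p) zero    = x
  coeff (x ∷ p) (suc i) = coeff p i

  record _≈_ (p q : Polynomial) : Set ℓ where
    constructor mk≈
    field
      coeff-≈ : ∀ i → coeff p i R.≈ coeff q i

  open _≈_ public

  const : Carrier → Polynomial
  const x = x ∷ []

  X : Polynomial
  X = 0# ∷ 1# ∷ []

  _+_ : Polynomial → Polynomial → Polynomial
  []      + q       = q
  (x ∷ p) + []      = x ∷ p
  (x ∷ p) + (y ∷ q) = (x R.+ y) ∷ (p + q)

  -_ : Polynomial → Polynomial
  -_ = map (R.-_)

  _·_ : Carrier → Polynomial → Polynomial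
  x · p = map (x R.*_) p

  _*_ : Polynomial → Polynomial → Polynomial
  []      * q = []
  (x ∷ p) * q = x · q + (0# ∷ p * q)

  ≈-isEquivalence : IsEquivalence _≈_
  ≈-isEquivalence = record
    { refl  = mk≈ λ _ → R.refl
    ; sym   = λ p≈q → mk≈ λ i → R.sym (coeff-≈ p≈q i)
    ; trans = λ p≈q q≈r → mk≈ λ i → R.trans (coeff-≈ p≈q i) (coeff-≈ q≈r i)
    }

  open IsEquivalence ≈-isEquivalence public
    using () renaming (refl to ≈-refl; sym to ≈-sym; trans to ≈-trans)

  ∷-cong : ∀ {x y p q} → x R.≈ y → p ≈ q → x ∷ p ≈ y ∷ q
  ∷-cong x≈y p≈q = mk≈ λ where
    zero    → x≈y
    (suc i) → coeff-≈ p≈q i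

  0∷[]≈[] : 0# ∷ [] ≈ []
  0∷[]≈[] = mk≈ λ where
    zero    → R.refl
    (suc _) → R.refl

  coeff-+ : ∀ p q i → coeff (p + q) i R.≈ coeff p i R.+ coeff q i
  coeff-+ []      q       i       = R.sym (R.+-identityˡ _)
  coeff-+ (x ∷ p) []      i       = R.sym (R.+-identityʳ _)
  coeff-+ (x ∷ p) (y ∷ q) zero    = R.refl
  coeff-+ (x ∷ p) (y ∷ q) (suc i) = coeff-+ p q i

  coeff-neg : ∀ p i → coeff (- p) i R.≈ R.- coeff p i
  coeff-neg []      i       = R.sym -0#≈0#
  coeff-neg (x ∷ p) zero    = R.refl
  coeff-neg (x ∷ p) (suc i) = coeff-neg p i

  coeff-· : ∀ x p i → coeff (x · p) i R.≈ x R.* coeff p i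
  coeff-· x []      i       = R.sym (R.zeroʳ x)
  coeff-· x (y ∷ p) zero    = R.refl
  coeff-· x (y ∷ p) (suc i) = coeff-· x p i

  +-cong : ∀ {p q r s} → p ≈ q → r ≈ s → p + r ≈ q + s
  +-cong {p} {q} {r} {s} p≈q r≈s = mk≈ λ i → begin
    coeff (p + r) i            ≈⟨ coeff-+ p r i ⟩
    coeff p i R.+ coeff r i    ≈⟨ R.+-cong (coeff-≈ p≈q i) (coeff-≈ r≈s i) ⟩
    coeff q i R.+ coeff s i    ≈⟨ coeff-+ q s i ⟨
    coeff (q + s) i            ∎

  +-assoc : ∀ p q r → (p + q) + r ≈ p + (q + r)
  +-assoc p q r = mk≈ λ i → begin
    coeff ((p + q) + r) i                    ≈⟨ coeff-+ (p + q) r i ⟩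
    coeff (p + q) i R.+ coeff r i            ≈⟨ R.+-congʳ (coeff-+ p q i) ⟩
    coeff p i R.+ coeff q i R.+ coeff r i    ≈⟨ R.+-assoc _ _ _ ⟩
    coeff p i R.+ (coeff q i R.+ coeff r i)  ≈⟨ R.+-congˡ (coeff-+ q r i) ⟨
    coeff p i R.+ coeff (q + r) i            ≈⟨ coeff-+ p (q + r) i ⟨
    coeff (p + (q + r)) i                    ∎

  +-comm : ∀ p q → p + q ≈ q + p
  +-comm p q = mk≈ λ i → begin
    coeff (p + q) i            ≈⟨ coeff-+ p q i ⟩
    coeff p i R.+ coeff q i    ≈⟨ R.+-comm _ _ ⟩
    coeff q i R.+ coeff p i    ≈⟨ coeff-+ q p i ⟨
    coeff (q + p) i            ∎

  +-identityʳ : ∀ p → p + [] ≈ p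
  +-identityʳ p = +-comm p []

  -‿cong : ∀ {p q} → p ≈ q → - p ≈ - q
  -‿cong {p} {q} p≈q = mk≈ λ i → begin
    coeff (- p) i    ≈⟨ coeff-neg p i ⟩
    R.- coeff p i    ≈⟨ R.-‿cong (coeff-≈ p≈q i) ⟩
    R.- coeff q i    ≈⟨ coeff-neg q i ⟨
    coeff (- q) i    ∎

  -‿inverseʳ : ∀ p → p + (- p) ≈ []
  -‿inverseʳ p = mk≈ λ i → begin
    coeff (p + (- p)) i              ≈⟨ coeff-+ p (- p) i ⟩
    coeff p i R.+ coeff (- p) i      ≈⟨ R.+-congˡ (coeff-neg p i) ⟩
    coeff p i R.+ R.- coeff p i      ≈⟨ R.-‿inverseʳ _ ⟩
    0#                               ∎

  -‿inverseˡ : ∀ p → (- p) + p ≈ []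
  -‿inverseˡ p = ≈-trans (+-comm (- p) p) (-‿inverseʳ p)

  +-interchange : ∀ p q r s → (p + q) + (r + s) ≈ (p + r) + (q + s)
  +-interchange p q r s = mk≈ λ i → begin
    coeff ((p + q) + (r + s)) i
      ≈⟨ coeff-+ (p + q) (r + s) i ⟩
    coeff (p + q) i R.+ coeff (r + s) i
      ≈⟨ R.+-cong (coeff-+ p q i) (coeff-+ r s i) ⟩
    (coeff p i R.+ coeff q i) R.+ (coeff r i R.+ coeff s i)
      ≈⟨ interchange _ _ _ _ ⟩
    (coeff p i R.+ coeff r i) R.+ (coeff q i R.+ coeff s i)
      ≈⟨ R.+-cong (coeff-+ p r i) (coeff-+ q s i) ⟨
    coeff (p + r) i R.+ coeff (q + s) i
      ≈⟨ coeff-+ (p + r) (q + s) i ⟨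
    coeff ((p + r) + (q + s)) i
      ∎

  +-swap : ∀ p q r → p + (q + r) ≈ q + (p + r)
  +-swap p q r =
    ≈-trans (≈-sym (+-assoc p q r))
      (≈-trans (+-cong (+-comm p q) ≈-refl) (+-assoc q p r))

  ·-cong : ∀ {x y p q} → x R.≈ y → p ≈ q → x · p ≈ y · q
  ·-cong {x} {y} {p} {q} x≈y p≈q = mk≈ λ i → begin
    coeff (x · p) i    ≈⟨ coeff-· x p i ⟩
    x R.* coeff p i    ≈⟨ R.*-cong x≈y (coeff-≈ p≈q i) ⟩
    y R.* coeff q i    ≈⟨ coeff-· y q i ⟨
    coeff (y · q) i    ∎

  ·-distribˡ : ∀ x p q → x · (p + q) ≈ x · p + x · q
  ·-distribˡ x p q = mk≈ λ i → begin
    coeff (x · (p + q)) i                    ≈⟨ coeff-· x (p + q) i ⟩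
    x R.* coeff (p + q) i                    ≈⟨ R.*-congˡ (coeff-+ p q i) ⟩
    x R.* (coeff p i R.+ coeff q i)          ≈⟨ R.distribˡ _ _ _ ⟩
    x R.* coeff p i R.+ x R.* coeff q i      ≈⟨ R.+-cong (coeff-· x p i) (coeff-· x q i) ⟨
    coeff (x · p) i R.+ coeff (x · q) i      ≈⟨ coeff-+ (x · p) (x · q) i ⟨
    coeff (x · p + x · q) i                  ∎

  ·-assoc : ∀ x y p → (x R.* y) · p ≈ x · (y · p)
  ·-assoc x y p = mk≈ λ i → begin
    coeff ((x R.* y) · p) i      ≈⟨ coeff-· (x R.* y) p i ⟩
    x R.* y R.* coeff p i        ≈⟨ R.*-assoc _ _ _ ⟩
    x R.* (y R.* coeff p i)      ≈⟨ R.*-congˡ (coeff-· y p i) ⟨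
    x R.* coeff (y · p) i        ≈⟨ coeff-· x (y · p) i ⟨
    coeff (x · (y · p)) i        ∎

  0·≈[] : ∀ {x} p → x R.≈ 0# → x · p ≈ []
  0·≈[] {x} p x≈0 = mk≈ λ i → begin
    coeff (x · p) i     ≈⟨ coeff-· x p i ⟩
    x R.* coeff p i     ≈⟨ R.*-congʳ x≈0 ⟩
    0# R.* coeff p i    ≈⟨ R.zeroˡ _ ⟩
    0#                  ∎

  *-congˡ : ∀ p {q r} → q ≈ r → p * q ≈ p * r
  *-congˡ []      q≈r = ≈-refl
  *-congˡ (x ∷ p) q≈r = +-cong (·-cong R.refl q≈r) (∷-cong R.refl (*-congˡ p q≈r))

  *-zeroʳ : ∀ p → p * [] ≈ []
  *-zeroʳ []      = ≈-refl
  *-zeroʳ (x ∷ p) = ≈-trans (∷-cong R.refl (*-zeroʳ p)) 0∷[]≈[]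

  *-∷ : ∀ p y q → p * (y ∷ q) ≈ y · p + (0# ∷ p * q)
  *-∷ []      y q = ≈-sym 0∷[]≈[]
  *-∷ (x ∷ p) y q = ∷-cong (R.+-congʳ (R.*-comm x y))
    (≈-trans (+-cong (≈-refl {x · q}) (*-∷ p y q))
      (+-swap (x · q) (y · p) (0# ∷ p * q)))

  *-comm : ∀ p q → p * q ≈ q * p
  *-comm []      q = ≈-sym (*-zeroʳ q)
  *-comm (x ∷ p) q = ≈-trans
    (+-cong (≈-refl {x · q}) (∷-cong R.refl (*-comm p q))) (≈-sym (*-∷ q x p))

  *-cong : ∀ {p q r s} → p ≈ q → r ≈ s → p * r ≈ q * s
  *-cong {p} {q} {r} {s} p≈q r≈s =
    ≈-trans (*-congˡ p r≈s) (≈-trans (*-comm p s)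
      (≈-trans (*-congˡ s p≈q) (*-comm s q)))

  *-distribˡ-+ : ∀ p q r → p * (q + r) ≈ p * q + p * r
  *-distribˡ-+ []      q r = ≈-refl
  *-distribˡ-+ (x ∷ p) q r = ≈-trans
    (+-cong (·-distribˡ x q r)
      (∷-cong (R.sym (R.+-identityˡ 0#)) (*-distribˡ-+ p q r)))
    (+-interchange (x · q) (x · r) (0# ∷ p * q) (0# ∷ p * r))

  *-distribʳ-+ : ∀ p q r → (q + r) * p ≈ q * p + r * p
  *-distribʳ-+ p q r = ≈-trans (*-comm (q + r) p)
    (≈-trans (*-distribˡ-+ p q r) (+-cong (*-comm p q) (*-comm p r)))

  ·-*-assoc : ∀ x p q → (x · p) * q ≈ x · (p * q)
  ·-*-assoc x []      q = ≈-refl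
  ·-*-assoc x (y ∷ p) q = ≈-trans
    (+-cong (·-assoc x y q) (∷-cong (R.sym (R.zeroʳ x)) (·-*-assoc x p q)))
    (≈-sym (·-distribˡ x (y · q) (0# ∷ p * q)))

  0∷-* : ∀ p q → (0# ∷ p) * q ≈ 0# ∷ p * q
  0∷-* p q = +-cong (0·≈[] q R.refl) ≈-refl

  *-assoc : ∀ p q r → (p * q) * r ≈ p * (q * r)
  *-assoc []      q r = ≈-refl
  *-assoc (x ∷ p) q r = ≈-trans (*-distribʳ-+ r (x · q) (0# ∷ p * q))
    (+-cong (·-*-assoc x q r)
      (≈-trans (0∷-* (p * q) r) (∷-cong R.refl (*-assoc p q r))))

  *-identityˡ : ∀ p → const 1# * p ≈ p
  *-identityˡ p = mk≈ λ i → begin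
    coeff (1# · p + (0# ∷ [])) i        ≈⟨ coeff-+ (1# · p) (0# ∷ []) i ⟩
    coeff (1# · p) i R.+ coeff (0# ∷ []) i
      ≈⟨ R.+-cong (coeff-· 1# p i) (coeff-≈ 0∷[]≈[] i) ⟩
    1# R.* coeff p i R.+ 0#             ≈⟨ R.+-identityʳ _ ⟩
    1# R.* coeff p i                    ≈⟨ R.*-identityˡ _ ⟩
    coeff p i                           ∎

  *-identityʳ : ∀ p → p * const 1# ≈ p
  *-identityʳ p = ≈-trans (*-comm p (const 1#)) (*-identityˡ p)

  isCommutativeRing : IsCommutativeRing _≈_ _+_ _*_ -_ [] (const 1#)
  isCommutativeRing = record
    { isRing = record
      { +-isAbelianGroup = record
        { isGroup = record
          { isMonoid = record
            { isSemigroup = record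
              { isMagma = record
                { isEquivalence = ≈-isEquivalence
                ; ∙-cong        = +-cong
                }
              ; assoc = +-assoc
              }
            ; identity = (λ _ → ≈-refl) , +-identityʳ
            }
          ; inverse = -‿inverseˡ , -‿inverseʳ
          ; ⁻¹-cong = -‿cong
          }
        ; comm = +-comm
        }
      ; *-cong     = *-cong
      ; *-assoc    = *-assoc
      ; *-identity = *-identityˡ , *-identityʳ
      ; distrib    = *-distribˡ-+ , *-distribʳ-+
      }
    ; *-comm = *-comm
    }

  polynomialRing : CommutativeRing c ℓ
  polynomialRing = record { isCommutativeRing = isCommutativeRing }

module PolynomialDomain (D : IntegralDomain c ℓ) where

  private module D = IntegralDomain D
  open Polynomials D.commutativeRing

  private

    head-≈0 : ∀ {x p} → x ∷ p ≈ [] → x D.≈ D.0#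
    head-≈0 e = coeff-≈ e zero

    tail-≈0 : ∀ {x p} → x ∷ p ≈ [] → p ≈ []
    tail-≈0 e = mk≈ λ i → coeff-≈ e (suc i)

    ∷-≈0 : ∀ {x p} → x D.≈ D.0# → p ≈ [] → x ∷ p ≈ []
    ∷-≈0 x≈0 p≈0 = ≈-trans (∷-cong x≈0 p≈0) 0∷[]≈[]

    ≟-list : Decidable _≈_
    ≟-list []      []      = yes ≈-refl
    ≟-list []      (y ∷ q) = map′
      (λ (y≈0 , q≈0) → ≈-sym (∷-≈0 y≈0 (≈-sym q≈0)))
      (λ e → head-≈0 (≈-sym e) , ≈-sym (tail-≈0 (≈-sym e)))
      (y D.≟ D.0# ×-dec ≟-list [] q)
    ≟-list (x ∷ p) []      = map′
      (λ (x≈0 , p≈0) → ∷-≈0 x≈0 p≈0)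
      (λ e → head-≈0 e , tail-≈0 e)
      (x D.≟ D.0# ×-dec ≟-list p [])
    ≟-list (x ∷ p) (y ∷ q) = map′
      (λ (x≈y , p≈q) → ∷-cong x≈y p≈q)
      (λ e → coeff-≈ e zero , mk≈ λ i → coeff-≈ e (suc i))
      (x D.≟ y ×-dec ≟-list p q)

    *-tailˡ : ∀ {x} p q → x D.≈ D.0# → (x ∷ p) * q ≈ [] → p * q ≈ []
    *-tailˡ p q x≈0 e = tail-≈0 (≈-trans (≈-sym (0∷-* p q))
      (≈-trans (*-cong (∷-cong (D.sym x≈0) (≈-refl {p})) (≈-refl {q})) e))

    *-tailʳ : ∀ {y} p q → y D.≈ D.0# → p * (y ∷ q) ≈ [] → p * q ≈ []
    *-tailʳ {y} p q y≈0 e = tail-≈0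
      (≈-trans (+-cong (≈-sym (0·≈[] p y≈0)) ≈-refl) (≈-trans (≈-sym (*-∷ p y q)) e))

    noZeroDivisor : ∀ p q → p * q ≈ [] → p ≈ [] ⊎ q ≈ []
    noZeroDivisor []      q       _ = inj₁ ≈-refl
    noZeroDivisor (x ∷ p) []      _ = inj₂ ≈-refl
    noZeroDivisor (x ∷ p) (y ∷ q) e = Sum.[
      (λ x≈0 → Sum.map₁ (∷-≈0 x≈0)
        (noZeroDivisor p (y ∷ q) (*-tailˡ p (y ∷ q) x≈0 e))) ,
      (λ y≈0 → Sum.map₂ (∷-≈0 y≈0)
        (noZeroDivisor (x ∷ p) q (*-tailʳ (x ∷ p) q y≈0 e))) ]′
      (D.noZeroDivisor x y (D.trans (D.sym (D.+-identityʳ _)) (head-≈0 e)))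

  polynomialDomain : IntegralDomain c ℓ
  polynomialDomain = record
    { commutativeRing = polynomialRing
    ; _≟_             = ≟-list
    ; 1≉0             = λ e → D.1≉0 (head-≈0 e)
    ; noZeroDivisor   = noZeroDivisor
    }

module Fractions (D : IntegralDomain c ℓ) where

  private module D = IntegralDomain D
  open D using (0#; 1#)
  open import Relation.Binary.Reasoning.Setoid D.setoid
  open import Algebra.Solver.Ring.NaturalCoefficients.Default D.commutativeSemiring
    using (solve; _:=_; _:*_; _:+_; con)
  open import Algebra.Properties.Ring D.ring
    using (-‿distribˡ-*; x∙y⁻¹≈ε⇒x≈y)

  infix  4 _≈_
  infix  8 -_
  infixl 7 _*_ _/_
  infixl 6 _+_
  infix  9 _⁻¹

  record Fraction : Set (c ⊔ ℓ) where
    constructor fraction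
    field
      num   : D.Carrier
      den   : D.Carrier
      den≉0 : den D.≉ 0#

  open Fraction public

  record _≈_ (x y : Fraction) : Set ℓ where
    constructor mk≈
    field
      cross : num x D.* den y D.≈ num y D.* den x

  open _≈_ public

  *-≉0 : ∀ {a b} → a D.≉ 0# → b D.≉ 0# → a D.* b D.≉ 0#
  *-≉0 {a} {b} a≉0 b≉0 ab≈0 = Sum.[ a≉0 , b≉0 ] (D.noZeroDivisor a b ab≈0)

  fromDomain : D.Carrier → Fraction
  fromDomain a = fraction a 1# D.1≉0

  _+_ : Fraction → Fraction → Fraction
  fraction a b b≉0 + fraction c d d≉0 =
    fraction (a D.* d D.+ c D.* b) (b D.* d) (*-≉0 b≉0 d≉0)

  _*_ : Fraction → Fraction → Fraction
  fraction a b b≉0 * fraction c d d≉0 =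
    fraction (a D.* c) (b D.* d) (*-≉0 b≉0 d≉0)

  -_ : Fraction → Fraction
  - fraction a b b≉0 = fraction (D.- a) b b≉0

  -- The inverse of 0 is 0 by convention.
  _⁻¹ : Fraction → Fraction
  fraction a b b≉0 ⁻¹ with a D.≟ 0#
  ... | yes _   = fromDomain 0#
  ... | no  a≉0 = fraction b a a≉0

  _/_ : Fraction → Fraction → Fraction
  x / y = x * y ⁻¹

  private

    *-cancelʳ : ∀ {a b} d → d D.≉ 0# → a D.* d D.≈ b D.* d → a D.≈ b
    *-cancelʳ {a} {b} d d≉0 e =
      Sum.[ x∙y⁻¹≈ε⇒x≈y a b , (λ d≈0 → contradiction d≈0 d≉0) ]
        (D.noZeroDivisor (a D.- b) d (begin
          (a D.- b) D.* d                  ≈⟨ D.distribʳ d a (D.- b) ⟩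
          a D.* d D.+ (D.- b) D.* d        ≈⟨ D.+-cong e (D.sym (-‿distribˡ-* b d)) ⟩
          b D.* d D.+ D.- (b D.* d)        ≈⟨ D.-‿inverseʳ _ ⟩
          0#                               ∎))

    ≈-refl : ∀ {x} → x ≈ x
    ≈-refl = mk≈ D.refl

    ≈-sym : ∀ {x y} → x ≈ y → y ≈ x
    ≈-sym (mk≈ e) = mk≈ (D.sym e)

    ≈-trans : ∀ {x y z} → x ≈ y → y ≈ z → x ≈ z
    ≈-trans {fraction a b _} {fraction c d d≉0} {fraction e f _} (mk≈ ad≈cb) (mk≈ cf≈ed) =
      mk≈ (*-cancelʳ d d≉0 (begin
        a D.* f D.* d    ≈⟨ swapʳ a f d ⟩
        a D.* d D.* f    ≈⟨ D.*-congʳ ad≈cb ⟩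
        c D.* b D.* f    ≈⟨ swapʳ c b f ⟩
        c D.* f D.* b    ≈⟨ D.*-congʳ cf≈ed ⟩
        e D.* d D.* b    ≈⟨ swapʳ e d b ⟩
        e D.* b D.* d    ∎))
      where
      swapʳ : ∀ x y z → x D.* y D.* z D.≈ x D.* z D.* y
      swapʳ = solve 3 (λ x y z → x :* y :* z := x :* z :* y) D.refl

    +-cong : ∀ {x y u v} → x ≈ y → u ≈ v → x + u ≈ y + v
    +-cong {fraction a b _} {fraction a′ b′ _} {fraction c d _} {fraction c′ d′ _}
           (mk≈ e) (mk≈ f) = mk≈ (begin
      (a D.* d D.+ c D.* b) D.* (b′ D.* d′)
        ≈⟨ regroup a b b′ c d d′ ⟩
      (a D.* b′) D.* (d D.* d′) D.+ (c D.* d′) D.* (b D.* b′)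
        ≈⟨ D.+-cong (D.*-congʳ e) (D.*-congʳ f) ⟩
      (a′ D.* b) D.* (d D.* d′) D.+ (c′ D.* d) D.* (b D.* b′)
        ≈⟨ regroup′ a′ b b′ c′ d d′ ⟩
      (a′ D.* d′ D.+ c′ D.* b′) D.* (b D.* d)
        ∎)
      where
      regroup : ∀ a b b′ c d d′ → (a D.* d D.+ c D.* b) D.* (b′ D.* d′) D.≈
                (a D.* b′) D.* (d D.* d′) D.+ (c D.* d′) D.* (b D.* b′)
      regroup = solve 6 (λ a b b′ c d d′ → (a :* d :+ c :* b) :* (b′ :* d′) :=
                (a :* b′) :* (d :* d′) :+ (c :* d′) :* (b :* b′)) D.refl
      regroup′ : ∀ a b b′ c d d′ →
                (a D.* b) D.* (d D.* d′) D.+ (c D.* d) D.* (b D.* b′) D.≈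
                (a D.* d′ D.+ c D.* b′) D.* (b D.* d)
      regroup′ = solve 6 (λ a b b′ c d d′ →
                (a :* b) :* (d :* d′) :+ (c :* d) :* (b :* b′) :=
                (a :* d′ :+ c :* b′) :* (b :* d)) D.refl

    *-cong : ∀ {x y u v} → x ≈ y → u ≈ v → x * u ≈ y * v
    *-cong {fraction a b _} {fraction a′ b′ _} {fraction c d _} {fraction c′ d′ _}
           (mk≈ e) (mk≈ f) = mk≈ (begin
      (a D.* c) D.* (b′ D.* d′)    ≈⟨ interchange a c b′ d′ ⟩
      (a D.* b′) D.* (c D.* d′)    ≈⟨ D.*-cong e f ⟩
      (a′ D.* b) D.* (c′ D.* d)    ≈⟨ interchange a′ b c′ d ⟩
      (a′ D.* c′) D.* (b D.* d)    ∎)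
      where
      interchange : ∀ a b c d → (a D.* b) D.* (c D.* d) D.≈ (a D.* c) D.* (b D.* d)
      interchange = solve 4 (λ a b c d → (a :* b) :* (c :* d) := (a :* c) :* (b :* d)) D.refl

    -‿cong : ∀ {x y} → x ≈ y → - x ≈ - y
    -‿cong {fraction a b _} {fraction a′ b′ _} (mk≈ e) = mk≈ (begin
      (D.- a) D.* b′     ≈⟨ -‿distribˡ-* a b′ ⟨
      D.- (a D.* b′)     ≈⟨ D.-‿cong e ⟩
      D.- (a′ D.* b)     ≈⟨ -‿distribˡ-* a′ b ⟩
      (D.- a′) D.* b     ∎)

    +-assoc : ∀ x y z → (x + y) + z ≈ x + (y + z)
    +-assoc (fraction a b _) (fraction c d _) (fraction e f _) = mk≈ (
      solve 6 (λ a b c d e f →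
        ((a :* d :+ c :* b) :* f :+ e :* (b :* d)) :* (b :* (d :* f)) :=
        (a :* (d :* f) :+ (c :* f :+ e :* d) :* b) :* (b :* d :* f))
        D.refl a b c d e f)

    +-comm : ∀ x y → x + y ≈ y + x
    +-comm (fraction a b _) (fraction c d _) = mk≈ (
      solve 4 (λ a b c d →
        (a :* d :+ c :* b) :* (d :* b) := (c :* b :+ a :* d) :* (b :* d))
        D.refl a b c d)

    +-identityˡ : ∀ x → fromDomain 0# + x ≈ x
    +-identityˡ (fraction a b _) = mk≈ (
      solve 2 (λ a b →
        (con 0 :* b :+ a :* con 1) :* b := a :* (con 1 :* b)) D.refl a b)

    -‿inverseˡ : ∀ x → - x + x ≈ fromDomain 0#
    -‿inverseˡ (fraction a b _) = mk≈ (begin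
      ((D.- a) D.* b D.+ a D.* b) D.* 1#    ≈⟨ D.*-identityʳ _ ⟩
      (D.- a) D.* b D.+ a D.* b             ≈⟨ D.distribʳ b (D.- a) a ⟨
      (D.- a D.+ a) D.* b                   ≈⟨ D.*-congʳ (D.-‿inverseˡ a) ⟩
      0# D.* b                              ≈⟨ D.zeroˡ b ⟩
      0#                                    ≈⟨ D.zeroˡ (b D.* b) ⟨
      0# D.* (b D.* b)                      ∎)

    *-assoc : ∀ x y z → (x * y) * z ≈ x * (y * z)
    *-assoc (fraction a b _) (fraction c d _) (fraction e f _) = mk≈ (
      D.*-cong (D.*-assoc a c e) (D.sym (D.*-assoc b d f)))

    *-comm : ∀ x y → x * y ≈ y * x
    *-comm (fraction a b _) (fraction c d _) = mk≈ (
      D.*-cong (D.*-comm a c) (D.*-comm d b))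

    *-identityˡ : ∀ x → fromDomain 1# * x ≈ x
    *-identityˡ (fraction a b _) = mk≈ (
      D.trans (D.*-congʳ (D.*-identityˡ a)) (D.*-congˡ (D.sym (D.*-identityˡ b))))

    distribˡ : ∀ x y z → x * (y + z) ≈ x * y + x * z
    distribˡ (fraction a b _) (fraction c d _) (fraction e f _) = mk≈ (
      solve 6 (λ a b c d e f →
        (a :* (c :* f :+ e :* d)) :* ((b :* d) :* (b :* f)) :=
        ((a :* c) :* (b :* f) :+ (a :* e) :* (b :* d)) :* (b :* (d :* f)))
        D.refl a b c d e f)

  isCommutativeRing :
    IsCommutativeRing _≈_ _+_ _*_ -_ (fromDomain 0#) (fromDomain 1#)
  isCommutativeRing = record
    { isRing = record
      { +-isAbelianGroup = record
        { isGroup = record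
          { isMonoid = record
            { isSemigroup = record
              { isMagma = record
                { isEquivalence = record
                  { refl = ≈-refl ; sym = ≈-sym ; trans = ≈-trans }
                ; ∙-cong = +-cong
                }
              ; assoc = +-assoc
              }
            ; identity = +-identityˡ , λ x → ≈-trans (+-comm x (fromDomain 0#)) (+-identityˡ x)
            }
          ; inverse = -‿inverseˡ , λ x → ≈-trans (+-comm x (- x)) (-‿inverseˡ x)
          ; ⁻¹-cong = -‿cong
          }
        ; comm = +-comm
        }
      ; *-cong     = *-cong
      ; *-assoc    = *-assoc
      ; *-identity = *-identityˡ , λ x → ≈-trans (*-comm x (fromDomain 1#)) (*-identityˡ x)
      ; distrib    = distribˡ , λ x y z → ≈-trans (*-comm (y + z) x)
          (≈-trans (distribˡ x y z) (+-cong (*-comm x y) (*-comm x z)))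
      }
    ; *-comm = *-comm
    }

  fractionField : CommutativeRing (c ⊔ ℓ) ℓ
  fractionField = record { isCommutativeRing = isCommutativeRing }

  *-inverseʳ : ∀ x → ¬ x ≈ fromDomain 0# → x * x ⁻¹ ≈ fromDomain 1#
  *-inverseʳ (fraction a b _) x≉0 with a D.≟ 0#
  ... | yes a≈0 = contradiction
        (mk≈ (D.trans (D.*-identityʳ a) (D.trans a≈0 (D.sym (D.zeroˡ b))))) x≉0
  ... | no  a≉0 = mk≈ (solve 2 (λ a b →
        a :* b :* con 1 := con 1 :* (b :* a)) D.refl a b)

ℚ-domain : IntegralDomain 0ℓ 0ℓ
ℚ-domain = record
  { commutativeRing = ℚ.+-*-commutativeRing
  ; _≟_             = ℚ._≟_
  ; 1≉0             = ℚ.1≢0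
  ; noZeroDivisor   = noZeroDivisor
  }
  where
  noZeroDivisor : ∀ x y → x ℚ.* y ≡ 0ℚ → x ≡ 0ℚ ⊎ y ≡ 0ℚ
  noZeroDivisor x y xy≡0 with x ℚ.≟ 0ℚ
  ... | yes x≡0 = inj₁ x≡0
  ... | no  x≢0 = inj₂ (begin
    y                       ≡⟨ ℚ.*-identityˡ y ⟨
    ℚ.1ℚ ℚ.* y              ≡⟨ ≡.cong (ℚ._* y) (ℚ.*-inverseˡ x) ⟨
    (ℚ.1/ x) ℚ.* x ℚ.* y    ≡⟨ ℚ.*-assoc (ℚ.1/ x) x y ⟩
    (ℚ.1/ x) ℚ.* (x ℚ.* y)  ≡⟨ ≡.cong ((ℚ.1/ x) ℚ.*_) xy≡0 ⟩
    (ℚ.1/ x) ℚ.* 0ℚ         ≡⟨ ℚ.*-zeroʳ (ℚ.1/ x) ⟩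
    0ℚ                      ∎)
    where
    open ≡.≡-Reasoning
    instance _ = ℚ.≢-nonZero x≢0

ℚ[q] : IntegralDomain 0ℓ 0ℓ
ℚ[q] = PolynomialDomain.polynomialDomain ℚ-domain

ℚ[q,a] : IntegralDomain 0ℓ 0ℓ
ℚ[q,a] = PolynomialDomain.polynomialDomain ℚ[q]

ℚ⟨q,a⟩ : CommutativeRing 0ℓ 0ℓ
ℚ⟨q,a⟩ = Fractions.fractionField ℚ[q,a]

private
  module Polyℚ    = Polynomials (IntegralDomain.commutativeRing ℚ-domain)
  module Polyℚ[q] = Polynomials (IntegralDomain.commutativeRing ℚ[q])
  module ℚ[q,a]   = IntegralDomain ℚ[q,a]
  module ℚ⟨q,a⟩   = CommutativeRing ℚ⟨q,a⟩

open Fractions ℚ[q,a] public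
  using (Fraction; num; den; den≉0; fromDomain; _⁻¹; _/_)
open ℚ⟨q,a⟩ public
  using (_≈_; _+_; _*_; -_; _-_; 0#; 1#)
open import Algebra.Properties.Semiring.Exp ℚ⟨q,a⟩.semiring public
  using (_^_)
open import Algebra.Properties.Semiring.Sum ℚ⟨q,a⟩.semiring public
  using (sum⁺-syntax)
open import Algebra.Properties.CommutativeMonoid.Sum ℚ⟨q,a⟩.*-commutativeMonoid
  using () renaming (sum to product)
open import Algebra.Properties.Semiring.Divisibility ℚ[q,a].semiring
  using (_∣_)
open import Algebra.Properties.Semiring.Primality ℚ[q,a].semiring
  using (Coprime)

q : Fraction
q = fromDomain (Polyℚ[q].const Polyℚ.X)

a : Fraction
a = fromDomain Polyℚ[q].X

-- The q-Pochhammer symbol (x;b)ₖ.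
⦅_⨾_⦆[_] : Fraction → Fraction → ℕ → Fraction
⦅ x ⨾ b ⦆[ k ] = product {k} (λ i → 1# - x * b ^ toℕ i)

-- The q-integer [m] in base b.
[_]⟨_⟩ : ℕ → Fraction → Fraction
[ m ]⟨ b ⟩ = (1# - b ^ m) / (1# - b)

infix 4 _≡_[mod_]

-- The modulus is given as a rational function, which has to be a polynomial.
-- The fraction F need not be in lowest terms.
_≡_[mod_] : (A B M : Fraction) → Set
A ≡ B [mod M ] =
  ∃[ P ] fromDomain P ≈ M ×
  (∃[ F ] A - B ≈ F × Coprime (den F) P × P ∣ num F)

{-# OPTIONS --safe #-}
module Submission where

-- Write α = q², p = q⁸, N = (n - 1)/4 and c = q²ⁿ = αpᴺ. Because
--   (1 - qpᵏ)² = (1 - q)² pᵏ + (1 - pᵏ)(1 - αpᵏ),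
-- the sum splits into a truncated very-well-poised ₆φ₅ sum ∑A with parameters α, aα, α/a
-- and a second sum ∑B. A telescoping combination of ∑A and ∑B produces the last factor of
-- the right-hand side, up to a boundary term divisible by [n] (1 - ac)(a - c), all q-integers
-- being in base q². So it suffices that ∑A/(1 - α) is congruent to [n] (α²;p)_N / (p;p)_N α⁻ᴺ.
--
-- Modulo [n], both sides vanish: Watson's transformation exhibits ∑A/(1 - α) as [n] times a
-- ₄φ₃ whose terms have denominators prime to [n], the factors 1 - p^j being paired off with
-- numerators 1 - q^(2m) for which gcd(4j,n) divides m.
--
-- Modulo (1 - ac)(a - c), the sum ∑A depends on a only through a + 1/a, so a may be replaced
-- by c. Then the transformation, with the roles of the parameters permuted, leaves one term.

open import Algebra.Bundles using (CommutativeRing)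
open import Algebra.Definitions.RawMagma using (_,_)
import Algebra.Properties.CommutativeMonoid.Sum
import Algebra.Properties.Semiring.Divisibility
import Algebra.Properties.Semiring.Exp
import Algebra.Properties.Semiring.Mult
import Algebra.Properties.Semiring.Primality
import Algebra.Properties.Semiring.Sum
open import Data.Fin.Base using (Fin; toℕ)
open import Data.Integer.Base as ℤ using (ℤ; +_; -[1+_])
import Data.Integer.Properties as ℤ
open import Data.List.Base using ([]; _∷_)
open import Data.Maybe.Base using (Maybe; just; nothing)
open import Data.Nat.Base as ℕ using (ℕ; zero; suc; _<_; _>_; _∸_; _%_; s≤s; z≤n)
open import Data.Nat.Divisibility as ℕ using (divides; ∣m+n∣m⇒∣n; ∣1⇒≡1; m∣m*n)
open import Data.Nat.DivMod using (m≡m%n+[m/n]*n; m*n/n≡m)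
open import Data.Nat.GCD using (gcd; gcd-GCD; gcd[m,n]∣m; gcd[m,n]∣n; gcd[m,n]≢0; module Bézout)
import Data.Nat.Properties as ℕ
open import Data.Product.Base using (_×_; _,_; ∃-syntax)
open import Data.Rational.Base as ℚ using (ℚ; 0ℚ; 1ℚ)
import Data.Rational.Properties as ℚ
import Data.Sign.Base as Sign
open import Data.Sum.Base using (inj₁; inj₂; [_,_]′)
open import Level using (_⊔_) renaming (suc to lsuc)
open import Relation.Binary.Definitions using (tri<; tri≈; tri>)
open import Relation.Binary.PropositionalEquality as ≡ using (_≡_; _≢_)
open import Relation.Nullary using (¬_; contradiction; yes; no)
open import Defs using (IntegralDomain; module Polynomials; module PolynomialDomain; module Fractions)

-- Two obstacles shape the proof. The first is the truncation: for general a the series does not end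
-- at N, so the terminating form of Watson's transformation does not apply. But the inner sum over k
-- telescopes for every upper limit, and `V-closed` takes the place of a terminating summation. The
-- second is the modulus. [n] is in general a product of several irreducible factors, and unique
-- factorisation in ℚ[q,a] is avoided. Coprimality is replaced by two stronger notions that are
-- stable under products: in ℚ[q], comaximality with [n], drawn from Bézout identities between
-- exponents, so that all divisors of n are treated at once and not one cyclotomic factor at a time;
-- in ℚ[q,a], regularity, that is, cancellability modulo the modulus. The divisibilities by [n] and
-- by (1 - ac)(a - c) can be joined because [n] is itself regular modulo (1 - ac)(a - c). The
-- relation p = α⁴ holds the pieces together: it turns the natural argument p/α² of the ₆φ₅ into α²,
-- and it makes the combination of ∑A and ∑B telescope.

-- Ring solver with integer coefficients

module IntegerSolver {c ℓ} (R : CommutativeRing c ℓ) where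

  open CommutativeRing R
  open import Algebra.Properties.Semiring.Mult.TCOptimised semiring
    using (×-homo-+; ×1-homo-*) renaming (_×_ to _×ᵣ_)
  open import Algebra.Properties.Ring ring
    using (-0#≈0#; -‿+-comm; -‿distribˡ-*; -‿distribʳ-*; -‿involutive)
  open import Algebra.Solver.Ring.AlmostCommutativeRing
  open import Relation.Binary.Reasoning.Setoid setoid

  private

    -- With this variant of multiplication `1 ×ᵣ 1#` reduces to `1#`, so the coefficients 0 and 1
    -- are interpreted by `0#` and `1#` on the nose.
    ⟦_⟧ℤ : ℤ → Carrier
    ⟦ + n      ⟧ℤ = n ×ᵣ 1#
    ⟦ -[1+ n ] ⟧ℤ = - (suc n ×ᵣ 1#)

    suc-× : ∀ n → suc n ×ᵣ 1# ≈ 1# + n ×ᵣ 1#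
    suc-× n = ×-homo-+ 1# 1 n

    cancel-1 : ∀ x y → (1# + x) - (1# + y) ≈ x - y
    cancel-1 x y = begin
      (1# + x) + - (1# + y)        ≈⟨ +-cong (+-comm 1# x) (sym (-‿+-comm 1# y)) ⟩
      (x + 1#) + (- 1# + - y)      ≈⟨ +-assoc x 1# _ ⟩
      x + (1# + (- 1# + - y))      ≈⟨ +-congˡ (+-assoc 1# (- 1#) (- y)) ⟨
      x + ((1# + - 1#) + - y)      ≈⟨ +-congˡ (+-congʳ (-‿inverseʳ 1#)) ⟩
      x + (0# + - y)               ≈⟨ +-congˡ (+-identityˡ (- y)) ⟩
      x - y                        ∎

    ⊖-homo : ∀ m n → ⟦ m ℤ.⊖ n ⟧ℤ ≈ m ×ᵣ 1# - n ×ᵣ 1#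
    ⊖-homo m zero = sym (trans (+-congˡ -0#≈0#) (+-identityʳ _))
    ⊖-homo zero (suc n) = sym (+-identityˡ _)
    ⊖-homo (suc m) (suc n) = begin
      ⟦ suc m ℤ.⊖ suc n ⟧ℤ           ≡⟨ ≡.cong ⟦_⟧ℤ (ℤ.[1+m]⊖[1+n]≡m⊖n m n) ⟩
      ⟦ m ℤ.⊖ n ⟧ℤ                   ≈⟨ ⊖-homo m n ⟩
      m ×ᵣ 1# - n ×ᵣ 1#                ≈⟨ cancel-1 _ _ ⟨
      (1# + m ×ᵣ 1#) - (1# + n ×ᵣ 1#)
        ≈⟨ +-cong (suc-× m) (-‿cong (suc-× n)) ⟨
      suc m ×ᵣ 1# - suc n ×ᵣ 1#        ∎

    +-homo : ∀ i j → ⟦ i ℤ.+ j ⟧ℤ ≈ ⟦ i ⟧ℤ + ⟦ j ⟧ℤ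
    +-homo (+ m)      (+ n)      = ×-homo-+ 1# m n
    +-homo (+ m)      -[1+ n ]   = ⊖-homo m (suc n)
    +-homo -[1+ m ]   (+ n)      = trans (⊖-homo n (suc m)) (+-comm _ _)
    +-homo -[1+ m ]   -[1+ n ]   = begin
      - (suc (suc (m ℕ.+ n)) ×ᵣ 1#)       ≡⟨ ≡.cong (λ k → - (suc k ×ᵣ 1#)) (ℕ.+-suc m n) ⟨
      - ((suc m ℕ.+ suc n) ×ᵣ 1#)         ≈⟨ -‿cong (×-homo-+ 1# (suc m) (suc n)) ⟩
      - (suc m ×ᵣ 1# + suc n ×ᵣ 1#)        ≈⟨ -‿+-comm _ _ ⟨
      - (suc m ×ᵣ 1#) + - (suc n ×ᵣ 1#)    ∎

    +◃-homo : ∀ n → ⟦ Sign.+ ℤ.◃ n ⟧ℤ ≈ n ×ᵣ 1#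
    +◃-homo zero    = refl
    +◃-homo (suc n) = refl

    -◃-homo : ∀ n → ⟦ Sign.- ℤ.◃ n ⟧ℤ ≈ - (n ×ᵣ 1#)
    -◃-homo zero    = sym -0#≈0#
    -◃-homo (suc n) = refl

    *-homo : ∀ i j → ⟦ i ℤ.* j ⟧ℤ ≈ ⟦ i ⟧ℤ * ⟦ j ⟧ℤ
    *-homo (+ m)    (+ n)    = trans (+◃-homo (m ℕ.* n)) (×1-homo-* m n)
    *-homo (+ m)    -[1+ n ] = trans (-◃-homo (m ℕ.* suc n))
      (trans (-‿cong (×1-homo-* m (suc n))) (-‿distribʳ-* _ _))
    *-homo -[1+ m ] (+ n)    = trans (-◃-homo (suc m ℕ.* n))
      (trans (-‿cong (×1-homo-* (suc m) n)) (-‿distribˡ-* _ _))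
    *-homo -[1+ m ] -[1+ n ] = begin
      (suc m ℕ.* suc n) ×ᵣ 1#               ≈⟨ ×1-homo-* (suc m) (suc n) ⟩
      suc m ×ᵣ 1# * (suc n ×ᵣ 1#)            ≈⟨ -‿involutive _ ⟨
      - - (suc m ×ᵣ 1# * (suc n ×ᵣ 1#))      ≈⟨ -‿cong (-‿distribˡ-* _ _) ⟩
      - (- (suc m ×ᵣ 1#) * (suc n ×ᵣ 1#))    ≈⟨ -‿distribʳ-* _ _ ⟩
      - (suc m ×ᵣ 1#) * - (suc n ×ᵣ 1#)      ∎

    -‿homo : ∀ i → ⟦ ℤ.- i ⟧ℤ ≈ - ⟦ i ⟧ℤ
    -‿homo (+ zero)    = sym -0#≈0#
    -‿homo (+ suc n)   = refl
    -‿homo -[1+ n ]    = sym (-‿involutive _)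

    homomorphism : ℤ.+-*-rawRing -Raw-AlmostCommutative⟶ fromCommutativeRing R
    homomorphism = record
      { ⟦_⟧    = ⟦_⟧ℤ
      ; +-homo = +-homo
      ; *-homo = *-homo
      ; -‿homo = -‿homo
      ; 0-homo = refl
      ; 1-homo = refl
      }

    ⟦⟧-≟ : ∀ i j → Maybe (⟦ i ⟧ℤ ≈ ⟦ j ⟧ℤ)
    ⟦⟧-≟ i j with i ℤ.≟ j
    ... | yes i≡j = just (reflexive (≡.cong ⟦_⟧ℤ i≡j))
    ... | no  _   = nothing

  open import Algebra.Solver.Ring ℤ.+-*-rawRing (fromCommutativeRing R)
    homomorphism ⟦⟧-≟ public

-- Finite sums and products

module Iterated {c ℓ} (R : CommutativeRing c ℓ) where

  open CommutativeRing R
  open import Relation.Binary.Reasoning.Setoid setoid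
  open IntegerSolver R

  -- The recursion splits off the last index, because the telescoping inductions below extend a sum
  -- at its upper end.
  ∑ ∏ : (ℕ → Carrier) → ℕ → Carrier
  ∑ f zero    = 0#
  ∑ f (suc n) = ∑ f n + f n
  ∏ f zero    = 1#
  ∏ f (suc n) = ∏ f n * f n

  ∑-cong : ∀ {f g} n → (∀ {i} → i < n → f i ≈ g i) → ∑ f n ≈ ∑ g n
  ∑-cong zero    f≈g = refl
  ∑-cong (suc n) f≈g = +-cong (∑-cong n (λ i<n → f≈g (ℕ.m<n⇒m<1+n i<n))) (f≈g (ℕ.n<1+n n))

  ∏-cong : ∀ {f g} n → (∀ {i} → i < n → f i ≈ g i) → ∏ f n ≈ ∏ g n
  ∏-cong zero    f≈g = refl
  ∏-cong (suc n) f≈g = *-cong (∏-cong n (λ i<n → f≈g (ℕ.m<n⇒m<1+n i<n))) (f≈g (ℕ.n<1+n n))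

  ∑-zero : ∀ {f} n → (∀ {i} → i < n → f i ≈ 0#) → ∑ f n ≈ 0#
  ∑-zero zero    f≈0 = refl
  ∑-zero (suc n) f≈0 = trans
    (+-cong (∑-zero n (λ i<n → f≈0 (ℕ.m<n⇒m<1+n i<n))) (f≈0 (ℕ.n<1+n n))) (+-identityˡ 0#)

  ∑-+ : ∀ f g n → ∑ (λ i → f i + g i) n ≈ ∑ f n + ∑ g n
  ∑-+ f g zero    = sym (+-identityˡ 0#)
  ∑-+ f g (suc n) = trans (+-congʳ (∑-+ f g n))
    (solve 4 (λ s t x y → (s :+ t) :+ (x :+ y) := (s :+ x) :+ (t :+ y)) refl _ _ _ _)

  ∑-*ˡ : ∀ x f n → ∑ (λ i → x * f i) n ≈ x * ∑ f n
  ∑-*ˡ x f zero    = sym (zeroʳ x)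
  ∑-*ˡ x f (suc n) = trans (+-congʳ (∑-*ˡ x f n)) (sym (distribˡ x _ _))

  ∑-comm : ∀ (f : ℕ → ℕ → Carrier) m n →
           ∑ (λ i → ∑ (f i) n) m ≈ ∑ (λ j → ∑ (λ i → f i j) m) n
  ∑-comm f zero    n = sym (∑-zero n (λ _ → refl))
  ∑-comm f (suc m) n = trans (+-congʳ (∑-comm f m n)) (sym (∑-+ _ (f m) n))

  ∑-front : ∀ f n → ∑ f (suc n) ≈ f 0 + ∑ (λ i → f (suc i)) n
  ∑-front f zero    = +-comm 0# (f 0)
  ∑-front f (suc n) = trans (+-congʳ (∑-front f n)) (+-assoc _ _ _)

  ∏-* : ∀ f g n → ∏ (λ i → f i * g i) n ≈ ∏ f n * ∏ g n
  ∏-* f g zero    = sym (*-identityˡ 1#)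
  ∏-* f g (suc n) = trans (*-congʳ (∏-* f g n))
    (solve 4 (λ s t x y → (s :* t) :* (x :* y) := (s :* x) :* (t :* y)) refl _ _ _ _)

  ∏-front : ∀ f n → ∏ f (suc n) ≈ f 0 * ∏ (λ i → f (suc i)) n
  ∏-front f zero    = *-comm 1# (f 0)
  ∏-front f (suc n) = trans (*-congʳ (∏-front f n)) (*-assoc _ _ _)

  ∏-one : ∀ {f} n → (∀ {i} → i < n → f i ≈ 1#) → ∏ f n ≈ 1#
  ∏-one zero    f≈1 = refl
  ∏-one (suc n) f≈1 = trans
    (*-cong (∏-one n (λ i<n → f≈1 (ℕ.m<n⇒m<1+n i<n))) (f≈1 (ℕ.n<1+n n))) (*-identityˡ 1#)

  ∏-zero : ∀ {f i} n → i < n → f i ≈ 0# → ∏ f n ≈ 0#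
  ∏-zero {f} {i} (suc n) i<1+n fi≈0 with ℕ.m≤n⇒m<n∨m≡n (ℕ.≤-pred i<1+n)
  ... | inj₁ i<n    = trans (*-congʳ (∏-zero n i<n fi≈0)) (zeroˡ (f n))
  ... | inj₂ ≡.refl = trans (*-congˡ fi≈0) (zeroʳ _)

  -- The solver knows no relation such as `pp′≈1`. Multiplying by an expression equal to 1 lets it
  -- regroup the factors around that expression.
  insert-1 : ∀ {u} x → u ≈ 1# → x ≈ x * u
  insert-1 x u≈1 = trans (sym (*-identityʳ x)) (*-congˡ (sym u≈1))

  1-cong : ∀ {x y} → x ≈ y → 1# - x ≈ 1# - y
  1-cong x≈y = +-congˡ (-‿cong x≈y)

  1-≈0 : ∀ {x} → x ≈ 1# → 1# - x ≈ 0#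
  1-≈0 x≈1 = trans (1-cong x≈1) (-‿inverseʳ 1#)

-- Basic hypergeometric series in base p

record QBase {c ℓ} (R : CommutativeRing c ℓ) : Set (c ⊔ ℓ) where
  open CommutativeRing R
  open Algebra.Properties.Semiring.Exp semiring using (_^_)
  field
    p p′   : Carrier
    pp′≈1  : p * p′ ≈ 1#
    ip     : ℕ → Carrier
    ip-inv : ∀ j → (1# - p ^ suc j) * ip j ≈ 1#

module QSeries {c ℓ} (R : CommutativeRing c ℓ) (B : QBase R) where

  open CommutativeRing R
  open QBase B
  open import Relation.Binary.Reasoning.Setoid setoid
  open Algebra.Properties.Semiring.Exp semiring using (_^_)
  open import Algebra.Properties.Ring ring using (x∙y⁻¹≈ε⇒x≈y)
  open import Algebra.Properties.CommutativeSemiring.Exp commutativeSemiring using (^-distrib-*)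
  open IntegerSolver R
  open Iterated R

  private
    1: : ∀ {n} → Polynomial n
    1: = con (+ 1)

  ^-inv : ∀ k → p ^ k * p′ ^ k ≈ 1#
  ^-inv zero    = *-identityˡ 1#
  ^-inv (suc k) = begin
    p * p ^ k * (p′ * p′ ^ k)
      ≈⟨ solve 4 (λ p x p′ x′ → p :* x :* (p′ :* x′) := p :* p′ :* (x :* x′)) refl _ _ _ _ ⟩
    p * p′ * (p ^ k * p′ ^ k)    ≈⟨ *-cong pp′≈1 (^-inv k) ⟩
    1# * 1#                      ≈⟨ *-identityˡ 1# ⟩
    1#                           ∎

  poch : Carrier → ℕ → Carrier
  poch x = ∏ (λ j → 1# - x * p ^ j)

  poch-cong : ∀ {x y} n → x ≈ y → poch x n ≈ poch y n
  poch-cong n x≈y = ∏-cong n (λ _ → 1-cong (*-congʳ x≈y))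

  poch-front : ∀ x n → poch x (suc n) ≈ (1# - x) * poch (x * p) n
  poch-front x n = trans (∏-front _ n)
    (*-cong (1-cong (*-identityʳ x)) (∏-cong n (λ _ → 1-cong (sym (*-assoc x p _)))))

  poch-one : ∀ n → poch 1# (suc n) ≈ 0#
  poch-one n = ∏-zero (suc n) (s≤s z≤n) (1-≈0 (*-identityˡ 1#))

  poch-p′^ : ∀ {n} k → n < k → poch (p′ ^ n) k ≈ 0#
  poch-p′^ {n} k n<k = ∏-zero k n<k (1-≈0 (trans (*-comm _ _) (^-inv n)))

  p′^-step : ∀ k → p′ ^ suc k * p ≈ p′ ^ k
  p′^-step k = begin
    p′ * p′ ^ k * p
      ≈⟨ solve 3 (λ p p′ x → p′ :* x :* p := x :* (p :* p′)) refl p p′ _ ⟩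
    p′ ^ k * (p * p′)   ≈⟨ *-congˡ pp′≈1 ⟩
    p′ ^ k * 1#         ≈⟨ *-identityʳ _ ⟩
    p′ ^ k              ∎

  shift : ∀ x k → x * p ^ k * p ≈ x * p ^ suc k
  shift x k = solve 3 (λ x p y → x :* y :* p := x :* (p :* y)) refl x p _

  -- The index k enters the two summations below only through this factor.
  M : Carrier → ℕ → ℕ → Carrier
  M α k i = poch (α * p ^ k) i * poch (p′ ^ k) i

  M-zero : ∀ α k i → k < i → M α k i ≈ 0#
  M-zero α k i k<i = trans (*-congˡ (poch-p′^ i k<i)) (zeroʳ _)

  M-suc : ∀ α k i → M α (suc k) (suc i) ≈
          poch (α * p ^ suc k) i * (1# - α * p ^ suc k * p ^ i) *
          ((1# - p′ ^ suc k) * poch (p′ ^ k) i)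
  M-suc α k i = *-congˡ (trans (poch-front _ i) (*-congˡ (poch-cong i (p′^-step k))))

  M-suc′ : ∀ α k i → M α k (suc i) ≈
           (1# - α * p ^ k) * poch (α * p ^ suc k) i * (poch (p′ ^ k) i * (1# - p′ ^ k * p ^ i))
  M-suc′ α k i = *-congʳ (trans (poch-front _ i) (*-congˡ (poch-cong i (shift α k))))

  -- The expansion
  --   Aᵏ(b,c;p)ₖ/(Ac,Ab;p)ₖ = ∑ᵢ (A,αpᵏ,p⁻ᵏ;p)ᵢ pⁱ/(p,Ac,Ab;p)ᵢ,  αp = Abc,
  -- is the q-Saalschütz sum; it follows from a recurrence in k, obtained by telescoping in i.
  module Saalschütz (A b c α : Carrier) (αp≈ : α * p ≈ A * b * c)
    (γ : ℕ → Carrier)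
    (γ-suc : ∀ i → γ (suc i) * ((1# - p ^ suc i) * (1# - A * c * p ^ i) * (1# - A * b * p ^ i))
                   ≈ γ i * (p * (1# - A * p ^ i)))
    where

    private
      s = A * b * c

      -- With x = pᵏ, the ratio of consecutive right-hand sides of the expansion is V x / U x. The
      -- factor S comes from U x - V x = (1 - A) S x, the term i = 0 of the telescoping sum divided
      -- by γ 0.
      U V S : Carrier → Carrier
      U x = (1# - A * c * x) * (1# - A * b * x)
      V x = A * ((1# - b * x) * (1# - c * x))
      S x = 1# - s * x * x

      -- The certificate of the recurrence in k, as creative telescoping produces it. Its factor
      -- (p⁻ᵏ;p)ᵢ makes it vanish once i exceeds k.
      H : ℕ → ℕ → Carrier
      H k zero    = 0#
      H k (suc i) = γ i * (1# - A * p ^ i) *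
        (poch (α * p ^ suc k) i * poch (p′ ^ k) i) * (p′ ^ i * S (p ^ k))

      -- What is left of `step` when the negative powers of p are collected in the unit κ and αp is
      -- replaced by s. Here x = pᵏ and w = pⁱ are free variables, so the solver can decide it.
      core : ∀ x w → (1# - p * w) * (1# - A * c * w) * (1# - A * b * w) * (x * p) * S x
        + p * w * ((1# - s * x * w) * (x * p - 1#) * U x)
        - p * w * ((p - s * x) * (x - w) * V x)
        ≈ (1# - A * (p * w)) * (1# - s * x * w) * (p * (x - w)) * S x
      core x w = solve 6 (λ A b c p x w → let s = A :* b :* c; C = A :* c; D = A :* b in
        (1: :- p :* w) :* (1: :- C :* w) :* (1: :- D :* w) :* (x :* p) :* (1: :- s :* x :* x)
        :+ p :* w :* ((1: :- s :* x :* w) :* (x :* p :- 1:) :* ((1: :- C :* x) :* (1: :- D :* x)))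
        :- p :* w :* ((p :- s :* x) :* (x :- w) :* (A :* ((1: :- b :* x) :* (1: :- c :* x))))
        := (1: :- A :* (p :* w)) :* (1: :- s :* x :* w) :* (p :* (x :- w)) :* (1: :- s :* x :* x))
        refl A b c p x w

      αpx : ∀ x w → 1# - α * (p * x) * w ≈ 1# - s * x * w
      αpx x w = 1-cong (trans
        (solve 4 (λ α p x w → α :* (p :* x) :* w := α :* p :* x :* w) refl α p x w)
        (*-congʳ (*-congʳ αp≈)))

      step : ∀ x x′ w w′ → x * x′ ≈ 1# → w * w′ ≈ 1# →
        (1# - p * w) * (1# - A * c * w) * (1# - A * b * w) * (p′ * w′ * S x)
        + ((1# - α * (p * x) * w) * (1# - p′ * x′) * U x
           - (1# - α * x) * (1# - x′ * w) * V x)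
        ≈ (1# - A * (p * w)) * ((1# - α * (p * x) * w) * (1# - x′ * w)) * (p′ * w′ * S x)
      step x x′ w w′ xx′ ww′ = begin
        e * (p′ * w′ * S x)
          + ((1# - α * (p * x) * w) * (1# - p′ * x′) * U x
             - (1# - α * x) * (1# - x′ * w) * V x)
          ≈⟨ +-cong term₁ (+-cong term₂ (-‿cong term₃)) ⟩
        κ * (e * (x * p) * S x)
          + (κ * (p * w * ((1# - s * x * w) * (x * p - 1#) * U x))
             - κ * (p * w * ((p - s * x) * (x - w) * V x)))
          ≈⟨ solve 4 (λ κ x y z → κ :* x :+ (κ :* y :- κ :* z) := κ :* (x :+ y :- z)) refl
               κ _ _ _ ⟩
        κ * (e * (x * p) * S x
          + p * w * ((1# - s * x * w) * (x * p - 1#) * U x)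
          - p * w * ((p - s * x) * (x - w) * V x))
          ≈⟨ *-congˡ (core x w) ⟩
        κ * ((1# - A * (p * w)) * (1# - s * x * w) * (p * (x - w)) * S x)
          ≈⟨ term₄ ⟨
        (1# - A * (p * w)) * ((1# - α * (p * x) * w) * (1# - x′ * w)) * (p′ * w′ * S x)
          ∎
        where
        e = (1# - p * w) * (1# - A * c * w) * (1# - A * b * w)
        κ = p′ * w′ * (p′ * x′)

        u-inv : ∀ {y y′} → y * y′ ≈ 1# → p′ * y′ * (p * y) ≈ 1#
        u-inv {y} {y′} yy′ = trans
          (solve 4 (λ p p′ y y′ → p′ :* y′ :* (p :* y) := p :* p′ :* (y :* y′)) refl p p′ y y′)
          (trans (*-cong pp′≈1 yy′) (*-identityˡ 1#))

        x-w : 1# - x′ * w ≈ x′ * (x - w)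
        x-w = trans (+-congʳ (sym xx′))
          (solve 3 (λ x x′ w → x :* x′ :- x′ :* w := x′ :* (x :- w)) refl x x′ w)

        term₁ : e * (p′ * w′ * S x) ≈ κ * (e * (x * p) * S x)
        term₁ = trans (insert-1 _ (u-inv xx′))
          (solve 7 (λ e S p p′ w′ x x′ →
            e :* (p′ :* w′ :* S) :* (p′ :* x′ :* (p :* x))
            := p′ :* w′ :* (p′ :* x′) :* (e :* (x :* p) :* S)) refl e (S x) p p′ w′ x x′)

        term₂ : (1# - α * (p * x) * w) * (1# - p′ * x′) * U x
                ≈ κ * (p * w * ((1# - s * x * w) * (x * p - 1#) * U x))
        term₂ = trans (*-congʳ (*-cong (αpx x w) (+-congʳ (sym (u-inv xx′)))))
          (trans (insert-1 _ (u-inv ww′))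
            (solve 8 (λ y U p p′ x x′ w w′ →
              y :* (p′ :* x′ :* (p :* x) :- p′ :* x′) :* U :* (p′ :* w′ :* (p :* w))
              := p′ :* w′ :* (p′ :* x′) :* (p :* w :* (y :* (x :* p :- 1:) :* U))) refl
              (1# - s * x * w) (U x) p p′ x x′ w w′))

        p-sx : 1# - α * x ≈ p′ * (p - s * x)
        p-sx = trans (+-cong (sym pp′≈1)
            (-‿cong (trans (insert-1 _ pp′≈1) (trans
              (solve 4 (λ α p p′ x → α :* x :* (p :* p′) := p′ :* (α :* p :* x)) refl α p p′ x)
              (*-congˡ (*-congʳ αp≈))))))
          (solve 3 (λ p p′ y → p :* p′ :- p′ :* y := p′ :* (p :- y)) refl p p′ (s * x))

        term₃ : (1# - α * x) * (1# - x′ * w) * V x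
                ≈ κ * (p * w * ((p - s * x) * (x - w) * V x))
        term₃ = trans (*-congʳ (*-cong p-sx x-w)) (trans (insert-1 _ (u-inv ww′))
          (solve 8 (λ y z V p p′ x′ w w′ →
            p′ :* y :* (x′ :* z) :* V :* (p′ :* w′ :* (p :* w))
            := p′ :* w′ :* (p′ :* x′) :* (p :* w :* (y :* z :* V))) refl
            (p - s * x) (x - w) (V x) p p′ x′ w w′))

        term₄ : (1# - A * (p * w)) * ((1# - α * (p * x) * w) * (1# - x′ * w)) * (p′ * w′ * S x)
                ≈ κ * ((1# - A * (p * w)) * (1# - s * x * w) * (p * (x - w)) * S x)
        term₄ = trans (*-congʳ (*-congˡ (*-cong (αpx x w) x-w))) (trans (insert-1 _ pp′≈1)
          (solve 8 (λ y z v S p p′ x′ w′ →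
            y :* (z :* (x′ :* v)) :* (p′ :* w′ :* S) :* (p :* p′)
            := p′ :* w′ :* (p′ :* x′) :* (y :* z :* (p :* v) :* S)) refl
            (1# - A * (p * w)) (1# - s * x * w) (x - w) (S x) p p′ x′ w′))

      telescope : ∀ k m → ∑ (λ i → γ i * (M α (suc k) i * U (p ^ k) - M α k i * V (p ^ k))) m ≈ H k m
      telescope k zero          = refl
      telescope k (suc zero)    = solve 5 (λ A b c x g →
        con (+ 0) :+ g :* (1: :* 1: :* ((1: :- A :* c :* x) :* (1: :- A :* b :* x))
                  :- 1: :* 1: :* (A :* ((1: :- b :* x) :* (1: :- c :* x))))
        := g :* (1: :- A :* 1:) :* (1: :* 1:) :* (1: :* (1: :- A :* b :* c :* x :* x)))
        refl A b c (p ^ k) (γ 0)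
      telescope k (suc (suc i)) = begin
        ∑ (λ j → γ j * (M α (suc k) j * U x - M α k j * V x)) (suc i)
          + γ (suc i) * (M α (suc k) (suc i) * U x - M α k (suc i) * V x)
          ≈⟨ +-cong (telescope k (suc i)) (*-congˡ (+-cong (*-congʳ (M-suc α k i))
               (-‿cong (*-congʳ (M-suc′ α k i))))) ⟩
        γ i * (1# - A * w) * (Y * Z) * (p′ ^ i * S x)
          + γ (suc i) * (Y * y * ((1# - p′ * x′) * Z) * U x
                         - (1# - α * x) * Y * (Z * z) * V x)
          ≈⟨ +-congʳ (trans (insert-1 _ pp′≈1)
               (solve 7 (λ g a Y Z S p p′ → g :* a :* (Y :* Z) :* S :* (p :* p′)
                 := g :* (p :* a) :* (Y :* Z :* p′ :* S)) refl _ _ _ _ _ _ _)) ⟩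
        γ i * (p * (1# - A * w)) * (Y * Z * p′ * (p′ ^ i * S x))
          + γ (suc i) * (Y * y * ((1# - p′ * x′) * Z) * U x
                         - (1# - α * x) * Y * (Z * z) * V x)
          ≈⟨ +-congʳ (*-congʳ (γ-suc i)) ⟨
        γ (suc i) * e * (Y * Z * p′ * (p′ ^ i * S x))
          + γ (suc i) * (Y * y * ((1# - p′ * x′) * Z) * U x
                         - (1# - α * x) * Y * (Z * z) * V x)
          ≈⟨ solve 13 (λ g e Y Z p′ w′ S y t U αx z V →
               g :* e :* (Y :* Z :* p′ :* (w′ :* S))
               :+ g :* (Y :* y :* (t :* Z) :* U :- αx :* Y :* (Z :* z) :* V)
               := g :* (Y :* Z) :* (e :* (p′ :* w′ :* S) :+ (y :* t :* U :- αx :* z :* V)))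
               refl (γ (suc i)) e Y Z p′ (p′ ^ i) (S x) y (1# - p′ * x′) (U x) (1# - α * x) z (V x) ⟩
        γ (suc i) * (Y * Z) * (e * (p′ * p′ ^ i * S x)
          + (y * (1# - p′ * x′) * U x - (1# - α * x) * z * V x))
          ≈⟨ *-congˡ (step x x′ w (p′ ^ i) (^-inv k) (^-inv i)) ⟩
        γ (suc i) * (Y * Z) * ((1# - A * (p * w)) * (y * z) * (p′ * p′ ^ i * S x))
          ≈⟨ solve 7 (λ g Y Z a y z S → g :* (Y :* Z) :* (a :* (y :* z) :* S)
               := g :* a :* (Y :* y :* (Z :* z)) :* S) refl _ _ _ _ _ _ _ ⟩
        γ (suc i) * (1# - A * (p * w)) * (Y * y * (Z * z)) * (p′ * p′ ^ i * S x)
          ∎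
        where
        x = p ^ k
        x′ = p′ ^ k
        w = p ^ i
        Y = poch (α * p ^ suc k) i
        Z = poch x′ i
        y = 1# - α * (p * x) * w
        z = 1# - x′ * w
        e = (1# - p * w) * (1# - A * c * w) * (1# - A * b * w)

    -- The upper limit K does not depend on k, so that in `transformation` the double sum runs over
    -- a square and its order can be interchanged.
    ρ : ℕ → ℕ → Carrier
    ρ K k = ∑ (λ i → γ i * M α k i) K

    ρ-zero : ∀ K → ρ (suc K) 0 ≈ γ 0
    ρ-zero zero    = solve 1 (λ g → con (+ 0) :+ g :* (1: :* 1:) := g) refl (γ 0)
    ρ-zero (suc K) = trans (+-cong (ρ-zero K) (trans (*-congˡ (M-zero α 0 (suc K) (s≤s z≤n))) (zeroʳ _)))
      (+-identityʳ (γ 0))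

    -- The boundary term of `telescope` contains (p⁻ᵏ;p) of length K - 1 > k, which is 0.
    ρ-suc : ∀ {K k} → suc k < K →
      ρ K (suc k) * ((1# - A * c * p ^ k) * (1# - A * b * p ^ k))
      ≈ ρ K k * (A * ((1# - b * p ^ k) * (1# - c * p ^ k)))
    ρ-suc {suc K} {k} (s≤s k<K) = x∙y⁻¹≈ε⇒x≈y _ _ (begin
      ρ (suc K) (suc k) * U x - ρ (suc K) k * V x
        ≈⟨ solve 4 (λ r u s v → r :* u :- s :* v := u :* r :+ (:- v) :* s) refl _ _ _ _ ⟩
      U x * ρ (suc K) (suc k) + - V x * ρ (suc K) k
        ≈⟨ +-cong (∑-*ˡ (U x) _ (suc K)) (∑-*ˡ (- V x) _ (suc K)) ⟨
      ∑ (λ i → U x * (γ i * M α (suc k) i)) (suc K) + ∑ (λ i → - V x * (γ i * M α k i)) (suc K)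
        ≈⟨ ∑-+ _ _ (suc K) ⟨
      ∑ (λ i → U x * (γ i * M α (suc k) i) + - V x * (γ i * M α k i)) (suc K)
        ≈⟨ ∑-cong (suc K) (λ _ → solve 5 (λ u v g m n →
             u :* (g :* m) :+ (:- v) :* (g :* n) := g :* (m :* u :- n :* v)) refl _ _ _ _ _) ⟩
      ∑ (λ i → γ i * (M α (suc k) i * U x - M α k i * V x)) (suc K)
        ≈⟨ telescope k (suc K) ⟩
      γ K * (1# - A * p ^ K) * (poch (α * p ^ suc k) K * poch (p′ ^ k) K) * (p′ ^ K * S x)
        ≈⟨ *-congʳ (*-congˡ (trans (*-congˡ (poch-p′^ K k<K)) (zeroʳ _))) ⟩
      γ K * (1# - A * p ^ K) * 0# * (p′ ^ K * S x)
        ≈⟨ trans (*-congʳ (zeroʳ _)) (zeroˡ _) ⟩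
      0#                                                        ∎)
      where x = p ^ k

  -- Up to the constant ω 0, ωₖ is (α,d;p)ₖ/((p,αp/d;p)ₖ dᵏ), the part of the well-poised term
  -- outside the Saalschütz expansion. Writing d - αpᵏ⁺¹ for d(1 - αpᵏ⁺¹/d) avoids an inverse of d.
  module Telescoping (α d : Carrier) (ω : ℕ → Carrier)
    (ω-suc : ∀ k → ω (suc k) * ((1# - p ^ suc k) * (d - α * p ^ suc k))
                   ≈ ω k * ((1# - α * p ^ k) * (1# - d * p ^ k)))
    where

    V : ℕ → ℕ → Carrier
    V N i = ∑ (λ k → (1# - α * (p ^ k * p ^ k)) * (ω k * M α k i)) (suc N)

    -- An indefinite summation in k, by induction on the upper limit; this is what admits truncated
    -- series. The factor 1 - dpⁱ stays on the left because it may vanish, as it does for d = p⁻ᴺ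
    -- and i = N.
    V-closed : ∀ N i → (1# - d * p ^ i) * V N i ≈
      ω N * (1# - d * p ^ N) * (poch (α * p ^ N) (suc i) * poch (p′ ^ N) i)
    V-closed zero    zero    = solve 3 (λ α d g →
      (1: :- d :* 1:) :* (con (+ 0) :+ (1: :- α :* (1: :* 1:)) :* (g :* (1: :* 1:)))
      := g :* (1: :- d :* 1:) :* (1: :* (1: :- α :* 1: :* 1:) :* 1:)) refl α d (ω 0)
    V-closed zero    (suc i) = begin
      (1# - d * p ^ suc i) * (0# + (1# - α * (1# * 1#)) * (ω 0 * M α 0 (suc i)))
        ≈⟨ *-congˡ (+-congˡ (*-congˡ (trans (*-congˡ (M-zero α 0 (suc i) (s≤s z≤n))) (zeroʳ _)))) ⟩
      (1# - d * p ^ suc i) * (0# + (1# - α * (1# * 1#)) * 0#)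
        ≈⟨ solve 2 (λ u v → u :* (con (+ 0) :+ v :* con (+ 0)) := con (+ 0)) refl _ _ ⟩
      0#
        ≈⟨ solve 2 (λ u v → con (+ 0) := u :* (v :* con (+ 0))) refl _ _ ⟩
      ω 0 * (1# - d * 1#) * (poch (α * 1#) (suc (suc i)) * 0#)
        ≈⟨ *-congˡ (*-congˡ (poch-one i)) ⟨
      ω 0 * (1# - d * 1#) * (poch (α * 1#) (suc (suc i)) * poch 1# (suc i)) ∎
    V-closed (suc N) i       = begin
      (1# - d * w) * (V N i + (1# - α * (x * x)) * (g * (Y * Z)))
        ≈⟨ distribˡ _ _ _ ⟩
      (1# - d * w) * V N i + (1# - d * w) * ((1# - α * (x * x)) * (g * (Y * Z)))
        ≈⟨ +-congʳ (trans (V-closed N i)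
             (*-congˡ (*-congʳ (trans (poch-front _ i) (*-congˡ (poch-cong i (shift α N))))))) ⟩
      ω N * (1# - d * p ^ N) * ((1# - α * p ^ N) * Y * Z₀)
        + (1# - d * w) * ((1# - α * (x * x)) * (g * (Y * Z)))
        ≈⟨ +-congʳ (trans (solve 5 (λ g u v Y Z → g :* u :* (v :* Y :* Z) := g :* (v :* u) :* (Y :* Z))
             refl _ _ _ _ _) (*-congʳ (sym (ω-suc N)))) ⟩
      g * ((1# - x) * (d - α * x)) * (Y * Z₀)
        + (1# - d * w) * ((1# - α * (x * x)) * (g * (Y * Z)))
        ≈⟨ +-congʳ (trans (solve 5 (λ g u v Y Z → g :* (u :* v) :* (Y :* Z) := g :* (v :* Y) :* (u :* Z))
             refl _ _ _ _ _) (*-congˡ Z₀-Z)) ⟩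
      g * ((d - α * x) * Y) * (Z * (w - x))
        + (1# - d * w) * ((1# - α * (x * x)) * (g * (Y * Z)))
        ≈⟨ solve 7 (λ α d x w g Y Z →
             g :* ((d :- α :* x) :* Y) :* (Z :* (w :- x))
             :+ (1: :- d :* w) :* ((1: :- α :* (x :* x)) :* (g :* (Y :* Z)))
             := g :* (1: :- d :* x) :* (Y :* (1: :- α :* x :* w) :* Z)) refl α d x w g Y Z ⟩
      g * (1# - d * x) * (Y * (1# - α * x * w) * Z) ∎
      where
      x = p ^ suc N
      x′ = p′ ^ suc N
      w = p ^ i
      g = ω (suc N)
      Y = poch (α * x) i
      Z = poch x′ i
      Z₀ = poch (p′ ^ N) i

      Z₀-Z : (1# - x) * Z₀ ≈ Z * (w - x)
      Z₀-Z = begin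
        (1# - x) * Z₀
          ≈⟨ *-congʳ (+-congʳ (sym (^-inv (suc N)))) ⟩
        (x * x′ - x) * Z₀
          ≈⟨ solve 3 (λ x x′ Z → (x :* x′ :- x) :* Z := (:- x) :* ((1: :- x′) :* Z)) refl x x′ Z₀ ⟩
        - x * ((1# - x′) * Z₀)
          ≈⟨ *-congˡ (*-congˡ (poch-cong i (p′^-step N))) ⟨
        - x * ((1# - x′) * poch (x′ * p) i)
          ≈⟨ *-congˡ (poch-front x′ i) ⟨
        - x * (Z * (1# - x′ * w))
          ≈⟨ solve 4 (λ x x′ w Z → (:- x) :* (Z :* (1: :- x′ :* w)) := Z :* (x :* x′ :* w :- x))
               refl x x′ w Z ⟩
        Z * (x * x′ * w - x)
          ≈⟨ *-congˡ (+-congʳ (trans (*-congʳ (^-inv (suc N))) (*-identityˡ w))) ⟩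
        Z * (w - x) ∎

  -- Watson's transformation of a truncated very-well-poised ₆φ₅ into a ₄φ₃:
  -- expand (b,c;p)ₖ/(Ac,Ab;p)ₖ, interchange the sums, and sum over k.
  module Watson (A b c d α : Carrier) (αp≈ : α * p ≈ A * b * c) (iC iB iE : ℕ → Carrier)
    (iC-inv : ∀ j → (1# - A * c * p ^ j) * iC j ≈ 1#)
    (iB-inv : ∀ j → (1# - A * b * p ^ j) * iB j ≈ 1#)
    (iE-inv : ∀ j → (d - α * p ^ suc j) * iE j ≈ 1#)
    where

    -- In the classical notation A = αp/(bc), so αp/b = Ac and αp/c = Ab. The ₆φ₅ has argument
    -- αp/(bcd) = A/d: Aᵏ is in rₖ together with b and c, and d⁻ᵏ is in ωₖ together with α and d.
    γ ω r : ℕ → Carrier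
    γ = ∏ (λ j → p * (1# - A * p ^ j) * (ip j * iC j * iB j))
    ω = ∏ (λ j → (1# - α * p ^ j) * (1# - d * p ^ j) * (ip j * iE j))
    r = ∏ (λ j → A * ((1# - b * p ^ j) * (1# - c * p ^ j)) * (iC j * iB j))

    private

      cancel₂ : ∀ {x x′ y y′} z → x * x′ ≈ 1# → y * y′ ≈ 1# → z * (x′ * y′) * (x * y) ≈ z
      cancel₂ z xx′ yy′ = trans
        (solve 5 (λ x x′ y y′ z → z :* (x′ :* y′) :* (x :* y) := z :* (x :* x′ :* (y :* y′)))
          refl _ _ _ _ z)
        (sym (insert-1 z (trans (*-cong xx′ yy′) (*-identityˡ 1#))))

      γ-suc : ∀ i → γ (suc i) * ((1# - p ^ suc i) * (1# - A * c * p ^ i) * (1# - A * b * p ^ i))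
                    ≈ γ i * (p * (1# - A * p ^ i))
      γ-suc i = trans (*-congʳ (sym (*-assoc _ _ _)))
        (cancel₂ _ (trans
          (solve 4 (λ x x′ y y′ → x :* y :* (x′ :* y′) := x :* x′ :* (y :* y′)) refl _ _ _ _)
          (trans (*-cong (ip-inv i) (iC-inv i)) (*-identityˡ 1#))) (iB-inv i))

      ω-suc : ∀ k → ω (suc k) * ((1# - p ^ suc k) * (d - α * p ^ suc k))
                    ≈ ω k * ((1# - α * p ^ k) * (1# - d * p ^ k))
      ω-suc k = trans (*-congʳ (sym (*-assoc _ _ _))) (cancel₂ _ (ip-inv k) (iE-inv k))

    open Saalschütz A b c α αp≈ γ γ-suc public
    open Telescoping α d ω ω-suc public

    r≈ρ : ∀ {K k} → k < K → r k ≈ ρ K k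
    r≈ρ {suc K} {zero}  _       = sym (ρ-zero K)
    r≈ρ {K}     {suc k} 1+k<K   = begin
      r k * (F * (iC k * iB k))      ≈⟨ *-congʳ (r≈ρ (ℕ.<-trans (ℕ.n<1+n k) 1+k<K)) ⟩
      ρ K k * (F * (iC k * iB k))    ≈⟨ *-assoc _ _ _ ⟨
      ρ K k * F * (iC k * iB k)      ≈⟨ *-congʳ (ρ-suc 1+k<K) ⟨
      ρ K (suc k) * ((1# - A * c * p ^ k) * (1# - A * b * p ^ k)) * (iC k * iB k)
        ≈⟨ cancel₂ _ (trans (*-comm _ _) (iC-inv k)) (trans (*-comm _ _) (iB-inv k)) ⟩
      ρ K (suc k)                    ∎
      where F = A * ((1# - b * p ^ k) * (1# - c * p ^ k))

    transformation : ∀ N → ∑ (λ k → (1# - α * (p ^ k * p ^ k)) * (ω k * r k)) (suc N)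
                           ≈ ∑ (λ i → γ i * V N i) (suc N)
    transformation N = begin
      ∑ (λ k → e k * (ω k * r k)) (suc N)
        ≈⟨ ∑-cong (suc N) (λ {k} k≤N → trans (sym (*-assoc (e k) _ _))
             (trans (*-congˡ (r≈ρ k≤N)) (sym (∑-*ˡ (e k * ω k) _ (suc N))))) ⟩
      ∑ (λ k → ∑ (λ i → e k * ω k * (γ i * M α k i)) (suc N)) (suc N)
        ≈⟨ ∑-comm _ (suc N) (suc N) ⟩
      ∑ (λ i → ∑ (λ k → e k * ω k * (γ i * M α k i)) (suc N)) (suc N)
        ≈⟨ ∑-cong (suc N) (λ {i} _ → trans (∑-cong (suc N) (λ _ →
             solve 4 (λ e w g m → e :* w :* (g :* m) := g :* (e :* (w :* m))) refl _ _ _ _))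
             (∑-*ˡ (γ i) _ (suc N))) ⟩
      ∑ (λ i → γ i * V N i) (suc N)  ∎
      where
      e : ℕ → Carrier
      e k = 1# - α * (p ^ k * p ^ k)

  -- This is p to the power -N(N-1)/2; the product form avoids halving an exponent.
  R′ : ℕ → Carrier
  R′ = ∏ (p′ ^_)

  -- Factor by factor, 1 - y′p⁻ʲ = -y′p⁻ʲ(1 - ypʲ).
  poch-reverse : ∀ {y y′} N → y * y′ ≈ 1# →
                 poch (y′ * p * p′ ^ N) N ≈ (- y′) ^ N * (poch y N * R′ N)
  poch-reverse zero    _ = solve 0 (1: := 1: :* (1: :* 1:)) refl
  poch-reverse {y} {y′} (suc N) yy′ = begin
    poch (y′ * p * p′ ^ suc N) (suc N)
      ≈⟨ poch-front _ N ⟩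
    (1# - y′ * p * p′ ^ suc N) * poch (y′ * p * p′ ^ suc N * p) N
      ≈⟨ *-cong (1-cong (trans (solve 4 (λ y p p′ x → y :* p :* (p′ :* x) := y :* x :* (p :* p′))
                   refl y′ p p′ (p′ ^ N)) (sym (insert-1 _ pp′≈1))))
           (poch-cong N (trans (*-assoc _ _ _) (*-congˡ (p′^-step N)))) ⟩
    (1# - y′ * p′ ^ N) * poch (y′ * p * p′ ^ N) N
      ≈⟨ *-cong factor (poch-reverse N yy′) ⟩
    - y′ * p′ ^ N * (1# - y * p ^ N) * ((- y′) ^ N * (poch y N * R′ N))
      ≈⟨ solve 6 (λ y x u z P R → y :* x :* u :* (z :* (P :* R))
           := y :* z :* (P :* u :* (R :* x))) refl _ _ _ _ _ _ ⟩
    - y′ * (- y′) ^ N * (poch y N * (1# - y * p ^ N) * (R′ N * p′ ^ N))  ∎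
    where
    factor : 1# - y′ * p′ ^ N ≈ - y′ * p′ ^ N * (1# - y * p ^ N)
    factor = trans (+-congʳ (sym (trans (*-cong yy′ (^-inv N)) (*-identityˡ 1#))))
      (solve 4 (λ y y′ x x′ → y :* y′ :* (x :* x′) :- y′ :* x′ := (:- y′) :* x′ :* (1: :- y :* x))
        refl y y′ (p ^ N) (p′ ^ N))

  -- In exponents of p: N² - N(N-1) = N.
  R′-square : ∀ N → (p ^ N) ^ N * (R′ N * R′ N) ≈ p ^ N
  R′-square zero    = solve 0 (1: :* (1: :* 1:) := 1:) refl
  R′-square (suc N) = begin
    p * x * (p * x) ^ N * (R′ N * x′ * (R′ N * x′))
      ≈⟨ *-congʳ (*-congˡ (^-distrib-* p x N)) ⟩
    p * x * (x * x ^ N) * (R′ N * x′ * (R′ N * x′))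
      ≈⟨ solve 5 (λ p x y R x′ → p :* x :* (x :* y) :* (R :* x′ :* (R :* x′))
           := p :* (x :* x′ :* (x :* x′)) :* (y :* (R :* R))) refl p x (x ^ N) (R′ N) x′ ⟩
    p * (x * x′ * (x * x′)) * (x ^ N * (R′ N * R′ N))
      ≈⟨ *-cong (sym (insert-1 p (trans (*-cong (^-inv N) (^-inv N)) (*-identityˡ 1#))))
           (R′-square N) ⟩
    p * x ∎
    where
    x = p ^ N
    x′ = p′ ^ N

-- The very-well-poised sums for p = α⁴

record WellPoisedBase {c ℓ} (R : CommutativeRing c ℓ) : Set (c ⊔ ℓ) where
  open CommutativeRing R
  field
    qBase : QBase R
  open QBase qBase public
  field
    α α′   : Carrier
    αα′≈1  : α * α′ ≈ 1#
    p≈α⁴   : p ≈ α * α * (α * α)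

module WellPoised {c ℓ} (R : CommutativeRing c ℓ) (B : WellPoisedBase R) where

  open CommutativeRing R
  open WellPoisedBase B
  open import Relation.Binary.Reasoning.Setoid setoid
  open import Algebra.Properties.Semiring.Exp semiring using (_^_; ^-congˡ; ^-homo-*)
  open import Algebra.Properties.CommutativeSemiring.Exp commutativeSemiring using (^-distrib-*)
  open IntegerSolver R
  open Iterated R
  open QSeries R qBase

  private
    1: : ∀ {n} → Polynomial n
    1: = con (+ 1)

  1-inverse : ∀ {x y x⁻¹} → x ≈ y → (1# - y) * x⁻¹ ≈ 1# → (1# - x) * x⁻¹ ≈ 1#
  1-inverse x≈y = trans (*-congʳ (1-cong x≈y))

  -- The parameter a is kept general because the formulas are needed both for the indeterminate and
  -- for c in its place.
  module Parameter (a a′ : Carrier) (aa′≈1 : a * a′ ≈ 1#) (ia ia′ : ℕ → Carrier)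
    (ia-inv : ∀ j → (1# - a * p ^ suc j) * ia j ≈ 1#)
    (ia′-inv : ∀ j → (1# - a′ * p ^ suc j) * ia′ j ≈ 1#)
    where

    L D⁻¹ Q : ℕ → Carrier
    L k   = (1# - a * α * p ^ k) * (1# - a′ * α * p ^ k)
    D⁻¹ k = ia k * ia′ k
    Q k   = α * ((1# - α * p ^ k) * ip k)

    -- In closed form α²ᵏ(α;p)ₖ²(aα,α/a;p)ₖ/((p;p)ₖ²(ap,p/a;p)ₖ): the ₆φ₅ term with parameters α,
    -- aα, α/a, apart from its very-well-poised factor. Its argument αp/(α·aα·α/a) = p/α² is α².
    ψ : ℕ → Carrier
    ψ = ∏ (λ k → Q k * Q k * (L k * D⁻¹ k))

    ∑A : ℕ → Carrier
    ∑A N = ∑ (λ k → (1# - α * (p ^ k * p ^ k)) * ψ k) (suc N)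

    private
      αaαa′ : ∀ x → x * (a * α) * (a′ * α) ≈ x * α * α
      αaαa′ x = trans (solve 4 (λ x α a a′ → x :* (a :* α) :* (a′ :* α) := x :* α :* α :* (a :* a′))
        refl x α a a′) (sym (insert-1 _ aa′≈1))

    private
      α³a : ∀ a x → α * α * α * (a * α) * x ≈ a * (p * x)
      α³a a x = trans (solve 3 (λ α a x → α :* α :* α :* (a :* α) :* x
        := a :* ((α :* α :* (α :* α)) :* x)) refl α a x) (*-congˡ (*-congʳ (sym p≈α⁴)))

    -- Here b = aα, c = α/a and d = α, whence A = α³, Ab = ap and Ac = p/a. The choice d = α
    -- produces 1 - αpᴺ twice: as 1 - dpᴺ and as the first factor of (αpᴺ;p)ᵢ₊₁.
    module Truncated where

      open Watson (α * α * α) (a * α) (a′ * α) α α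
        (trans (*-congˡ p≈α⁴) (trans (solve 1 (λ α → α :* (α :* α :* (α :* α))
          := α :* α :* α :* α :* α) refl α) (sym (αaαa′ (α * α * α)))))
        ia′ ia (λ j → ip j * α′)
        (λ j → 1-inverse (α³a a′ (p ^ j)) (ia′-inv j))
        (λ j → 1-inverse (α³a a (p ^ j)) (ia-inv j))
        (λ j → trans (solve 5 (λ α α′ p x i → (α :- α :* (p :* x)) :* (i :* α′)
            := (1: :- p :* x) :* i :* (α :* α′)) refl α α′ p (p ^ j) (ip j))
          (trans (*-cong (ip-inv j) αα′≈1) (*-identityˡ 1#)))

      private

        ω≈ : ∀ N → ω N ≈ poch α N * ∏ ip N * (poch α N * ∏ ip N) * α′ ^ N
        ω≈ zero    = solve 0 (1: := 1: :* 1: :* (1: :* 1:) :* 1:) refl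
        ω≈ (suc N) = trans (*-congʳ (ω≈ N)) (solve 6 (λ P I α′ u i z →
          P :* I :* (P :* I) :* z :* (u :* u :* (i :* (i :* α′)))
          := P :* u :* (I :* i) :* (P :* u :* (I :* i)) :* (α′ :* z)) refl _ _ α′ _ _ _)

        γ≈ : ∀ i → γ i ≈ p ^ i * poch (α * α * α) i * (∏ ia i * ∏ ia′ i) * ∏ ip i
        γ≈ zero    = solve 0 (1: := 1: :* 1: :* (1: :* 1:) :* 1:) refl
        γ≈ (suc i) = trans (*-congʳ (γ≈ i)) (solve 10 (λ p x P I J K u i j k →
          x :* P :* (I :* J) :* K :* (p :* u :* (k :* j :* i))
          := p :* x :* (P :* u) :* (I :* i :* (J :* j)) :* (K :* k)) refl p _ _ _ _ _ _ _ _ _)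

        ψ≈ : ∀ k → ψ k ≈ ω k * r k
        ψ≈ k = trans (∏-cong k (λ {j} _ → factor _ _ _ _ _ _)) (∏-* _ _ k)
          where
          factor : ∀ u i l m j k →
            α * (u * i) * (α * (u * i)) * (l * m * (j * k))
            ≈ u * u * (i * (i * α′)) * (α * α * α * (l * m) * (k * j))
          factor u i l m j k = trans (insert-1 _ αα′≈1)
            (solve 8 (λ α α′ u i l m j k →
              α :* (u :* i) :* (α :* (u :* i)) :* (l :* m :* (j :* k)) :* (α :* α′)
              := u :* u :* (i :* (i :* α′)) :* (α :* α :* α :* (l :* m) :* (k :* j)))
              refl α α′ u i l m j k)

      -- One factor 1 - αpᴺ is put in front, to become [n] after division by 1 - α; the other stays
      -- beside 1/(1 - αpⁱ), whose denominator need not be prime to [n]. The remaining factors are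
      -- grouped so that each group can be shown integral by itself.
      ∑A-expansion : ∀ N (ν : ℕ → Carrier) → (∀ i → (1# - α * p ^ i) * ν i ≈ 1#) →
        ∑A N ≈ (1# - α * p ^ N) * ∑ (λ i →
          p ^ i * poch (α * α * α) i * (∏ ia i * ∏ ia′ i) * (poch (p′ ^ N) i * ∏ ip i) *
          (poch α N * ∏ ip N * (poch α N * ∏ ip N) * α′ ^ N *
            ((1# - α * p ^ N) * ν i) * poch (α * p ^ N * p) i)) (suc N)
      ∑A-expansion N ν ν-inv = begin
        ∑A N                                  ≈⟨ ∑-cong (suc N) (λ {k} _ → *-congˡ (ψ≈ k)) ⟩
        ∑ (λ k → (1# - α * (p ^ k * p ^ k)) * (ω k * r k)) (suc N)
                                              ≈⟨ transformation N ⟩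
        ∑ (λ i → γ i * V N i) (suc N)         ≈⟨ ∑-cong (suc N) (λ {i} _ → term i) ⟩
        ∑ (λ i → (1# - α * p ^ N) * _) (suc N) ≈⟨ ∑-*ˡ _ _ (suc N) ⟩
        _                                     ∎
        where
        v = 1# - α * p ^ N

        term : ∀ i → γ i * V N i ≈ v * (
          p ^ i * poch (α * α * α) i * (∏ ia i * ∏ ia′ i) * (poch (p′ ^ N) i * ∏ ip i) *
          (poch α N * ∏ ip N * (poch α N * ∏ ip N) * α′ ^ N * (v * ν i) * poch (α * p ^ N * p) i))
        term i = begin
          γ i * V N i
            ≈⟨ insert-1 _ (ν-inv i) ⟩
          γ i * V N i * ((1# - α * p ^ i) * ν i)
            ≈⟨ solve 4 (λ g V u n → g :* V :* (u :* n) := g :* (u :* V :* n)) refl _ _ _ _ ⟩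
          γ i * ((1# - α * p ^ i) * V N i * ν i)
            ≈⟨ *-cong (γ≈ i) (*-congʳ (trans (V-closed N i)
                 (*-cong (*-congʳ (ω≈ N)) (*-congʳ (poch-front _ i))))) ⟩
          p ^ i * poch (α * α * α) i * (∏ ia i * ∏ ia′ i) * ∏ ip i *
            (W * v * (v * Y * Z) * ν i)
            ≈⟨ solve 9 (λ x P I J W v Y Z n →
                 x :* P :* I :* J :* (W :* v :* (v :* Y :* Z) :* n)
                 := v :* (x :* P :* I :* (Z :* J) :* (W :* (v :* n) :* Y))) refl _ _ _ _ _ _ _ _ _ ⟩
          v * (p ^ i * poch (α * α * α) i * (∏ ia i * ∏ ia′ i) * (Z * ∏ ip i) *
            (W * (v * ν i) * Y)) ∎
          where
          W = poch α N * ∏ ip N * (poch α N * ∏ ip N) * α′ ^ N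
          Y = poch (α * p ^ N * p) i
          Z = poch (p′ ^ N) i

    -- For a = αpᴺ the series terminates of its own accord: with d = α/a = p⁻ᴺ only the
    -- last term of the transformed series is left.
    module Terminating (N : ℕ) (a≈αpᴺ : a ≈ α * p ^ N) where

      private
        d = a′ * α
        x = p ^ N
        x′ = p′ ^ N

        a′α≈ : d ≈ x′
        a′α≈ = begin
          a′ * α                   ≈⟨ insert-1 _ (^-inv N) ⟩
          a′ * α * (x * x′)
            ≈⟨ solve 4 (λ a α x x′ → a :* α :* (x :* x′) := α :* x :* a :* x′) refl a′ α x x′ ⟩
          α * x * a′ * x′          ≈⟨ *-congʳ (*-congʳ a≈αpᴺ) ⟨
          a * a′ * x′              ≈⟨ *-congʳ aa′≈1 ⟩
          1# * x′                  ≈⟨ *-identityˡ x′ ⟩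
          x′                       ∎

        α′a≈ : α′ * a ≈ x
        α′a≈ = trans (*-congˡ a≈αpᴺ) (trans
          (solve 3 (λ α α′ x → α′ :* (α :* x) := x :* (α :* α′)) refl α α′ x)
          (sym (insert-1 x αα′≈1)))

        A = α * α * α * a′

        Aaα : ∀ y → A * (a * α) * y ≈ p * y
        Aaα y = *-congʳ (trans (solve 3 (λ α a a′ → α :* α :* α :* a′ :* (a :* α)
          := α :* α :* (α :* α) :* (a :* a′)) refl α a a′)
          (trans (sym (insert-1 _ aa′≈1)) (sym p≈α⁴)))

      -- The second α now plays the part of c, and α/a that of d. Then A = α³/a, Ab = p and Ac =
      -- p/a.
      open Watson A (a * α) α d α
        (begin
          α * p                  ≈⟨ *-comm α p ⟩
          p * α                  ≈⟨ *-congʳ (*-identityʳ p) ⟨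
          p * 1# * α             ≈⟨ *-congʳ (Aaα 1#) ⟨
          A * (a * α) * 1# * α   ≈⟨ *-congʳ (*-identityʳ _) ⟩
          A * (a * α) * α        ∎)
        ia′ ip (λ j → α′ * a * ia j)
        (λ j → 1-inverse (trans (*-congʳ (*-assoc _ a′ α)) (α³a a′ (p ^ j))) (ia′-inv j))
        (λ j → 1-inverse (Aaα (p ^ j)) (ip-inv j))
        (λ j → begin
          (a′ * α - α * p ^ suc j) * (α′ * a * ia j)
            ≈⟨ solve 6 (λ α α′ a a′ y i → (a′ :* α :- α :* y) :* (α′ :* a :* i)
                 := α :* α′ :* ((a :* a′ :- a :* y) :* i)) refl α α′ a a′ (p ^ suc j) (ia j) ⟩
          α * α′ * ((a * a′ - a * p ^ suc j) * ia j)
            ≈⟨ *-cong αα′≈1 (*-congʳ (+-congʳ aa′≈1)) ⟩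
          1# * ((1# - a * p ^ suc j) * ia j)
            ≈⟨ trans (*-identityˡ _) (ia-inv j) ⟩
          1# ∎)

      private

        ψ≈ : ∀ k → ψ k ≈ ω k * r k
        ψ≈ k = trans (∏-cong k (λ {j} _ → factor _ _ _ _ _ _)) (∏-* _ _ k)
          where
          factor : ∀ u i l m j k →
            α * (u * i) * (α * (u * i)) * (l * m * (j * k))
            ≈ u * m * (i * (α′ * a * j)) * (A * (l * u) * (k * i))
          factor u i l m j k = trans
            (trans (insert-1 _ αα′≈1) (insert-1 _ aa′≈1))
            (solve 10 (λ α α′ a a′ u i l m j k →
              α :* (u :* i) :* (α :* (u :* i)) :* (l :* m :* (j :* k)) :* (α :* α′) :* (a :* a′)
              := u :* m :* (i :* (α′ :* a :* j)) :* (α :* α :* α :* a′ :* (l :* u) :* (k :* i)))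
              refl α α′ a a′ u i l m j k)

        -- The closed form contains 1 - dpᴺ = 0, whereas 1 - dpⁱ = 1 - p^(i-N) is a unit for i < N.
        V-vanishes : ∀ {i} → i < N → V N i ≈ 0#
        V-vanishes {i} i<N with j , N≡ ← ℕ.m≤n⇒∃[o]m+o≡n i<N = begin
          V N i                                 ≈⟨ insert-1 _ unit ⟩
          V N i * ((1# - d * p ^ i) * z)
            ≈⟨ solve 3 (λ V u z → V :* (u :* z) := u :* V :* z) refl _ _ _ ⟩
          (1# - d * p ^ i) * V N i * z          ≈⟨ *-congʳ (V-closed N i) ⟩
          ω N * (1# - d * x) * Y * z
            ≈⟨ *-congʳ (*-congʳ (*-congˡ (1-≈0 (trans (*-congʳ a′α≈)
                 (trans (*-comm x′ x) (^-inv N)))))) ⟩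
          ω N * 0# * Y * z
            ≈⟨ solve 3 (λ w Y z → w :* con (+ 0) :* Y :* z := con (+ 0)) refl _ _ _ ⟩
          0# ∎
          where
          Y = poch (α * p ^ N) (suc i) * poch (p′ ^ N) i
          z = - (p ^ suc j) * ip j

          dpⁱ : d * p ^ i * p ^ suc j ≈ 1#
          dpⁱ = begin
            d * p ^ i * p ^ suc j         ≈⟨ *-assoc d _ _ ⟩
            d * (p ^ i * p ^ suc j)       ≈⟨ *-congˡ (^-homo-* p i (suc j)) ⟨
            d * p ^ (i ℕ.+ suc j)         ≈⟨ *-cong a′α≈ (reflexive (≡.cong (p ^_) i+1+j≡N)) ⟩
            x′ * x                        ≈⟨ trans (*-comm x′ x) (^-inv N) ⟩
            1#                            ∎
            where i+1+j≡N = ≡.trans (ℕ.+-suc i j) N≡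

          unit : (1# - d * p ^ i) * z ≈ 1#
          unit = begin
            (1# - d * p ^ i) * (- (p ^ suc j) * ip j)
              ≈⟨ solve 3 (λ u y i → (1: :- u) :* ((:- y) :* i) := (u :* y :- y) :* i) refl _ _ _ ⟩
            (d * p ^ i * p ^ suc j - p ^ suc j) * ip j
              ≈⟨ trans (*-congʳ (+-congʳ dpⁱ)) (ip-inv j) ⟩
            1# ∎

        -- At i = N both sides of `V-closed` are 0, so this value is computed directly: (p⁻ᵏ;p) of
        -- length N vanishes for every k < N.
        V-last : V N N ≈ (1# - α * (x * x)) * (ω N * M α N N)
        V-last = trans (+-congʳ (∑-zero N (λ {k} k<N →
          trans (*-congˡ (trans (*-congˡ (M-zero α k N k<N)) (zeroʳ _))) (zeroʳ _)))) (+-identityˡ _)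

        ω≈ : ∀ k → ω k ≈ poch α k * poch d k * ∏ ip k * ((α′ * a) ^ k * ∏ ia k)
        ω≈ zero    = solve 0 (1: := 1: :* 1: :* 1: :* (1: :* 1:)) refl
        ω≈ (suc k) = trans (*-congʳ (ω≈ k)) (solve 10 (λ P Q I z J u v i y j →
          P :* Q :* I :* (z :* J) :* (u :* v :* (i :* (y :* j)))
          := P :* u :* (Q :* v) :* (I :* i) :* (y :* z :* (J :* j))) refl _ _ _ _ _ _ _ _ _ _)

        γ≈ : ∀ i → γ i ≈ p ^ i * poch A i * (∏ ip i * ∏ ia′ i * ∏ ip i)
        γ≈ zero    = solve 0 (1: := 1: :* 1: :* (1: :* 1: :* 1:)) refl
        γ≈ (suc i) = trans (*-congʳ (γ≈ i)) (solve 8 (λ p x P I J u i j →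
          x :* P :* (I :* J :* I) :* (p :* u :* (i :* j :* i))
          := p :* x :* (P :* u) :* (I :* i :* (J :* j) :* (I :* i))) refl p _ _ _ _ _ _ _)

      ∑A-closed : ∑A N ≈ (1# - α * p ^ N) * (poch (α * α) N * ∏ ip N * α′ ^ N)
      ∑A-closed = begin
        ∑A N
          ≈⟨ ∑-cong (suc N) (λ {k} _ → *-congˡ (ψ≈ k)) ⟩
        ∑ (λ k → (1# - α * (p ^ k * p ^ k)) * (ω k * r k)) (suc N)
          ≈⟨ transformation N ⟩
        ∑ (λ i → γ i * V N i) N + γ N * V N N
          ≈⟨ +-congʳ (∑-zero N (λ i<N → trans (*-congˡ (V-vanishes i<N)) (zeroʳ _))) ⟩
        0# + γ N * V N N
          ≈⟨ trans (+-identityˡ _) (*-cong (trans (γ≈ N) (*-congʳ (*-congˡ PA≈))) V-last) ⟩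
        x * (s * (PB * T)) * (I * J * I) * ((1# - α * (x * x)) * (ω N * (poch (α * x) N * poch x′ N)))
          ≈⟨ *-congˡ (*-congˡ (*-cong (trans (ω≈ N)
               (*-cong (*-congʳ (*-congˡ Pd≈)) (*-congʳ (^-congˡ N α′a≈))))
               (*-congˡ (trans (poch-cong N (sym a′α≈)) Pd≈)))) ⟩
        x * (s * (PB * T)) * (I * J * I) *
          ((1# - α * (x * x)) * (Pα * (t * (Pp * T)) * I * (y * K) * (poch (α * x) N * (t * (Pp * T)))))
          -- The factors fall into blocks: `αx-term` leaves 1 - αpᴺ, `s-term` leaves α⁻ᴺ, `x-term`
          -- collects the powers of p into 1, and `Pp` cancels with `I`. Only `PB * I` remains
          -- besides.
          ≈⟨ solve 13 (λ x s B R I J u Pα t Pp y K Y →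
               x :* (s :* (B :* R)) :* (I :* J :* I) :*
                 (u :* (Pα :* (t :* (Pp :* R)) :* I :* (y :* K) :* (Y :* (t :* (Pp :* R)))))
               := B :* I :* (Y :* u :* K) :* (s :* (J :* (Pα :* R)))
                  :* (x :* (y :* (R :* R)) :* (t :* t)) :* (Pp :* I :* (Pp :* I)))
               refl x s PB T I J _ Pα t Pp y K _ ⟩
        PB * I * (poch (α * x) N * (1# - α * (x * x)) * K) * (s * (J * (Pα * T)))
          * (x * (y * (T * T)) * (t * t)) * (Pp * I * (Pp * I))
          ≈⟨ *-cong (*-cong (*-cong (*-congˡ αx-term) s-term) x-term)
               (trans (*-cong Pp-I Pp-I) (*-identityˡ 1#)) ⟩
        PB * I * (1# - α * x) * α′ ^ N * 1# * 1#
          ≈⟨ solve 4 (λ B I u z → B :* I :* u :* z :* 1: :* 1: := u :* (B :* I :* z))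
               refl PB I (1# - α * x) (α′ ^ N) ⟩
        (1# - α * x) * (PB * I * α′ ^ N) ∎
        where
        I = ∏ ip N
        J = ∏ ia′ N
        K = ∏ ia N
        T = R′ N
        PB = poch (α * α) N
        Pα = poch α N
        Pp = poch p N
        s = (- (α′ * α′)) ^ N
        t = (- p′) ^ N
        y = x ^ N

        inverse-∏ : ∀ {f g} n → (∀ j → f j * g j ≈ 1#) → ∏ f n * ∏ g n ≈ 1#
        inverse-∏ n inv = trans (sym (∏-* _ _ n)) (∏-one n (λ {j} _ → inv j))

        a′≈ : a′ ≈ α′ * x′
        a′≈ = trans (insert-1 a′ αα′≈1) (trans
          (solve 3 (λ a α α′ → a :* (α :* α′) := α′ :* (a :* α)) refl a′ α α′) (*-congˡ a′α≈))

        PA≈ : poch A N ≈ s * (PB * T)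
        PA≈ = trans (poch-cong N (begin
            α * α * α * a′                     ≈⟨ *-congˡ a′≈ ⟩
            α * α * α * (α′ * x′)
              ≈⟨ *-congʳ (trans (insert-1 _ αα′≈1) (*-congʳ (*-assoc _ _ _))) ⟩
            α * (α * α) * (α * α′) * (α′ * x′)
              ≈⟨ solve 3 (λ α α′ x → α :* (α :* α) :* (α :* α′) :* (α′ :* x)
                   := α′ :* α′ :* (α :* α :* (α :* α)) :* x) refl α α′ x′ ⟩
            α′ * α′ * (α * α * (α * α)) * x′   ≈⟨ *-congʳ (*-congˡ p≈α⁴) ⟨
            α′ * α′ * p * x′                   ∎))
          (poch-reverse N (trans (solve 2 (λ α α′ → α :* α :* (α′ :* α′) := α :* α′ :* (α :* α′))
            refl α α′) (trans (*-cong αα′≈1 αα′≈1) (*-identityˡ 1#))))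

        Pd≈ : poch d N ≈ t * (Pp * T)
        Pd≈ = trans (poch-cong N (trans a′α≈ (trans (insert-1 x′ pp′≈1)
            (solve 3 (λ p p′ x → x :* (p :* p′) := p′ :* p :* x) refl p p′ x′))))
          (poch-reverse N pp′≈1)

        Pp-I : Pp * I ≈ 1#
        Pp-I = inverse-∏ N ip-inv

        αx-term : poch (α * x) N * (1# - α * (x * x)) * K ≈ 1# - α * x
        αx-term = begin
          poch (α * x) N * (1# - α * (x * x)) * K
            ≈⟨ *-congʳ (*-congˡ (1-cong (*-assoc α x x))) ⟨
          poch (α * x) (suc N) * K                ≈⟨ *-congʳ (poch-front _ N) ⟩
          (1# - α * x) * poch (α * x * p) N * K   ≈⟨ *-assoc _ _ _ ⟩
          (1# - α * x) * (poch (α * x * p) N * K)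
            ≈⟨ *-congˡ (inverse-∏ N (λ j → 1-inverse
                 (trans (*-assoc _ p _) (*-congʳ (sym a≈αpᴺ))) (ia-inv j))) ⟩
          (1# - α * x) * 1#                       ≈⟨ *-identityʳ _ ⟩
          1# - α * x                              ∎

        -- Half of s, namely (-α⁻¹)ᴺ, turns the product `Pα` into its reversal, which is (p/a;p) of
        -- length N and is cancelled by J. The other half is the result.
        s-term : s * (J * (Pα * T)) ≈ α′ ^ N
        s-term = begin
          s * (J * (Pα * T))
            ≈⟨ *-congʳ (trans (^-congˡ N (solve 1 (λ α → :- (α :* α) := α :* (:- α)) refl α′))
                 (^-distrib-* α′ (- α′) N)) ⟩
          α′ ^ N * (- α′) ^ N * (J * (Pα * T))
            ≈⟨ solve 4 (λ z u J P → z :* u :* (J :* P) := z :* (u :* P :* J)) refl _ _ J (Pα * T) ⟩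
          α′ ^ N * ((- α′) ^ N * (Pα * T) * J)
            ≈⟨ *-congˡ (*-congʳ (poch-reverse N αα′≈1)) ⟨
          α′ ^ N * (poch (α′ * p * x′) N * J)
            ≈⟨ *-congˡ (inverse-∏ N (λ j → 1-inverse (trans
                 (solve 4 (λ α p x y → α :* p :* x :* y := α :* x :* (p :* y)) refl α′ p x′ (p ^ j))
                 (*-congʳ (sym a′≈))) (ia′-inv j))) ⟩
          α′ ^ N * 1#                  ≈⟨ *-identityʳ _ ⟩
          α′ ^ N                       ∎

        x-term : x * (y * (T * T)) * (t * t) ≈ 1#
        x-term = begin
          x * (y * (T * T)) * (t * t)
            ≈⟨ *-cong (*-congˡ (R′-square N)) (trans (sym (^-distrib-* (- p′) (- p′) N))
                 (trans (^-congˡ N (solve 1 (λ p → (:- p) :* (:- p) := p :* p) refl p′))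
                   (^-distrib-* p′ p′ N))) ⟩
          x * x * (x′ * x′)
            ≈⟨ solve 2 (λ x x′ → x :* x :* (x′ :* x′) := x :* x′ :* (x :* x′)) refl x x′ ⟩
          x * x′ * (x * x′)   ≈⟨ *-cong (^-inv N) (^-inv N) ⟩
          1# * 1#             ≈⟨ *-identityˡ 1# ⟩
          1#                  ∎

    L₀ : Carrier
    L₀ = (1# - a * α) * (1# - a′ * α)

    ∑B : ℕ → Carrier
    ∑B N = ∑ (λ k → (1# - α * (p ^ k * p ^ k)) * ψ k *
                    (p′ ^ k * ((1# - p ^ k) * (1# - α * p ^ k)))) (suc N)

    -- Since aa′ = 1, only a + a′ is left of the parameter. This serves the telescoping below and,
    -- later, the replacement of a by c.
    linear-factors : ∀ x → (1# - a * x) * (1# - a′ * x) ≈ 1# + x * x - x * (a + a′)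
    linear-factors x = trans (solve 3 (λ a a′ x →
        (1: :- a :* x) :* (1: :- a′ :* x) := 1: :+ a :* a′ :* (x :* x) :- x :* (a :+ a′)) refl a a′ x)
      (+-congʳ (+-congˡ (trans (*-congʳ aa′≈1) (*-identityˡ _))))

    linear-factors-α : ∀ x → (1# - a * α * x) * (1# - a′ * α * x)
                             ≈ 1# + α * x * (α * x) - α * x * (a + a′)
    linear-factors-α x = trans (*-cong (1-cong (*-assoc a α x)) (1-cong (*-assoc a′ α x)))
      (linear-factors (α * x))

    private

      -- With x = pᵏ, the first term is the preceding `remainder` and the right-hand side the
      -- present one, both divided by ψ k. At x = 1 the first term vanishes, which forces the
      -- coefficient L₀.
      gosper : ∀ {x x′} → x * x′ ≈ 1# →
        α * α * x′ * ((1# - x) * (1# - x) * ((1# - a * x) * (1# - a′ * x)))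
        + (1# - α) * (1# - α * (x * x)) * ((1# + α) * (x′ * ((1# - x) * (1# - α * x))) + L₀)
        ≈ (1# - α * x) * (1# - α * x) * ((1# - a * α * x) * (1# - a′ * α * x)) * x′
      gosper {x} {x′} xx′≈1 = begin
        α * α * x′ * ((1# - x) * (1# - x) * ((1# - a * x) * (1# - a′ * x)))
          + (1# - α) * (1# - α * (x * x)) * ((1# + α) * (x′ * ((1# - x) * (1# - α * x))) + L₀)
          ≈⟨ +-cong (*-congˡ (*-congˡ (linear-factors x)))
               (*-congˡ (+-congˡ (trans (insert-1 L₀ xx′≈1) (*-congʳ (linear-factors α))))) ⟩
        α * α * x′ * ((1# - x) * (1# - x) * (1# + x * x - x * y))
          + (1# - α) * (1# - α * (x * x)) *
            ((1# + α) * (x′ * ((1# - x) * (1# - α * x))) + (1# + α * α - α * y) * (x * x′))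
          ≈⟨ solve 4 (λ α x x′ y →
               α :* α :* x′ :* ((1: :- x) :* (1: :- x) :* (1: :+ x :* x :- x :* y))
               :+ (1: :- α) :* (1: :- α :* (x :* x)) :*
                 ((1: :+ α) :* (x′ :* ((1: :- x) :* (1: :- α :* x)))
                  :+ (1: :+ α :* α :- α :* y) :* (x :* x′))
               := (1: :- α :* x) :* (1: :- α :* x) :*
                  (1: :+ α :* x :* (α :* x) :- α :* x :* y) :* x′) refl α x x′ y ⟩
        (1# - α * x) * (1# - α * x) * (1# + α * x * (α * x) - α * x * y) * x′
          ≈⟨ *-congʳ (*-congˡ (linear-factors-α x)) ⟨
        (1# - α * x) * (1# - α * x) * ((1# - a * α * x) * (1# - a′ * α * x)) * x′ ∎
        where y = a + a′

    -- Divided by (1 - α)², the square of 1 - αpᴺ becomes [n]², while L N is (1 - ac)(1 - c/a).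
    remainder : ℕ → Carrier
    remainder N = ψ N * ((1# - α * p ^ N) * (1# - α * p ^ N) * L N * p′ ^ N)

    -- Gosper's algorithm telescopes this combination of the two sums.
    ∑B-∑A : ∀ N → (1# - α) * ((1# + α) * ∑B N + L₀ * ∑A N) ≈ remainder N
    ∑B-∑A zero    = trans
      (solve 3 (λ α u v → let z = con (+ 0) in
        (1: :- α) :* ((1: :+ α) :* (z :+ (1: :- α :* (1: :* 1:)) :* 1:
            :* (1: :* ((1: :- 1:) :* (1: :- α :* 1:))))
          :+ u :* v :* (z :+ (1: :- α :* (1: :* 1:)) :* 1:))
        := 1: :* ((1: :- α :* 1:) :* (1: :- α :* 1:) :* (u :* v) :* 1:))
        refl α (1# - a * α) (1# - a′ * α))
      (*-congˡ (*-congʳ (*-congˡ (*-cong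
        (1-cong (sym (*-identityʳ _))) (1-cong (sym (*-identityʳ _)))))))
    ∑B-∑A (suc N) = begin
      (1# - α) * ((1# + α) * (∑B N + e * ψ′ * b) + L₀ * (∑A N + e * ψ′))
        ≈⟨ solve 7 (λ α B A e ψ b l →
             (1: :- α) :* ((1: :+ α) :* (B :+ e :* ψ :* b) :+ l :* (A :+ e :* ψ))
             := (1: :- α) :* ((1: :+ α) :* B :+ l :* A)
                :+ ψ :* ((1: :- α) :* e :* ((1: :+ α) :* b :+ l)))
             refl α (∑B N) (∑A N) e ψ′ b L₀ ⟩
      (1# - α) * ((1# + α) * ∑B N + L₀ * ∑A N) + ψ′ * ((1# - α) * e * ((1# + α) * b + L₀))
        ≈⟨ +-congʳ (trans (∑B-∑A N) remainder≈) ⟩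
      ψ′ * (α * α * x′ * ((1# - x) * (1# - x) * ((1# - a * x) * (1# - a′ * x))))
        + ψ′ * ((1# - α) * e * ((1# + α) * b + L₀))
        ≈⟨ distribˡ _ _ _ ⟨
      ψ′ * (α * α * x′ * ((1# - x) * (1# - x) * ((1# - a * x) * (1# - a′ * x)))
        + (1# - α) * e * ((1# + α) * b + L₀))
        ≈⟨ *-congˡ (gosper (^-inv (suc N))) ⟩
      remainder (suc N) ∎
      where
      x = p ^ suc N
      x′ = p′ ^ suc N
      ψ′ = ψ (suc N)
      e = 1# - α * (x * x)
      b = x′ * ((1# - x) * (1# - α * x))

      -- The quotient ψ (N + 1)/ψ N contributes α² and `gosper` another α²; their product α⁴ = p
      -- cancels p′. Telescoping depends on this relation between p and α.
      remainder≈ : remainder N ≈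
        ψ′ * (α * α * x′ * ((1# - x) * (1# - x) * ((1# - a * x) * (1# - a′ * x))))
      remainder≈ = sym (begin
        ψ N * (α * (u * i) * (α * (u * i)) * (l * (j * k))) *
          (α * α * (p′ * z) * ((1# - x) * (1# - x) * ((1# - a * x) * (1# - a′ * x))))
          ≈⟨ solve 12 (λ ψ α u i l j k p′ z y v w →
               ψ :* (α :* (u :* i) :* (α :* (u :* i)) :* (l :* (j :* k))) :*
                 (α :* α :* (p′ :* z) :* (y :* y :* (v :* w)))
               := ψ :* (u :* u :* l :* z) :* (α :* α :* (α :* α) :* p′)
                  :* (y :* i :* (y :* i)) :* (v :* j :* (w :* k)))
               refl (ψ N) α u i l j k p′ z (1# - x) (1# - a * x) (1# - a′ * x) ⟩
        remainder N * (α * α * (α * α) * p′) * ((1# - x) * i * ((1# - x) * i))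
          * ((1# - a * x) * j * ((1# - a′ * x) * k))
          ≈⟨ *-cong (*-cong (*-congˡ (trans (*-congʳ (sym p≈α⁴)) pp′≈1))
               (*-cong (ip-inv N) (ip-inv N))) (*-cong (ia-inv N) (ia′-inv N)) ⟩
        remainder N * 1# * (1# * 1#) * (1# * 1#)
          ≈⟨ solve 1 (λ r → r :* 1: :* (1: :* 1:) :* (1: :* 1:) := r) refl _ ⟩
        remainder N ∎)
        where
        u = 1# - α * p ^ N
        i = ip N
        l = L N
        j = ia N
        k = ia′ N
        z = p′ ^ N

    module Summation (q i₁ i₂ i₃ : Carrier) (α≈q² : α ≈ q * q) (i₁-inv : (1# - α) * i₁ ≈ 1#)
      (i₂-inv : (1# - q) * i₂ ≈ 1#) (i₃-inv : (1# + α) * i₃ ≈ 1#)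
      where

      summand : ℕ → Carrier
      summand k = (1# - α * (p ^ k * p ^ k)) * i₁ *
        ((1# - q * p ^ k) * i₂ * ((1# - q * p ^ k) * i₂)) * (ψ k * p′ ^ k)

      private
        summand≈ : ∀ k → summand k ≈
          i₁ * ((1# - α * (p ^ k * p ^ k)) * ψ k)
          + i₁ * (i₂ * i₂) * ((1# - α * (p ^ k * p ^ k)) * ψ k *
              (p′ ^ k * ((1# - p ^ k) * (1# - α * p ^ k))))
        summand≈ k = begin
          e * i₁ * ((1# - q * x) * i₂ * ((1# - q * x) * i₂)) * (ψ k * x′)
            ≈⟨ solve 6 (λ e i j u ψ x → e :* i :* (u :* j :* (u :* j)) :* (ψ :* x)
                 := i :* (j :* j) :* (e :* ψ) :* (u :* u :* x)) refl e i₁ i₂ _ (ψ k) x′ ⟩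
          i₁ * (i₂ * i₂) * (e * ψ k) * ((1# - q * x) * (1# - q * x) * x′)
            ≈⟨ *-congˡ weight ⟩
          i₁ * (i₂ * i₂) * (e * ψ k) * ((1# - q) * (1# - q) + x′ * ((1# - x) * (1# - α * x)))
            ≈⟨ solve 5 (λ i j v u b → i :* (j :* j) :* v :* (u :* u :+ b)
                 := i :* v :* (u :* j :* (u :* j)) :+ i :* (j :* j) :* (v :* b))
                 refl i₁ i₂ (e * ψ k) (1# - q) _ ⟩
          i₁ * (e * ψ k) * ((1# - q) * i₂ * ((1# - q) * i₂))
            + i₁ * (i₂ * i₂) * (e * ψ k * (x′ * ((1# - x) * (1# - α * x))))
            ≈⟨ +-congʳ (sym (insert-1 _ (trans (*-cong i₂-inv i₂-inv) (*-identityˡ 1#)))) ⟩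
          i₁ * (e * ψ k) + i₁ * (i₂ * i₂) * (e * ψ k * (x′ * ((1# - x) * (1# - α * x)))) ∎
          where
          x = p ^ k
          x′ = p′ ^ k
          e = 1# - α * (x * x)

          weight : (1# - q * x) * (1# - q * x) * x′
                   ≈ (1# - q) * (1# - q) + x′ * ((1# - x) * (1# - α * x))
          weight = begin
            (1# - q * x) * (1# - q * x) * x′
              ≈⟨ solve 3 (λ q x x′ → (1: :- q :* x) :* (1: :- q :* x) :* x′
                   := (1: :- q) :* (1: :- q) :* (x :* x′)
                      :+ x′ :* ((1: :- x) :* (1: :- q :* q :* x))) refl q x x′ ⟩
            (1# - q) * (1# - q) * (x * x′) + x′ * ((1# - x) * (1# - q * q * x))
              ≈⟨ +-cong (sym (insert-1 _ (^-inv k)))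
                   (*-congˡ (*-congˡ (1-cong (*-congʳ (sym α≈q²))))) ⟩
            (1# - q) * (1# - q) + x′ * ((1# - x) * (1# - α * x)) ∎

      -- Solving `∑B-∑A` for ∑B introduces 1/(1 + α) and the multiple -L₀ of ∑A. This is the origin
      -- of the last factor of the theorem and of its denominator (1 - q)²(1 + q²).
      ∑-summand : ∀ N → ∑ summand (suc N) ≈
        i₁ * ∑A N * (1# - L₀ * (i₂ * i₂ * i₃)) + i₁ * i₁ * (i₂ * i₂ * i₃) * remainder N
      ∑-summand N = begin
        ∑ summand (suc N)
          ≈⟨ trans (∑-cong (suc N) (λ {k} _ → summand≈ k)) (∑-+ _ _ (suc N)) ⟩
        _ ≈⟨ +-cong (∑-*ˡ i₁ _ (suc N)) (∑-*ˡ (i₁ * (i₂ * i₂)) _ (suc N)) ⟩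
        i₁ * ∑A N + i₁ * (i₂ * i₂) * ∑B N
          ≈⟨ +-congˡ (insert-1 _ (trans (*-cong i₁-inv i₃-inv) (*-identityˡ 1#))) ⟩
        i₁ * ∑A N + i₁ * (i₂ * i₂) * ∑B N * ((1# - α) * i₁ * ((1# + α) * i₃))
          ≈⟨ +-congˡ (solve 6 (λ α i j k A B → let u = 1: :- α in
               i :* (j :* j) :* B :* (u :* i :* ((1: :+ α) :* k))
               := i :* i :* (j :* j :* k) :* (u :* ((1: :+ α) :* B)))
               refl α i₁ i₂ i₃ (∑A N) (∑B N)) ⟩
        i₁ * ∑A N + i₁ * i₁ * (i₂ * i₂ * i₃) * ((1# - α) * ((1# + α) * ∑B N))
          ≈⟨ +-congˡ (solve 6 (λ i w u B l A →
               i :* i :* w :* (u :* B)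
               := i :* i :* w :* (u :* (B :+ l :* A)) :- i :* w :* l :* A :* (u :* i))
               refl i₁ (i₂ * i₂ * i₃) (1# - α) ((1# + α) * ∑B N) L₀ (∑A N)) ⟩
        i₁ * ∑A N + (i₁ * i₁ * (i₂ * i₂ * i₃) * ((1# - α) * ((1# + α) * ∑B N + L₀ * ∑A N))
          - i₁ * (i₂ * i₂ * i₃) * L₀ * ∑A N * ((1# - α) * i₁))
          ≈⟨ +-congˡ (+-cong (*-congˡ (∑B-∑A N)) (-‿cong (sym (insert-1 _ i₁-inv)))) ⟩
        i₁ * ∑A N + (i₁ * i₁ * (i₂ * i₂ * i₃) * remainder N - i₁ * (i₂ * i₂ * i₃) * L₀ * ∑A N)
          ≈⟨ solve 5 (λ i w l A r → i :* A :+ (i :* i :* w :* r :- i :* w :* l :* A)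
               := i :* A :* (1: :- l :* w) :+ i :* i :* w :* r)
               refl i₁ (i₂ * i₂ * i₃) L₀ (∑A N) (remainder N) ⟩
        i₁ * ∑A N * (1# - L₀ * (i₂ * i₂ * i₃)) + i₁ * i₁ * (i₂ * i₂ * i₃) * remainder N ∎

-- Cancellation modulo an element of an integral domain

module DomainProperties {c ℓ} (D : IntegralDomain c ℓ) where

  open IntegralDomain D
  open import Algebra.Properties.Ring ring using (x∙y⁻¹≈ε⇒x≈y)
  open Algebra.Properties.Semiring.Divisibility semiring using (_∣_)
  open Algebra.Properties.Semiring.Primality semiring using (Coprime)
  open import Relation.Binary.Reasoning.Setoid setoid
  open IntegerSolver commutativeRing

  *-cancelˡ : ∀ x {y z} → x ≉ 0# → x * y ≈ x * z → y ≈ z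
  *-cancelˡ x {y} {z} x≉0 xy≈xz =
    [ (λ x≈0 → contradiction x≈0 x≉0) , x∙y⁻¹≈ε⇒x≈y y z ]′ (noZeroDivisor x (y - z)
      (trans (solve 3 (λ x y z → x :* (y :- z) := x :* y :- x :* z) refl x y z)
        (trans (+-congʳ xy≈xz) (-‿inverseʳ _))))

  *-≉0 : ∀ {x y} → x ≉ 0# → y ≉ 0# → x * y ≉ 0#
  *-≉0 {x} {y} x≉0 y≉0 xy≈0 = [ x≉0 , y≉0 ]′ (noZeroDivisor x y xy≈0)

  ∣-difference : ∀ {m x y} → m ∣ x + y → m ∣ x → m ∣ y
  ∣-difference {m} {x} {y} (s , sm≈) (t , tm≈) = s - t , (begin
    (s - t) * m      ≈⟨ solve 3 (λ s t m → (s :- t) :* m := s :* m :- t :* m) refl s t m ⟩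
    s * m - t * m    ≈⟨ +-cong sm≈ (-‿cong tm≈) ⟩
    x + y - x        ≈⟨ solve 2 (λ x y → x :+ y :- x := y) refl x y ⟩
    y                ∎)

  -- Unlike coprimality, this is multiplicative in v without unique factorisation.
  record Regular (m v : Carrier) : Set (c ⊔ ℓ) where
    field
      ≉0     : v ≉ 0#
      cancel : ∀ w → m ∣ v * w → m ∣ w

  open Regular public

  Regular-resp : ∀ {m v v′} → v ≈ v′ → Regular m v → Regular m v′
  Regular-resp v≈v′ v-reg = record
    { ≉0     = λ v′≈0 → ≉0 v-reg (trans v≈v′ v′≈0)
    ; cancel = λ { w (s , e) → cancel v-reg w (s , trans e (*-congʳ (sym v≈v′))) }
    }

  Regular-1 : ∀ {m} → Regular m 1#
  Regular-1 = record
    { ≉0     = 1≉0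
    ; cancel = λ { w (s , e) → s , trans e (*-identityˡ w) }
    }

  Regular-* : ∀ {m v w} → Regular m v → Regular m w → Regular m (v * w)
  Regular-* v-reg w-reg = record
    { ≉0     = *-≉0 (≉0 v-reg) (≉0 w-reg)
    ; cancel = λ { x (s , e) → cancel w-reg x (cancel v-reg _ (s , trans e (*-assoc _ _ x))) }
    }

  Regular-modulus-* : ∀ {m₁ m₂ v} → m₁ ≉ 0# → Regular m₁ v → Regular m₂ v → Regular (m₁ * m₂) v
  Regular-modulus-* {m₁} {m₂} {v} m₁≉0 v-reg₁ v-reg₂ = record
    { ≉0     = ≉0 v-reg₁
    ; cancel = cancel′
    }
    where
    cancel′ : ∀ w → m₁ * m₂ ∣ v * w → m₁ * m₂ ∣ w
    cancel′ w (s , e) with cancel v-reg₁ w (s * m₂ , trans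
        (solve 3 (λ s m n → s :* n :* m := s :* (m :* n)) refl s m₁ m₂) e)
    ... | t , tm₁≈w with cancel v-reg₂ t (s , *-cancelˡ m₁ m₁≉0 (begin
        m₁ * (s * m₂)  ≈⟨ solve 3 (λ s m n → m :* (s :* n) := s :* (m :* n)) refl s m₁ m₂ ⟩
        s * (m₁ * m₂)  ≈⟨ e ⟩
        v * w          ≈⟨ *-congˡ tm₁≈w ⟨
        v * (t * m₁)   ≈⟨ solve 3 (λ v t m → v :* (t :* m) := m :* (v :* t)) refl v t m₁ ⟩
        m₁ * (v * t)   ∎))
    ... | r , rm₂≈t = r , trans
        (solve 3 (λ r m n → r :* (m :* n) := r :* n :* m) refl r m₁ m₂)
        (trans (*-congʳ rm₂≈t) tm₁≈w)

  Regular-modulus-factor : ∀ {m₁ m₂ v} → m₁ ≉ 0# → Regular (m₁ * m₂) v → Regular m₂ v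
  Regular-modulus-factor {m₁} {m₂} {v} m₁≉0 v-reg = record
    { ≉0     = ≉0 v-reg
    ; cancel = cancel′
    }
    where
    cancel′ : ∀ w → m₂ ∣ v * w → m₂ ∣ w
    cancel′ w (s , e) with cancel v-reg (m₁ * w) (s , (begin
        s * (m₁ * m₂)  ≈⟨ solve 3 (λ s m n → s :* (m :* n) := m :* (s :* n)) refl s m₁ m₂ ⟩
        m₁ * (s * m₂)  ≈⟨ *-congˡ e ⟩
        m₁ * (v * w)   ≈⟨ solve 3 (λ m v w → m :* (v :* w) := v :* (m :* w)) refl m₁ v w ⟩
        v * (m₁ * w)   ∎))
    ... | t , t≈ = t , *-cancelˡ m₁ m₁≉0 (trans
      (solve 3 (λ t m n → m :* (t :* n) := t :* (m :* n)) refl t m₁ m₂) t≈)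

  -- If sv = mw, then m divides vs, hence s = tm and w = tv. Constants become regular modulo a
  -- polynomial in this way, by way of the polynomial being regular modulo constants.
  Regular-sym : ∀ {m v} → m ≉ 0# → Regular m v → Regular v m
  Regular-sym {m} {v} m≉0 v-reg = record
    { ≉0     = m≉0
    ; cancel = cancel′
    }
    where
    cancel′ : ∀ w → v ∣ m * w → v ∣ w
    cancel′ w (s , sv≈mw) with cancel v-reg s (w , trans (*-comm w m) (trans (sym sv≈mw) (*-comm s v)))
    ... | t , tm≈s = t , *-cancelˡ m m≉0 (begin
      m * (t * v)  ≈⟨ solve 3 (λ m t v → m :* (t :* v) := t :* m :* v) refl m t v ⟩
      t * m * v    ≈⟨ *-congʳ tm≈s ⟩
      s * v        ≈⟨ sv≈mw ⟩
      m * w        ∎)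

  -- From m ∣ vw follows m ∣ rw. Bézout identities and resultants enter in this form.
  Regular-combination : ∀ {m v r} x y → v ≉ 0# → x * m + y * v ≈ r → Regular m r → Regular m v
  Regular-combination {m} {v} {r} x y v≉0 xm+yv≈r r-reg = record
    { ≉0     = v≉0
    ; cancel = λ { w (s , sm≈vw) → cancel r-reg w (x * w + y * s , (begin
        (x * w + y * s) * m
          ≈⟨ solve 5 (λ x y w s m → (x :* w :+ y :* s) :* m := x :* m :* w :+ y :* (s :* m))
               refl x y w s m ⟩
        x * m * w + y * (s * m)    ≈⟨ +-congˡ (*-congˡ sm≈vw) ⟩
        x * m * w + y * (v * w)
          ≈⟨ solve 5 (λ x y w v m → x :* m :* w :+ y :* (v :* w) := (x :* m :+ y :* v) :* w)
               refl x y w v m ⟩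
        (x * m + y * v) * w        ≈⟨ *-congʳ xm+yv≈r ⟩
        r * w                      ∎)) }
    }

  -- If z divides v and m = m′z, then m divides vm′, hence m′, and this makes z a unit.
  Regular⇒Coprime : ∀ {m v} → m ≉ 0# → Regular m v → Coprime v m
  Regular⇒Coprime {m} {v} m≉0 v-reg {z} (v′ , v′z≈v) (m′ , m′z≈m)
    with cancel v-reg m′ (v′ , (begin
      v′ * m          ≈⟨ *-congˡ m′z≈m ⟨
      v′ * (m′ * z)   ≈⟨ solve 3 (λ v m z → v :* (m :* z) := v :* z :* m) refl v′ m′ z ⟩
      v′ * z * m′     ≈⟨ *-congʳ v′z≈v ⟩
      v * m′          ∎))
  ... | s , sm≈m′ = s , *-cancelˡ m m≉0 (begin
    m * (s * z)   ≈⟨ solve 3 (λ m s z → m :* (s :* z) := s :* m :* z) refl m s z ⟩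
    s * m * z     ≈⟨ *-congʳ sm≈m′ ⟩
    m′ * z        ≈⟨ m′z≈m ⟩
    m             ≈⟨ *-identityʳ m ⟨
    m * 1#        ∎)

-- Abstract, because comparing terms built from concrete fractions would compute them.
record FieldOfFractions {c ℓ} (D : IntegralDomain c ℓ) k ℓ′ : Set (c ⊔ ℓ ⊔ lsuc (k ⊔ ℓ′)) where
  private module D = IntegralDomain D
  field
    commutativeRing : CommutativeRing k ℓ′
  open CommutativeRing commutativeRing public
  field
    ι           : D.Carrier → Carrier
    ι-cong      : ∀ {x y} → x D.≈ y → ι x ≈ ι y
    ι-injective : ∀ {x y} → ι x ≈ ι y → x D.≈ y
    ι-+         : ∀ x y → ι (x D.+ y) ≈ ι x + ι y
    ι-*         : ∀ x y → ι (x D.* y) ≈ ι x * ι y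
    ι-neg       : ∀ x → ι (D.- x) ≈ - ι x
    ι-1         : ι D.1# ≈ 1#
    _⁻¹         : Carrier → Carrier
    *-inverseʳ  : ∀ x → x ≉ 0# → x * x ⁻¹ ≈ 1#

  infix 9 _⁻¹

-- Localisation at the elements regular modulo m

module Localization {c ℓ k ℓ′} (D : IntegralDomain c ℓ) (K : FieldOfFractions D k ℓ′) where

  private module D = IntegralDomain D
  open DomainProperties D
  open Algebra.Properties.Semiring.Divisibility D.semiring using (_∣_)
  open FieldOfFractions K
  open Algebra.Properties.Semiring.Exp semiring using (_^_)
  open import Algebra.Properties.Ring ring using (-‿distribˡ-*)
  open import Relation.Binary.Reasoning.Setoid setoid
  open IntegerSolver commutativeRing
  open Iterated commutativeRing

  ι-0 : ι D.0# ≈ 0#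
  ι-0 = begin
    ι D.0#                       ≈⟨ ι-cong (D.-‿inverseʳ D.1#) ⟨
    ι (D.1# D.- D.1#)            ≈⟨ trans (ι-+ _ _) (+-congˡ (ι-neg _)) ⟩
    ι D.1# - ι D.1#              ≈⟨ -‿inverseʳ _ ⟩
    0#                           ∎

  ι-1- : ∀ {x y} → ι x ≈ y → ι (D.1# D.- x) ≈ 1# - y
  ι-1- e = trans (ι-+ D.1# _) (+-cong ι-1 (trans (ι-neg _) (-‿cong e)))

  ι-≉0 : ∀ {v} → v D.≉ D.0# → ι v ≉ 0#
  ι-≉0 v≉0 e = v≉0 (ι-injective (trans e (sym ι-0)))

  ι-inverse : ∀ {v x} → v D.≉ D.0# → ι v ≈ x → x * x ⁻¹ ≈ 1#
  ι-inverse v≉0 v≈x =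
    *-inverseʳ _ (λ x≈0 → ι-≉0 v≉0 (trans v≈x x≈0))

  ⁻¹-unique : ∀ {x y} → x * y ≈ 1# → x ⁻¹ ≈ y
  ⁻¹-unique {x} {y} xy≈1 = begin
    x ⁻¹             ≈⟨ insert-1 _ xy≈1 ⟩
    x ⁻¹ * (x * y)   ≈⟨ solve 3 (λ x y z → z :* (x :* y) := x :* z :* y) refl x y (x ⁻¹) ⟩
    x * x ⁻¹ * y     ≈⟨ *-congʳ (*-inverseʳ x x≉0) ⟩
    1# * y           ≈⟨ *-identityˡ y ⟩
    y                ∎
    where
    x≉0 : x ≉ 0#
    x≉0 x≈0 = ι-≉0 D.1≉0 (trans ι-1 (trans (sym xy≈1) (trans (*-congʳ x≈0) (zeroˡ y))))

  module _ (m : D.Carrier) where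

    -- Membership in the localisation. Some representation with a regular denominator is enough, so
    -- sums and products need no reduction to lowest terms.
    record Integral (x : Carrier) : Set (c ⊔ ℓ ⊔ ℓ′) where
      constructor integral
      field
        {numerator denominator} : D.Carrier
        regular                 : Regular m denominator
        equation                : x * ι denominator ≈ ι numerator

  module _ {m : D.Carrier} where

    ⟦_⟧-integral : ∀ u → Integral m (ι u)
    ⟦ u ⟧-integral = integral Regular-1 (trans (*-congˡ ι-1) (*-identityʳ _))

    Integral-resp : ∀ {x y} → x ≈ y → Integral m x → Integral m y
    Integral-resp x≈y (integral v e) = integral v (trans (*-congʳ (sym x≈y)) e)

    Integral-+ : ∀ {x y} → Integral m x → Integral m y → Integral m (x + y)
    Integral-+ {x} {y} (integral {u} {v} v-reg e) (integral {u′} {v′} v′-reg e′) =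
      integral {numerator = u D.* v′ D.+ u′ D.* v} (Regular-* v-reg v′-reg) (begin
        (x + y) * ι (v D.* v′)
          ≈⟨ *-congˡ (ι-* v v′) ⟩
        (x + y) * (ι v * ι v′)
          ≈⟨ solve 4 (λ x y v w → (x :+ y) :* (v :* w) := x :* v :* w :+ y :* w :* v) refl x y _ _ ⟩
        x * ι v * ι v′ + y * ι v′ * ι v
          ≈⟨ +-cong (trans (*-congʳ e) (sym (ι-* u v′)))
                    (trans (*-congʳ e′) (sym (ι-* u′ v))) ⟩
        ι (u D.* v′) + ι (u′ D.* v)
          ≈⟨ ι-+ _ _ ⟨
        ι (u D.* v′ D.+ u′ D.* v)     ∎)

    Integral-* : ∀ {x y} → Integral m x → Integral m y → Integral m (x * y)
    Integral-* {x} {y} (integral {u} {v} v-reg e) (integral {u′} {v′} v′-reg e′) =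
      integral {numerator = u D.* u′} (Regular-* v-reg v′-reg) (begin
        x * y * ι (v D.* v′)
          ≈⟨ *-congˡ (ι-* v v′) ⟩
        x * y * (ι v * ι v′)
          ≈⟨ solve 4 (λ x y v w → x :* y :* (v :* w) := x :* v :* (y :* w)) refl x y _ _ ⟩
        x * ι v * (y * ι v′)  ≈⟨ *-cong e e′ ⟩
        ι u * ι u′            ≈⟨ ι-* u u′ ⟨
        ι (u D.* u′)                   ∎)

    Integral-neg : ∀ {x} → Integral m x → Integral m (- x)
    Integral-neg {x} (integral {u} v-reg e) = integral {numerator = D.- u} v-reg
      (trans (sym (-‿distribˡ-* x _)) (trans (-‿cong e) (sym (ι-neg u))))

    Integral-1 : Integral m 1#
    Integral-1 = Integral-resp ι-1 ⟦ D.1# ⟧-integral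

    Integral-1- : ∀ {x} → Integral m x → Integral m (1# - x)
    Integral-1- x-int = Integral-+ Integral-1 (Integral-neg x-int)

    Integral-inverse : ∀ {v x y} → Regular m v → ι v ≈ x → x * y ≈ 1# → Integral m y
    Integral-inverse v-reg v≈x xy≈1 = integral {numerator = D.1#} v-reg
      (trans (*-congˡ v≈x) (trans (*-comm _ _) (trans xy≈1 (sym ι-1))))

    Integral-∏ : ∀ {f} n → (∀ {i} → i < n → Integral m (f i)) → Integral m (∏ f n)
    Integral-∏ zero    f-int = Integral-1
    Integral-∏ (suc n) f-int =
      Integral-* (Integral-∏ n (λ i<n → f-int (ℕ.m<n⇒m<1+n i<n))) (f-int (ℕ.n<1+n n))

    Integral-∑ : ∀ {f} n → (∀ {i} → i < n → Integral m (f i)) → Integral m (∑ f n)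
    Integral-∑ zero    f-int = Integral-resp ι-0 ⟦ D.0# ⟧-integral
    Integral-∑ (suc n) f-int =
      Integral-+ (Integral-∑ n (λ i<n → f-int (ℕ.m<n⇒m<1+n i<n))) (f-int (ℕ.n<1+n n))

    Integral-^ : ∀ {x} k → Integral m x → Integral m (x ^ k)
    Integral-^ zero    x-int = Integral-1
    Integral-^ (suc k) x-int = Integral-* x-int (Integral-^ k x-int)


  -- Write g = u/v and h = u′/v′. Then ng = eh shows that e divides v′nu; modulo e both v′ and n can
  -- be cancelled, so e divides u. Only g has to be integral for the whole modulus.
  common-multiple : ∀ {x g h n e} → Regular e n →
    x ≈ ι n * g → Integral (n D.* e) g → x ≈ ι e * h → Integral e h →
    ∃[ u ] ∃[ v ] Regular (n D.* e) v × (n D.* e) ∣ u × x * ι v ≈ ι u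
  common-multiple {x} {g} {h} {n} {e} n-reg x≈ng (integral {u} {v} v-reg gv≈u)
    x≈eh (integral {u′} {v′} v′-reg hv′≈u′)
    with cancel n-reg u (cancel v′-reg _ (u′ D.* v , ι-injective (begin
      ι (u′ D.* v D.* e)
        ≈⟨ trans (ι-* _ e) (*-congʳ (ι-* u′ v)) ⟩
      ι u′ * ι v * ι e
        ≈⟨ *-congʳ (*-congʳ hv′≈u′) ⟨
      h * ι v′ * ι v * ι e
        ≈⟨ solve 4 (λ h w v e → h :* w :* v :* e := e :* h :* v :* w) refl h _ _ _ ⟩
      ι e * h * ι v * ι v′
        ≈⟨ *-congʳ (*-congʳ (trans (sym x≈eh) x≈ng)) ⟩
      ι n * g * ι v * ι v′
        ≈⟨ solve 4 (λ n g v w → n :* g :* v :* w := w :* (n :* (g :* v))) refl _ g _ _ ⟩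
      ι v′ * (ι n * (g * ι v))
        ≈⟨ *-congˡ (*-congˡ gv≈u) ⟩
      ι v′ * (ι n * ι u)
        ≈⟨ trans (ι-* v′ _) (*-congˡ (ι-* n u)) ⟨
      ι (v′ D.* (n D.* u)) ∎)))
  ... | s , se≈u = n D.* u , v , v-reg ,
      (s , D.trans (D.*-congˡ (D.*-comm n e)) (D.trans (D.sym (D.*-assoc s e n))
        (D.trans (D.*-congʳ se≈u) (D.*-comm u n)))) ,
      trans (*-congʳ x≈ng) (trans (*-assoc _ g _) (trans (*-congˡ gv≈u) (sym (ι-* n u))))

-- Regularity in a polynomial ring

module RegularPolynomials {c ℓ} (D : IntegralDomain c ℓ) where

  E : IntegralDomain c ℓ
  E = PolynomialDomain.polynomialDomain D

  private
    module D = IntegralDomain D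
    module E = IntegralDomain E
  open D using (0#; 1#)
  open Polynomials D.commutativeRing
  open DomainProperties D using (Regular; ≉0; cancel; ∣-difference)
  open DomainProperties E using () renaming (Regular to Regularᴱ)
  open Algebra.Properties.Semiring.Divisibility D.semiring using (_∣_; ∣-respʳ)
  open Algebra.Properties.Semiring.Divisibility E.semiring using () renaming (_∣_ to _∣ᴱ_)
  open IntegerSolver D.commutativeRing using (solve; _:=_; _:+_; _:*_; _:-_; con)
  open import Relation.Binary.Reasoning.Setoid D.setoid

  coeff-*-const : ∀ p m i → coeff (p * const m) i D.≈ coeff p i D.* m
  coeff-*-const p m i = begin
    coeff (p * const m) i                            ≈⟨ coeff-≈ (*-∷ p m []) i ⟩
    coeff (m · p + (0# ∷ p * [])) i                  ≈⟨ coeff-+ (m · p) _ i ⟩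
    coeff (m · p) i D.+ coeff (0# ∷ p * []) i
      ≈⟨ D.+-cong (coeff-· m p i) (coeff-≈ (≈-trans (∷-cong D.refl (*-zeroʳ p)) 0∷[]≈[]) i) ⟩
    m D.* coeff p i D.+ 0#                           ≈⟨ D.+-identityʳ _ ⟩
    m D.* coeff p i                                  ≈⟨ D.*-comm m _ ⟩
    coeff p i D.* m                                  ∎

  const-∣⇒ : ∀ {m p} → const m ∣ᴱ p → ∀ i → m ∣ coeff p i
  const-∣⇒ {m} {p} (s , e) i =
    coeff s i , D.trans (D.sym (coeff-*-const s m i)) (coeff-≈ e i)

  const-∣⇐ : ∀ {m} p → (∀ i → m ∣ coeff p i) → const m ∣ᴱ p
  const-∣⇐ []      m∣ = [] , ≈-refl
  const-∣⇐ (x ∷ p) m∣ with m∣ 0 | const-∣⇐ p (λ i → m∣ (suc i))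
  ... | t , tm≈x | s , e = t ∷ s , ∷-cong (D.trans (D.+-identityʳ _) tm≈x) e

  coeff₀-* : ∀ p r → coeff (p * r) 0 D.≈ coeff p 0 D.* coeff r 0
  coeff₀-* []      r = D.sym (D.zeroˡ _)
  coeff₀-* (x ∷ p) r = D.trans (coeff-+ (x · r) _ 0)
    (D.trans (D.+-identityʳ _) (coeff-· x r 0))

  coeff-*-∷₀ : ∀ p x r → coeff (p * (x ∷ r)) 0 D.≈ coeff p 0 D.* x
  coeff-*-∷₀ p x r = coeff₀-* p (x ∷ r)

  coeff-*-∷ : ∀ p x r i → coeff (p * (x ∷ r)) (suc i) D.≈ x D.* coeff p (suc i) D.+ coeff (p * r) i
  coeff-*-∷ p x r i = D.trans (coeff-≈ (*-∷ p x r) (suc i))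
    (D.trans (coeff-+ (x · p) _ (suc i)) (D.+-congʳ (coeff-· x p (suc i))))

  ∣ˡ : ∀ {m x} y → m ∣ x → m ∣ x D.* y
  ∣ˡ y (s , sm≈x) = y D.* s , D.trans (D.*-assoc y s _) (D.trans (D.*-congˡ sm≈x) (D.*-comm y _))

  -- As with power series, the coefficients of the cofactor are treated from the lowest upwards: the
  -- constant term of p is cancelled, and what it contributes to the higher coefficients is
  -- subtracted.
  regular-constant-term : ∀ {m} p → Regular m (coeff p 0) → Regularᴱ (const m) p
  regular-constant-term {m} p p₀-reg = record
    { ≉0     = λ p≈0 → ≉0 p₀-reg (coeff-≈ p≈0 0)
    ; cancel = λ r m∣pr → const-∣⇐ r (coeffs r (const-∣⇒ m∣pr))
    }
    where
    coeffs : ∀ r → (∀ i → m ∣ coeff (p * r) i) → ∀ i → m ∣ coeff r i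
    coeffs []      _    i = 0# , D.zeroˡ m
    coeffs (x ∷ r) m∣pr = λ where
        zero    → m∣x
        (suc i) → coeffs r (λ j → ∣-difference
          (∣-respʳ (coeff-*-∷ p x r j) (m∣pr (suc j))) (∣ˡ _ m∣x)) i
      where
      m∣x : m ∣ x
      m∣x = cancel p₀-reg x (∣-respʳ (coeff-*-∷₀ p x r) (m∣pr 0))

  X-regular : ∀ m → Regularᴱ (const m) X
  X-regular m = record
    { ≉0     = λ X≈0 → D.1≉0 (coeff-≈ X≈0 1)
    ; cancel = λ r m∣Xr → const-∣⇐ r (λ i →
        ∣-respʳ (X-coeff r i) (const-∣⇒ m∣Xr (suc i)))
    }
    where
    X-coeff : ∀ r i → coeff (X * r) (suc i) D.≈ coeff r i
    X-coeff r i = begin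
      coeff (X * r) (suc i)                    ≈⟨ coeff-≈ (0∷-* (1# ∷ []) r) (suc i) ⟩
      coeff (const 1# * r) i                   ≈⟨ coeff-≈ (*-identityˡ r) i ⟩
      coeff r i                                ∎

  regular-monic : ∀ {r} x → r D.≉ 0# → Regularᴱ (const r) (X + - const x)
  regular-monic {m} x m≉0 = record
    { ≉0     = λ e → D.1≉0 (coeff-≈ e 1)
    ; cancel = λ r m∣vr → const-∣⇐ r (descend r (λ i →
        ∣-respʳ (difference r i) (const-∣⇒ m∣vr (suc i))))
    }
    where
    difference : ∀ r i → coeff ((X + - const x) * r) (suc i)
                 D.≈ coeff r i D.- x D.* coeff r (suc i)
    difference r i = begin
      coeff (((0# D.- x) · r) + (0# ∷ const 1# * r)) (suc i)
        ≈⟨ coeff-+ ((0# D.- x) · r) _ (suc i) ⟩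
      coeff ((0# D.- x) · r) (suc i) D.+ coeff (const 1# * r) i
        ≈⟨ D.+-cong (coeff-· _ r (suc i)) (coeff-≈ (*-identityˡ r) i) ⟩
      (0# D.- x) D.* coeff r (suc i) D.+ coeff r i
        ≈⟨ solve 3 (λ x y z → (con (+ 0) :- x) :* y :+ z := z :- x :* y) D.refl _ _ _ ⟩
      coeff r i D.- x D.* coeff r (suc i) ∎

    -- The leading coefficient is reached at the end of the list.
    descend : ∀ r → (∀ i → m ∣ coeff r i D.- x D.* coeff r (suc i)) → ∀ i → m ∣ coeff r i
    descend []      _ i = 0# , D.zeroˡ m
    descend (y ∷ r) h = λ where
        zero    → ∣-difference (∣-respʳ
          (solve 2 (λ y z → y :- z := (con (+ 0) :- z) :+ y) D.refl y _) (h 0))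
          (∣-respʳ (solve 2 (λ x z → z :* (con (+ 0) :- x) := con (+ 0) :- x :* z) D.refl x _)
            (∣ˡ _ (tail-∣ 0)))
        (suc i) → tail-∣ i
      where
      tail-∣ : ∀ i → m ∣ coeff r i
      tail-∣ = descend r (λ i → h (suc i))

-- Comaximality of q-integers

cancel-factor : ∀ {g C D} x y C′ D′ → C ≡ C′ ℕ.* suc g → D ≡ D′ ℕ.* suc g →
                suc g ℕ.+ y ℕ.* D ≡ x ℕ.* C → 1 ℕ.+ y ℕ.* D′ ≡ x ℕ.* C′
cancel-factor {g} {C} {D} x y C′ D′ C≡ D≡ e = ℕ.*-cancelʳ-≡ _ _ (suc g) (begin
  (1 ℕ.+ y ℕ.* D′) ℕ.* suc g        ≡⟨ ≡.cong (suc g ℕ.+_) (ℕ.*-assoc y D′ (suc g)) ⟩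
  suc g ℕ.+ y ℕ.* (D′ ℕ.* suc g)    ≡⟨ ≡.cong (λ k → suc g ℕ.+ y ℕ.* k) D≡ ⟨
  suc g ℕ.+ y ℕ.* D                 ≡⟨ ≡.trans e (≡.cong (x ℕ.*_) C≡) ⟩
  x ℕ.* (C′ ℕ.* suc g)              ≡⟨ ℕ.*-assoc x C′ (suc g) ⟨
  x ℕ.* C′ ℕ.* suc g                ∎)
  where open ≡.≡-Reasoning

module Comaximality {c ℓ} (R : CommutativeRing c ℓ) where

  open CommutativeRing R
  open Algebra.Properties.Semiring.Exp semiring using (_^_; ^-assocʳ; ^-congˡ; ^-congʳ)
  open Algebra.Properties.Semiring.Mult semiring using () renaming (_×_ to _×ᵣ_)
  open import Relation.Binary.Reasoning.Setoid setoid
  open IntegerSolver R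

  private
    1: : ∀ {n} → Polynomial n
    1: = con (+ 1)

  -- Bézout identities in the ring itself can be multiplied without factoring anything; they replace
  -- an inspection of the cyclotomic factors of [n].
  Comaximal : Carrier → Carrier → Set _
  Comaximal x y = ∃[ s ] ∃[ t ] s * x + t * y ≈ 1#

  Comaximal-sym : ∀ {x y} → Comaximal x y → Comaximal y x
  Comaximal-sym (s , t , e) = t , s , trans (+-comm _ _) e

  Comaximal-resp : ∀ {x y x′ y′} → x ≈ x′ → y ≈ y′ → Comaximal x y → Comaximal x′ y′
  Comaximal-resp x≈ y≈ (s , t , e) =
    s , t , trans (+-cong (*-congˡ (sym x≈)) (*-congˡ (sym y≈))) e

  Comaximal-* : ∀ {x y m} → Comaximal x m → Comaximal y m → Comaximal (x * y) m
  Comaximal-* {x} {y} {m} (s , t , e) (s′ , t′ , e′) =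
    s * s′ , s * x * t′ + t * (s′ * y) + t * t′ * m , (begin
      s * s′ * (x * y) + (s * x * t′ + t * (s′ * y) + t * t′ * m) * m
        ≈⟨ solve 7 (λ s t s′ t′ x y m →
             s :* s′ :* (x :* y) :+ (s :* x :* t′ :+ t :* (s′ :* y) :+ t :* t′ :* m) :* m
             := (s :* x :+ t :* m) :* (s′ :* y :+ t′ :* m)) refl s t s′ t′ x y m ⟩
      (s * x + t * m) * (s′ * y + t′ * m)   ≈⟨ *-cong e e′ ⟩
      1# * 1#                               ≈⟨ *-identityˡ 1# ⟩
      1#                                    ∎)

  Comaximal-^ : ∀ {x m} k → Comaximal x m → Comaximal (x ^ k) m
  Comaximal-^ zero    _ = 1# , 0# , trans (+-cong (*-identityˡ 1#) (zeroˡ _)) (+-identityʳ 1#)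
  Comaximal-^ (suc k) e = Comaximal-* e (Comaximal-^ k e)

  Comaximal-factorˡ : ∀ {x y m} → Comaximal (x * y) m → Comaximal x m
  Comaximal-factorˡ {x} {y} (s , t , e) = s * y , t , trans
    (+-congʳ (solve 3 (λ s x y → s :* y :* x := s :* (x :* y)) refl s x y)) e

  -- The q-integer [n] in base z, free of division.
  geometric : Carrier → ℕ → Carrier
  geometric z zero    = 0#
  geometric z (suc n) = 1# + z * geometric z n

  geometric-sum : ∀ z n → (1# - z) * geometric z n ≈ 1# - z ^ n
  geometric-sum z zero    = trans (zeroʳ _) (sym (-‿inverseʳ 1#))
  geometric-sum z (suc n) = begin
    (1# - z) * (1# + z * geometric z n)
      ≈⟨ solve 2 (λ z s → (1: :- z) :* (1: :+ z :* s) := 1: :- z :+ z :* ((1: :- z) :* s)) refl z _ ⟩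
    1# - z + z * ((1# - z) * geometric z n)   ≈⟨ +-congˡ (*-congˡ (geometric-sum z n)) ⟩
    1# - z + z * (1# - z ^ n)
      ≈⟨ solve 2 (λ z y → 1: :- z :+ z :* (1: :- y) := 1: :- z :* y) refl z _ ⟩
    1# - z * z ^ n                            ∎

  geometric-+ : ∀ z m n → geometric z (m ℕ.+ n) ≈ geometric z m + z ^ m * geometric z n
  geometric-+ z zero    n = solve 1 (λ s → s := con (+ 0) :+ 1: :* s) refl _
  geometric-+ z (suc m) n = trans (+-congˡ (*-congˡ (geometric-+ z m n)))
    (solve 4 (λ z s y t → 1: :+ z :* (s :+ y :* t) := 1: :+ z :* s :+ z :* y :* t) refl z _ _ _)

  geometric-* : ∀ z m n → geometric z (m ℕ.* n) ≈ geometric z m * geometric (z ^ m) n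
  geometric-* z m zero    rewrite ℕ.*-zeroʳ m = sym (zeroʳ _)
  geometric-* z m (suc n) rewrite ℕ.*-suc m n = begin
    geometric z (m ℕ.+ m ℕ.* n)                     ≈⟨ geometric-+ z m (m ℕ.* n) ⟩
    geometric z m + z ^ m * geometric z (m ℕ.* n)   ≈⟨ +-congˡ (*-congˡ (geometric-* z m n)) ⟩
    geometric z m + z ^ m * (geometric z m * geometric (z ^ m) n)
      ≈⟨ solve 3 (λ s y t → s :+ y :* (s :* t) := s :* (1: :+ y :* t)) refl _ _ _ ⟩
    geometric z m * (1# + z ^ m * geometric (z ^ m) n) ∎

  geometric-at-1 : ∀ z n → ∃[ h ] geometric z n ≈ n ×ᵣ 1# + (1# - z) * h
  geometric-at-1 z zero    = 0# , sym (trans (+-identityˡ _) (zeroʳ _))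
  geometric-at-1 z (suc n) with h , e ← geometric-at-1 z n = h - geometric z n , (begin
    1# + z * geometric z n
      ≈⟨ solve 2 (λ z s → 1: :+ z :* s := 1: :+ (s :- (1: :- z) :* s)) refl z _ ⟩
    1# + (geometric z n - (1# - z) * geometric z n)
      ≈⟨ +-congˡ (+-congʳ e) ⟩
    1# + (n ×ᵣ 1# + (1# - z) * h - (1# - z) * geometric z n)
      ≈⟨ solve 4 (λ z k h s → 1: :+ (k :+ (1: :- z) :* h :- (1: :- z) :* s)
           := 1: :+ k :+ (1: :- z) :* (h :- s)) refl z _ h _ ⟩
    1# + n ×ᵣ 1# + (1# - z) * (h - geometric z n) ∎)

  base-comaximal : ∀ z n → Comaximal z (geometric z (suc n))
  base-comaximal z n = - geometric z n , 1# ,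
    solve 2 (λ z s → (:- s) :* z :+ 1: :* (1: :+ z :* s) := 1:) refl z _

  -- The numerical identity lifts to [xm] = 1 + z[yn], where [m] divides [xm] and [n] divides [yn].
  bézout-comaximal : ∀ z {m n} x y → 1 ℕ.+ y ℕ.* n ≡ x ℕ.* m →
                     Comaximal (geometric z m) (geometric z n)
  bézout-comaximal z {m} {n} x y e =
    geometric (z ^ m) x , - (z * geometric (z ^ n) y) , (begin
      geometric (z ^ m) x * geometric z m + - (z * geometric (z ^ n) y) * geometric z n
        ≈⟨ solve 5 (λ z a b s t → a :* s :+ (:- (z :* b)) :* t := s :* a :- z :* (t :* b))
             refl z _ _ _ _ ⟩
      geometric z m * geometric (z ^ m) x - z * (geometric z n * geometric (z ^ n) y)
        ≈⟨ +-cong (geometric-* z m x) (-‿cong (*-congˡ (geometric-* z n y))) ⟨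
      geometric z (m ℕ.* x) - z * geometric z (n ℕ.* y)
        ≡⟨ ≡.cong₂ (λ i j → geometric z i - z * geometric z j)
             (≡.trans (ℕ.*-comm m x) (≡.sym e)) (ℕ.*-comm n y) ⟩
      1# + z * geometric z (y ℕ.* n) - z * geometric z (y ℕ.* n)
        ≈⟨ solve 1 (λ s → 1: :+ s :- s := 1:) refl _ ⟩
      1# ∎)

  module _ (ℕ⁻¹ : ∀ n → ∃[ u ] u * (suc n ×ᵣ 1#) ≈ 1#) where

    -- Modulo 1 - z, and so modulo its divisor y, the q-integer becomes the integer n + 1, a unit by
    -- `ℕ⁻¹`.
    geometric-comaximal : ∀ {z y w} n → 1# - z ≈ w * y → Comaximal (geometric z (suc n)) y
    geometric-comaximal {z} {y} {w} n 1-z≈wy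
      with h , e ← geometric-at-1 z (suc n) | u , u-inv ← ℕ⁻¹ n = u , - (u * h * w) , (begin
        u * geometric z (suc n) + - (u * h * w) * y
          ≈⟨ +-congʳ (*-congˡ (trans e (+-congˡ (*-congʳ 1-z≈wy)))) ⟩
        u * (suc n ×ᵣ 1# + w * y * h) + - (u * h * w) * y
          ≈⟨ solve 5 (λ u k w y h → u :* (k :+ w :* y :* h) :+ (:- (u :* h :* w)) :* y := u :* k)
               refl u (suc n ×ᵣ 1#) w y h ⟩
        u * (suc n ×ᵣ 1#)  ≈⟨ u-inv ⟩
        1#                 ∎)

    1-base-comaximal : ∀ z n → Comaximal (1# - z) (geometric z (suc n))
    1-base-comaximal z n = Comaximal-sym (geometric-comaximal n (sym (*-identityˡ _)))

    -- Let g = gcd(B,n) and Z = z^g. Since g divides A, the factor 1 - Z cancels from the ratio and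
    -- leaves v = [B/g] in base Z as denominator. Now [n] is [g] in base z times [n/g] in base Z.
    -- For the first factor, [g] divides 1 - Z, modulo which v is the integer B/g; for the second,
    -- B/g and n/g are coprime.
    power-ratio : ∀ z n A B → B > 0 → gcd B n ℕ.∣ A →
      ∃[ u ] ∃[ v ] Comaximal v (geometric z n) × (∃[ w ] v * w ≈ 1# - z ^ B) ×
        (1# - z ^ A) * v ≈ u * (1# - z ^ B)
    power-ratio z n A B B>0 (divides A′ A≡)
      with gcd B n in g≡ | gcd[m,n]∣m B n | gcd[m,n]∣n B n | gcd[m,n]≢0 B n (inj₁ (ℕ.>⇒≢ B>0))
         | Bézout.identity (gcd-GCD B n)
    ... | zero  | _                | _             | g≢0 | _ = contradiction ≡.refl g≢0
    ... | suc g | divides zero B≡  | _             | _   | _ = contradiction B≡ (ℕ.>⇒≢ B>0)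
    ... | suc g | divides B′@(suc B″) B≡ | divides n′ n≡ | _ | bézout =
      geometric Z A′ , geometric Z B′ ,
      Comaximal-resp refl
        (trans (sym (geometric-* z (suc g) n′))
          (reflexive (≡.cong (geometric z) (≡.trans (ℕ.*-comm (suc g) n′) (≡.sym n≡)))))
        (Comaximal-sym (Comaximal-*
          (Comaximal-sym (geometric-comaximal B″ (sym (geometric-sum z (suc g)))))
          (Comaximal-sym (coprime bézout)))) ,
      (1# - Z , trans (*-comm _ _) (sym (1-power B′ B≡))) ,
      (begin
        (1# - z ^ A) * geometric Z B′          ≈⟨ *-congʳ (1-power A′ A≡) ⟩
        (1# - Z) * geometric Z A′ * geometric Z B′
          ≈⟨ solve 3 (λ x a b → x :* a :* b := a :* (x :* b)) refl _ _ _ ⟩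
        geometric Z A′ * ((1# - Z) * geometric Z B′)
          ≈⟨ *-congˡ (1-power B′ B≡) ⟨
        geometric Z A′ * (1# - z ^ B) ∎)
      where
      Z = z ^ suc g

      1-power : ∀ {C} C′ → C ≡ C′ ℕ.* suc g → 1# - z ^ C ≈ (1# - Z) * geometric Z C′
      1-power {C} C′ C≡ = begin
        1# - z ^ C               ≡⟨ ≡.cong (λ k → 1# - z ^ k) (≡.trans C≡ (ℕ.*-comm C′ (suc g))) ⟩
        1# - z ^ (suc g ℕ.* C′)  ≈⟨ +-congˡ (-‿cong (^-assocʳ z (suc g) C′)) ⟨
        1# - Z ^ C′              ≈⟨ geometric-sum Z C′ ⟨
        (1# - Z) * geometric Z C′ ∎

      coprime : Bézout.Identity (suc g) B n → Comaximal (geometric Z B′) (geometric Z n′)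
      coprime (Bézout.+- x y e) = bézout-comaximal Z x y (cancel-factor x y B′ n′ B≡ n≡ e)
      coprime (Bézout.-+ x y e) = Comaximal-sym
        (bézout-comaximal Z y x (cancel-factor y x n′ B′ n≡ B≡ e))

    -- A common zero z would give zⁿ = 1 and zʲ = -1, hence 1 = (-1)ⁿ, impossible for odd n.
    -- Explicitly, with w = zʲ, the multiples 1 + wⁿ of 1 + w and 1 - wⁿ of [n] add up to 2, a unit.
    1+power-comaximal : ∀ z j m → Comaximal (1# + z ^ j) (geometric z (1 ℕ.+ 2 ℕ.* m))
    1+power-comaximal z j m with u , u-inv ← ℕ⁻¹ 1 =
      u * geometric (- w) n , u * ((1# - z) * geometric (z ^ n) j) , (begin
        u * geometric (- w) n * (1# + w) + u * ((1# - z) * geometric (z ^ n) j) * geometric z n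
          ≈⟨ solve 6 (λ u s w z t r → u :* s :* (1: :+ w) :+ u :* ((1: :- z) :* t) :* r
               := u :* ((1: :- (:- w)) :* s :+ (1: :- z) :* r :* t)) refl u _ w z _ _ ⟩
        u * ((1# - - w) * geometric (- w) n + (1# - z) * geometric z n * geometric (z ^ n) j)
          ≈⟨ *-congˡ (+-cong (trans (geometric-sum (- w) n) (+-congˡ (-‿cong odd-power)))
               (trans (*-congʳ (geometric-sum z n)) (trans (geometric-sum (z ^ n) j)
                 (+-congˡ (-‿cong swap))))) ⟩
        u * ((1# - - (w ^ n)) + (1# - w ^ n))
          ≈⟨ solve 2 (λ u y → u :* ((1: :- (:- y)) :+ (1: :- y)) := u :* (1: :+ (1: :+ con (+ 0))))
               refl u _ ⟩
        u * (2 ×ᵣ 1#)   ≈⟨ u-inv ⟩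
        1# ∎)
      where
      n = 1 ℕ.+ 2 ℕ.* m
      w = z ^ j

      swap : (z ^ n) ^ j ≈ w ^ n
      swap = trans (^-assocʳ z n j) (trans (^-congʳ z (ℕ.*-comm n j)) (sym (^-assocʳ z j n)))

      odd-power : (- w) ^ n ≈ - (w ^ n)
      odd-power = begin
        - w * (- w) ^ (2 ℕ.* m)   ≈⟨ *-congˡ (^-assocʳ (- w) 2 m) ⟨
        - w * ((- w) ^ 2) ^ m
          ≈⟨ *-congˡ (^-congˡ m (solve 1 (λ w → (:- w) :* ((:- w) :* 1:) := w :* (w :* 1:)) refl w)) ⟩
        - w * (w ^ 2) ^ m         ≈⟨ *-congˡ (^-assocʳ w 2 m) ⟩
        - w * w ^ (2 ℕ.* m)       ≈⟨ solve 2 (λ w y → (:- w) :* y := :- (w :* y)) refl w _ ⟩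
        - (w * w ^ (2 ℕ.* m))     ∎

-- Elements regular modulo [n](1 - ac)(a - c)

record Base {c ℓ} (D : IntegralDomain c ℓ) : Set (c ⊔ ℓ) where
  open IntegralDomain D
  open Algebra.Properties.Semiring.Exp semiring using (_^_)
  open Algebra.Properties.Semiring.Mult semiring using () renaming (_×_ to _×ᵣ_)
  field
    q       : Carrier
    q≉0     : q ≉ 0#
    1-q^≉0  : ∀ k → 1# - q ^ suc k ≉ 0#
    ℕ⁻¹     : ∀ n → ∃[ u ] u * (suc n ×ᵣ 1#) ≈ 1#

module Moduli {c ℓ} (D : IntegralDomain c ℓ) (B : Base D) (N : ℕ) where

  open RegularPolynomials D using (E; regular-constant-term; X-regular; regular-monic; coeff₀-*)
  open IntegralDomain D
  open Base B
  open Algebra.Properties.Semiring.Exp semiring using (_^_; ^-homo-*; ^-assocʳ; ^-congʳ)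
  open DomainProperties D using (*-≉0; Regular; Regular-combination; Regular-1)
  open Comaximality commutativeRing
  module P = Polynomials commutativeRing
  open P using (const; X; coeff; coeff-≈)
  module E = IntegralDomain E
  open DomainProperties E using () renaming
    (*-≉0 to *-≉0ᴱ; Regular to Regularᴱ; Regular-combination to Regular-combinationᴱ;
     Regular-sym to Regular-symᴱ; Regular-modulus-* to Regular-modulus-*ᴱ)
  open IntegerSolver commutativeRing

  n : ℕ
  n = suc (4 ℕ.* N)

  z c₀ n₀ : Carrier
  z  = q ^ 2
  c₀ = q ^ (2 ℕ.* n)
  n₀ = geometric z n

  e₁ e₂ e : E.Carrier
  e₁ = E.1# E.- X E.* const c₀
  e₂ = X E.- const c₀
  e  = e₁ E.* e₂

  q^≉0 : ∀ k → q ^ k ≉ 0#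
  q^≉0 zero    = 1≉0
  q^≉0 (suc k) = *-≉0 q≉0 (q^≉0 k)

  1-q^≉0′ : ∀ {k} → k > 0 → 1# - q ^ k ≉ 0#
  1-q^≉0′ {suc k} _ = 1-q^≉0 k

  q^-difference : ∀ {k l} → k < l → q ^ k - q ^ l ≉ 0#
  q^-difference {k} {l} k<l qᵏ-qˡ≈0 with d , 1+k+d≡l ← ℕ.m≤n⇒∃[o]m+o≡n k<l =
    *-≉0 (q^≉0 k) (1-q^≉0 d) (trans
      (solve 2 (λ x y → x :* (con (+ 1) :- y) := x :- x :* y) refl (q ^ k) (q ^ suc d))
      (trans (+-congˡ (-‿cong (trans (sym (^-homo-* q k (suc d)))
        (^-congʳ q (≡.trans (ℕ.+-suc k d) 1+k+d≡l))))) qᵏ-qˡ≈0))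

  n₀≉0 : n₀ ≉ 0#
  n₀≉0 n₀≈0 = 1-q^≉0′ {2 ℕ.* n} (ℕ.s≤s ℕ.z≤n) (trans (+-congˡ (-‿cong (sym (^-assocʳ q 2 n))))
    (trans (sym (geometric-sum z n)) (trans (*-congˡ n₀≈0) (zeroʳ _))))

  const-≉0 : ∀ {r} → r ≉ 0# → const r E.≉ E.0#
  const-≉0 r≉0 r≈0 = r≉0 (coeff-≈ r≈0 0)

  const-* : ∀ x y → const (x * y) E.≈ const x E.* const y
  const-* x y = P.∷-cong (sym (+-identityʳ _)) P.≈-refl

  coeff₀-1-X : ∀ b → coeff (E.1# E.- X E.* const b) 0 ≈ 1#
  coeff₀-1-X b = trans (P.coeff-+ E.1# (E.- (X E.* const b)) 0) (trans (+-congˡ (trans (P.coeff-neg (X E.* const b) 0)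
    (-‿cong (trans (coeff₀-* X (const b)) (zeroˡ b)))))
    (solve 0 (con (+ 1) :- con (+ 0) := con (+ 1)) refl))

  1-X-≉0 : ∀ b → E.1# E.- X E.* const b E.≉ E.0#
  1-X-≉0 b e = 1≉0 (trans (sym (coeff₀-1-X b)) (coeff-≈ e 0))

  X--≉0 : ∀ b → X E.- const b E.≉ E.0#
  X--≉0 b e = 1≉0 (coeff-≈ e 1)

  e≉0 : e E.≉ E.0#
  e≉0 = *-≉0ᴱ (1-X-≉0 c₀) (X--≉0 c₀)

  Regular-unit : ∀ {m r} → r ≈ 1# → Regular m r
  Regular-unit r≈1 = DomainProperties.Regular-resp D (sym r≈1) Regular-1

  -- The factor e₁ has constant term 1 and e₂ is monic, so both are regular modulo any nonzero
  -- constant; then the roles are exchanged.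
  constant-e : ∀ {r} → r ≉ 0# → Regularᴱ e (const r)
  constant-e {r} r≉0 = Regular-modulus-*ᴱ (1-X-≉0 c₀)
    (Regular-symᴱ (const-≉0 r≉0) (regular-constant-term e₁ (Regular-unit (coeff₀-1-X c₀))))
    (Regular-symᴱ (const-≉0 r≉0) (regular-monic c₀ r≉0))

  comaximal-regular : ∀ {r} → r ≉ 0# → Comaximal r n₀ → Regular n₀ r
  comaximal-regular r≉0 (s , t , e) =
    Regular-combination t s r≉0 (trans (+-comm _ _) e) Regular-1

  modulus : ∀ {v} → Regularᴱ (const n₀) v → Regularᴱ e v → Regularᴱ (const n₀ E.* e) v
  modulus = Regular-modulus-*ᴱ (const-≉0 n₀≉0)

  constant : ∀ {r} → r ≉ 0# → Comaximal r n₀ → Regularᴱ (const n₀ E.* e) (const r)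
  constant r≉0 r-n₀ = modulus
    (regular-constant-term (const _) (comaximal-regular r≉0 r-n₀)) (constant-e r≉0)

  n₀-regular : Regularᴱ e (const n₀)
  n₀-regular = constant-e n₀≉0

  module Combination = IntegerSolver E.commutativeRing

  private
    constant-e₁ : ∀ {r} → r ≉ 0# → Regularᴱ e₁ (const r)
    constant-e₁ r≉0 =
      Regular-symᴱ (const-≉0 r≉0) (regular-constant-term e₁ (Regular-unit (coeff₀-1-X c₀)))

    constant-e₂ : ∀ {r} → r ≉ 0# → Regularᴱ e₂ (const r)
    constant-e₂ r≉0 = Regular-symᴱ (const-≉0 r≉0) (regular-monic c₀ r≉0)

    1-const* : ∀ b → const (1# - b * c₀) E.≈ E.1# E.- const b E.* const c₀
    1-const* b = E.+-congˡ {E.1#} (E.-‿cong (const-* b c₀))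

  module _ {b : Carrier} (c₀-b≉0 : c₀ - b ≉ 0#) (1-bc₀≉0 : 1# - b * c₀ ≉ 0#) where

    open Combination using () renaming
      (solve to solveᴱ; _:=_ to _:=ᴱ_; _:+_ to _:+ᴱ_; _:*_ to _:*ᴱ_; _:-_ to _:-ᴱ_; :-_ to :-ᴱ_; con to conᴱ)

    -- Modulo n₀ the constant term 1 decides. Modulo e₁ and e₂, eliminating X leaves c₀ - b and 1 -
    -- bc₀, the resultants up to sign, and nonzero constants are regular there.
    1-X-regular : Regularᴱ (const n₀ E.* e) (E.1# E.- X E.* const b)
    1-X-regular = modulus (regular-constant-term _ (Regular-unit (coeff₀-1-X b)))
      (Regular-modulus-*ᴱ (1-X-≉0 c₀)
        (Regular-combinationᴱ (E.- const b) (const c₀) (1-X-≉0 b)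
          (identity₁ X (const b) (const c₀))
          (constant-e₁ c₀-b≉0))
        (Regular-combinationᴱ (const b) E.1# (1-X-≉0 b)
          (E.trans (identity₂ X (const b) (const c₀)) (E.sym (1-const* b)))
          (constant-e₂ 1-bc₀≉0)))
      where
      identity₁ : ∀ x b c → (E.- b) E.* (E.1# E.- x E.* c) E.+ c E.* (E.1# E.- x E.* b) E.≈ c E.- b
      identity₁ = solveᴱ 3 (λ x b c → (:-ᴱ b) :*ᴱ (conᴱ (+ 1) :-ᴱ x :*ᴱ c)
        :+ᴱ c :*ᴱ (conᴱ (+ 1) :-ᴱ x :*ᴱ b) :=ᴱ c :-ᴱ b) E.refl
      identity₂ : ∀ x b c → b E.* (x E.- c) E.+ E.1# E.* (E.1# E.- x E.* b) E.≈ E.1# E.- b E.* c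
      identity₂ = solveᴱ 3 (λ x b c → b :*ᴱ (x :-ᴱ c)
        :+ᴱ conᴱ (+ 1) :*ᴱ (conᴱ (+ 1) :-ᴱ x :*ᴱ b) :=ᴱ conᴱ (+ 1) :-ᴱ b :*ᴱ c) E.refl

    X--regular : Comaximal b n₀ → b ≉ 0# → Regularᴱ (const n₀ E.* e) (X E.- const b)
    X--regular b-n₀ b≉0 = modulus
      (regular-constant-term _ (comaximal-regular
        (λ -b≈0 → b≉0 (trans (solve 1 (λ b → b := con (+ 0) :- (con (+ 0) :- b)) refl b)
          (trans (+-congˡ (-‿cong -b≈0)) (-‿inverseʳ 0#))))
        (neg b-n₀)))
      (Regular-modulus-*ᴱ (1-X-≉0 c₀)
        (Regular-combinationᴱ E.1# (const c₀) (X--≉0 b)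
          (E.trans (identity₁ X (const b) (const c₀)) (E.sym (1-const* b)))
          (constant-e₁ 1-bc₀≉0))
        (Regular-combinationᴱ (E.- E.1#) E.1# (X--≉0 b)
          (identity₂ X (const b) (const c₀))
          (constant-e₂ c₀-b≉0)))
      where
      neg : Comaximal b n₀ → Comaximal (0# - b) n₀
      neg (s , t , e) = - s , t , trans (+-congʳ
        (solve 2 (λ s b → (:- s) :* (con (+ 0) :- b) := s :* b) refl s b)) e
      identity₁ : ∀ x b c → E.1# E.* (E.1# E.- x E.* c) E.+ c E.* (x E.- b) E.≈ E.1# E.- b E.* c
      identity₁ = solveᴱ 3 (λ x b c → conᴱ (+ 1) :*ᴱ (conᴱ (+ 1) :-ᴱ x :*ᴱ c)
        :+ᴱ c :*ᴱ (x :-ᴱ b) :=ᴱ conᴱ (+ 1) :-ᴱ b :*ᴱ c) E.refl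
      identity₂ : ∀ x b c → (E.- E.1#) E.* (x E.- c) E.+ E.1# E.* (x E.- b) E.≈ c E.- b
      identity₂ = solveᴱ 3 (λ x b c → (:-ᴱ conᴱ (+ 1)) :*ᴱ (x :-ᴱ c)
        :+ᴱ conᴱ (+ 1) :*ᴱ (x :-ᴱ b) :=ᴱ c :-ᴱ b) E.refl

  X-regular-modulus : Regularᴱ (const n₀ E.* e) X
  X-regular-modulus = modulus (X-regular n₀) (Regular-modulus-*ᴱ (1-X-≉0 c₀)
      (Regular-combinationᴱ E.1# (const c₀) X≉0 (identity₁ X (const c₀)) (constant-e₁ 1≉0))
      (Regular-combinationᴱ (E.- E.1#) E.1# X≉0 (identity₂ X (const c₀)) (constant-e₂ (q^≉0 (2 ℕ.* n)))))
    where
    open Combination using () renaming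
      (solve to solveᴱ; _:=_ to _:=ᴱ_; _:+_ to _:+ᴱ_; _:*_ to _:*ᴱ_; _:-_ to _:-ᴱ_; :-_ to :-ᴱ_; con to conᴱ)
    X≉0 : X E.≉ E.0#
    X≉0 e = 1≉0 (coeff-≈ e 1)
    identity₁ : ∀ x c → E.1# E.* (E.1# E.- x E.* c) E.+ c E.* x E.≈ E.1#
    identity₁ = solveᴱ 2 (λ x c → conᴱ (+ 1) :*ᴱ (conᴱ (+ 1) :-ᴱ x :*ᴱ c) :+ᴱ c :*ᴱ x
      :=ᴱ conᴱ (+ 1)) E.refl
    identity₂ : ∀ x c → (E.- E.1#) E.* (x E.- c) E.+ E.1# E.* x E.≈ c
    identity₂ = solveᴱ 2 (λ x c → (:-ᴱ conᴱ (+ 1)) :*ᴱ (x :-ᴱ c) :+ᴱ conᴱ (+ 1) :*ᴱ x :=ᴱ c) E.refl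

  b₀ : ℕ → Carrier
  b₀ j = (q ^ 8) ^ suc j

  private
    -- n = 4N + 1 is no multiple of 4. Hence c = q²ⁿ is none of the powers pʲ⁺¹, and the
    -- denominators 1 - apʲ⁺¹ and a - pʲ⁺¹ share no factor with (1 - ac)(a - c).
    n≢4+4j : ∀ j → n ≢ 4 ℕ.* suc j
    n≢4+4j j e with () ← ∣1⇒≡1 (∣m+n∣m⇒∣n (≡.subst (4 ℕ.∣_)
      (≡.trans (≡.sym e) (ℕ.+-comm 1 (4 ℕ.* N))) (m∣m*n (suc j))) (m∣m*n N))

    2n≢8+8j : ∀ j → 2 ℕ.* n ≢ 8 ℕ.* suc j
    2n≢8+8j j e = n≢4+4j j (ℕ.*-cancelˡ-≡ n (4 ℕ.* suc j) 2 (≡.trans e (ℕ.*-assoc 2 4 (suc j))))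

    b₀≈ : ∀ j → b₀ j ≈ q ^ (8 ℕ.* suc j)
    b₀≈ j = ^-assocʳ q 8 (suc j)

    c₀-q^≉0 : ∀ l → 2 ℕ.* n ≢ l → c₀ - q ^ l ≉ 0#
    c₀-q^≉0 l 2n≢l c₀-qˡ≈0 with ℕ.<-cmp (2 ℕ.* n) l
    ... | tri< 2n<l _ _ = q^-difference 2n<l c₀-qˡ≈0
    ... | tri≈ _ 2n≡l _ = 2n≢l 2n≡l
    ... | tri> _ _ l<2n = q^-difference l<2n (trans
      (solve 2 (λ x y → x :- y := con (+ 0) :- (y :- x)) refl _ _)
      (trans (+-congˡ (-‿cong c₀-qˡ≈0)) (-‿inverseʳ 0#)))

  c₀-b₀≉0 : ∀ j → c₀ - b₀ j ≉ 0#
  c₀-b₀≉0 j e = c₀-q^≉0 (8 ℕ.* suc j) (2n≢8+8j j) (trans (+-congˡ (-‿cong (sym (b₀≈ j)))) e)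

  1-b₀c₀≉0 : ∀ j → 1# - b₀ j * c₀ ≉ 0#
  1-b₀c₀≉0 j e = 1-q^≉0′ {8 ℕ.* suc j ℕ.+ 2 ℕ.* n} (ℕ.s≤s ℕ.z≤n)
    (trans (+-congˡ (-‿cong (trans (^-homo-* q (8 ℕ.* suc j) (2 ℕ.* n)) (*-congʳ (sym (b₀≈ j)))))) e)

  z-comaximal : Comaximal z n₀
  z-comaximal = base-comaximal z (4 ℕ.* N)

  q-comaximal : Comaximal q n₀
  q-comaximal = Comaximal-factorˡ z-comaximal

  b₀-comaximal : ∀ j → Comaximal (b₀ j) n₀
  b₀-comaximal j = Comaximal-^ (suc j) (Comaximal-^ 8 q-comaximal)

  b₀≉0 : ∀ j → b₀ j ≉ 0#
  b₀≉0 j b₀≈0 = q^≉0 (8 ℕ.* suc j) (trans (sym (b₀≈ j)) b₀≈0)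

  1-X-b₀-regular : ∀ j → Regularᴱ (const n₀ E.* e) (E.1# E.- X E.* const (b₀ j))
  1-X-b₀-regular j = 1-X-regular (c₀-b₀≉0 j) (1-b₀c₀≉0 j)

  X-b₀-regular : ∀ j → Regularᴱ (const n₀ E.* e) (X E.- const (b₀ j))
  X-b₀-regular j = X--regular (c₀-b₀≉0 j) (1-b₀c₀≉0 j) (b₀-comaximal j) (b₀≉0 j)

  q^-regular : ∀ k → Regularᴱ (const n₀ E.* e) (const (q ^ k))
  q^-regular k = constant (q^≉0 k) (Comaximal-^ k q-comaximal)

  1-q-regular : Regularᴱ (const n₀ E.* e) (const (1# - q))
  1-q-regular = constant
    (λ e → 1-q^≉0 0 (trans (+-congˡ (-‿cong (*-identityʳ q))) e))
    (Comaximal-factorˡ {y = 1# + q} (Comaximal-resp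
      (solve 1 (λ q → con (+ 1) :- q :* (q :* con (+ 1)) := (con (+ 1) :- q) :* (con (+ 1) :+ q)) refl q)
      refl (1-base-comaximal ℕ⁻¹ z (4 ℕ.* N))))

  1+z^-regular : ∀ j → Regularᴱ (const n₀ E.* e) (const (1# + z ^ suc j))
  1+z^-regular j = constant
    (λ 1+z≈0 → 1-q^≉0′ {2 ℕ.* (suc j ℕ.* 2)} (ℕ.s≤s ℕ.z≤n) (trans (+-congˡ (-‿cong
        (trans (sym (^-assocʳ q 2 (suc j ℕ.* 2))) (sym (^-assocʳ z (suc j) 2)))))
      (trans (solve 1 (λ w → con (+ 1) :- w :* (w :* con (+ 1)) := (con (+ 1) :- w) :* (con (+ 1) :+ w)) refl _)
        (trans (*-congˡ 1+z≈0) (zeroʳ _)))))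
    (≡.subst (λ m → Comaximal (1# + z ^ suc j) (geometric z (suc m)))
      (≡.sym (ℕ.*-assoc 2 2 N)) (1+power-comaximal ℕ⁻¹ z (suc j) (2 ℕ.* N)))

  power-ratio-regular : ∀ A l → gcd (suc l) n ℕ.∣ A → ∃[ u ] ∃[ v ]
    Regularᴱ (const n₀ E.* e) (const v) × (1# - z ^ A) * v ≈ u * (1# - z ^ suc l)
  power-ratio-regular A l g∣A with u , v , v-n₀ , (w , vw≈) , eq ←
    power-ratio ℕ⁻¹ z n A (suc l) (ℕ.s≤s ℕ.z≤n) g∣A =
    u , v , constant (λ v≈0 → 1-q^≉0′ {2 ℕ.* suc l} (ℕ.s≤s ℕ.z≤n)
      (trans (+-congˡ (-‿cong (sym (^-assocʳ q 2 (suc l)))))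
        (trans (sym vw≈) (trans (*-congʳ v≈0) (zeroˡ w))))) v-n₀ , eq

-- Integrality of Gaussian binomial coefficients

module IntegralQuotients {c ℓ k ℓ′} (E : IntegralDomain c ℓ) (K : FieldOfFractions E k ℓ′)
  (m : IntegralDomain.Carrier E) (B : QBase (FieldOfFractions.commutativeRing K)) where

  open FieldOfFractions K
  open QBase B using () renaming (p to s; p′ to s′; ip to is; ip-inv to is-inv)
  open Algebra.Properties.Semiring.Exp semiring using (_^_)
  open Localization E K
  open Iterated commutativeRing
  open QSeries commutativeRing B
  open IntegerSolver commutativeRing
  open import Relation.Binary.Reasoning.Setoid setoid

  -- For x a power of s or s′ these are Gaussian binomial coefficients up to sign and powers of s.
  -- Their integrality is no matter of coprimality, since single factors 1 - sʲ may have a factor in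
  -- common with m.
  Quotients : Carrier → Set _
  Quotients x = ∀ i → Integral m (poch x i * ∏ is i)

  -- A q-Pascal rule. Read in both directions it passes between x and xs, starting from x = 1, where
  -- all quotients with i > 0 are 0.
  pascal : ∀ x i → poch (x * s) (suc i) * ∏ is (suc i)
           ≈ poch x (suc i) * ∏ is (suc i) + x * (poch (x * s) i * ∏ is i)
  pascal x i = begin
    P * (1# - x * s * y) * (I * is i)
      ≈⟨ solve 6 (λ P x s y I i → P :* (con (+ 1) :- x :* s :* y) :* (I :* i)
           := (con (+ 1) :- x) :* P :* (I :* i) :+ x :* (P :* I) :* ((con (+ 1) :- s :* y) :* i))
           refl P x s y I (is i) ⟩
    (1# - x) * P * (I * is i) + x * (P * I) * ((1# - s * y) * is i)
      ≈⟨ +-cong (*-congʳ (sym (poch-front x i))) (trans (*-congˡ (is-inv i)) (*-identityʳ _)) ⟩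
    poch x (suc i) * (I * is i) + x * (P * I) ∎
    where
    P = poch (x * s) i
    I = ∏ is i
    y = s ^ i

  Quotients-up : ∀ {x} → Integral m x → Quotients x → Quotients (x * s)
  Quotients-up x-int x-quot zero    = Integral-* Integral-1 Integral-1
  Quotients-up x-int x-quot (suc i) = Integral-resp (sym (pascal _ i))
    (Integral-+ (x-quot (suc i)) (Integral-* x-int (Quotients-up x-int x-quot i)))

  Quotients-down : ∀ {x} → Integral m x → Quotients (x * s) → Quotients x
  Quotients-down x-int xs-quot zero    = Integral-* Integral-1 Integral-1
  Quotients-down {x} x-int xs-quot (suc i) = Integral-resp
    (trans (+-congʳ (pascal x i))
      (solve 2 (λ y z → y :+ z :- z := y) refl _ _))
    (Integral-+ (xs-quot (suc i)) (Integral-neg (Integral-* x-int (xs-quot i))))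

  Quotients-resp : ∀ {x y} → x ≈ y → Quotients x → Quotients y
  Quotients-resp x≈y x-quot i = Integral-resp (*-congʳ (poch-cong i x≈y)) (x-quot i)

  Quotients-1 : Quotients 1#
  Quotients-1 zero    = Integral-* Integral-1 Integral-1
  Quotients-1 (suc i) = Integral-resp (sym (trans (*-congʳ (poch-one i)) (zeroˡ _)))
    (Integral-resp ι-0 ⟦ IntegralDomain.0# E ⟧-integral)

  Quotients-s^ : Integral m s → ∀ i → Quotients (s ^ i)
  Quotients-s^ s-int zero    = Quotients-1
  Quotients-s^ s-int (suc i) = Quotients-resp (*-comm _ s)
    (Quotients-up (Integral-^ i s-int) (Quotients-s^ s-int i))

  Quotients-s′^ : Integral m s′ → ∀ i → Quotients (s′ ^ i)
  Quotients-s′^ s′-int zero    = Quotients-1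
  Quotients-s′^ s′-int (suc i) = Quotients-down (Integral-^ (suc i) s′-int)
    (Quotients-resp (sym (p′^-step i)) (Quotients-s′^ s′-int i))

  -- The left-hand side is the quotient of (s;s) of length 2N by (s;s) of length N. The odd
  -- exponents give the first product; the even ones, 1 - s²ʲ = (1 - sʲ)(1 + sʲ), lose 1 - sʲ to the
  -- denominator.
  central : ∀ N → poch (s ^ suc N) N ≈
            ∏ (λ j → 1# - s * (s ^ j * s ^ j)) N * ∏ (λ j → 1# + s ^ suc j) N
  central zero    = sym (*-identityˡ 1#)
  central (suc N) = begin
    poch (s * y) (suc N)
      ≈⟨ insert-1 _ (is-inv N) ⟩
    poch (s * y) (suc N) * ((1# - y) * is N)
      ≈⟨ solve 3 (λ P u i → P :* (u :* i) := u :* P :* i) refl _ _ _ ⟩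
    (1# - y) * poch (s * y) (suc N) * is N
      ≈⟨ *-congʳ (*-congˡ (poch-cong (suc N) (*-comm s y))) ⟩
    (1# - y) * poch (y * s) (suc N) * is N
      ≈⟨ *-congʳ (poch-front y (suc N)) ⟨
    poch y N * (1# - y * w) * (1# - y * (s * w)) * is N
      ≈⟨ *-congʳ (*-congʳ (*-congʳ (central N))) ⟩
    O * Z * (1# - y * w) * (1# - y * (s * w)) * is N
      ≈⟨ solve 5 (λ O Z s w i → let y = s :* w in
           O :* Z :* (con (+ 1) :- y :* w) :* (con (+ 1) :- y :* (s :* w)) :* i
           := O :* (con (+ 1) :- s :* (w :* w)) :* (Z :* (con (+ 1) :+ y)) :* ((con (+ 1) :- y) :* i))
           refl O Z s w (is N) ⟩
    O * (1# - s * (w * w)) * (Z * (1# + y)) * ((1# - y) * is N)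
      ≈⟨ insert-1 _ (is-inv N) ⟨
    O * (1# - s * (w * w)) * (Z * (1# + y)) ∎
    where
    y = s ^ suc N
    w = s ^ N
    O = ∏ (λ j → 1# - s * (s ^ j * s ^ j)) N
    Z = ∏ (λ j → 1# + s ^ suc j) N

-- The congruence over an abstract field of fractions

module Assembly {o ℓ k ℓ′} (D : IntegralDomain o ℓ) (B : Base D) (N : ℕ)
  (K : FieldOfFractions (RegularPolynomials.E D) k ℓ′) where

  private module D = IntegralDomain D
  open RegularPolynomials D using (E)
  open Base B using () renaming (q to q₀)
  open Moduli D B N
  open Polynomials D.commutativeRing using (const; X)
  open FieldOfFractions K
  open Localization E K
  open DomainProperties E using (Regular; ≉0)
  open Algebra.Properties.Semiring.Divisibility E.semiring using () renaming (_∣_ to _∣ᴱ_)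
  open Algebra.Properties.Semiring.Exp semiring using (_^_; ^-homo-*; ^-assocʳ; ^-congʳ; ^-congˡ)
  open Algebra.Properties.Semiring.Exp D.semiring using () renaming (_^_ to _^ᴰ_)
  open import Relation.Binary.Reasoning.Setoid setoid
  open IntegerSolver commutativeRing
  open Iterated commutativeRing

  private
    1: : ∀ {n} → Polynomial n
    1: = con (+ 1)

  j : D.Carrier → Carrier
  j r = ι (const r)

  j-* : ∀ x y → j (x D.* y) ≈ j x * j y
  j-* x y = trans (ι-cong (const-* x y)) (ι-* (const x) (const y))

  j-^ : ∀ x i → j (x ^ᴰ i) ≈ j x ^ i
  j-^ x zero    = ι-1
  j-^ x (suc i) = trans (j-* x _) (*-congˡ (j-^ x i))

  j-1- : ∀ {x y} → j x ≈ y → j (D.1# D.- x) ≈ 1# - y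
  j-1- {x} e = ι-1- {const x} e

  P : E.Carrier
  P = const n₀ E.* e

  P≉0 : P E.≉ E.0#
  P≉0 = DomainProperties.*-≉0 E (const-≉0 n₀≉0) e≉0

  q a α p c α′ p′ a′ c′ [n] : Carrier
  q = j q₀
  a = ι X
  α = q ^ 2
  p = q ^ 8
  c = q ^ (2 ℕ.* n)
  α′ = α ⁻¹
  p′ = p ⁻¹
  a′ = a ⁻¹
  c′ = c ⁻¹
  [n] = j n₀

  q^-inv : ∀ i → q ^ i * (q ^ i) ⁻¹ ≈ 1#
  q^-inv i = ι-inverse (const-≉0 (q^≉0 i)) (j-^ q₀ i)

  aa′≈1 : a * a′ ≈ 1#
  aa′≈1 = ι-inverse (≉0 X-regular-modulus) refl

  1-q^-inv : ∀ {x} i → x ≈ q ^ suc i → (1# - x) * (1# - x) ⁻¹ ≈ 1#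
  1-q^-inv i x≈ = ι-inverse (const-≉0 (Base.1-q^≉0 B i)) (j-1- (trans (j-^ q₀ (suc i)) (sym x≈)))

  p^≈ : ∀ i → p ^ i ≈ q ^ (8 ℕ.* i)
  p^≈ i = ^-assocʳ q 8 i

  αp^≈ : ∀ i → α * p ^ i ≈ q ^ (2 ℕ.+ 8 ℕ.* i)
  αp^≈ i = trans (*-congˡ (p^≈ i)) (sym (^-homo-* q 2 (8 ℕ.* i)))

  2n≡ : 2 ℕ.* n ≡ 2 ℕ.+ 8 ℕ.* N
  2n≡ = ≡.trans (ℕ.*-suc 2 (4 ℕ.* N)) (≡.cong (2 ℕ.+_) (≡.sym (ℕ.*-assoc 2 4 N)))

  c≈αp^ : c ≈ α * p ^ N
  c≈αp^ = trans (^-congʳ q 2n≡) (sym (αp^≈ N))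

  p≈α⁴ : p ≈ α * α * (α * α)
  p≈α⁴ = trans (^-homo-* q 4 4) (*-cong (^-homo-* q 2 2) (^-homo-* q 2 2))

  -- The inverse of 1 - pⁱ⁺¹/a is written a/(a - pⁱ⁺¹), so that its denominator comes from the
  -- polynomial X - b₀. `ic` and `ic′` are the analogues for c in place of a.
  ip ia ia′ ic ic′ ν : ℕ → Carrier
  ip i = (1# - p ^ suc i) ⁻¹
  ia i = (1# - a * p ^ suc i) ⁻¹
  ia′ i = a * (a - p ^ suc i) ⁻¹
  ic i = (1# - c * p ^ suc i) ⁻¹
  ic′ i = c * (c - p ^ suc i) ⁻¹
  ν i = (1# - α * p ^ i) ⁻¹

  ip-inv : ∀ i → (1# - p ^ suc i) * ip i ≈ 1#
  ip-inv i = 1-q^-inv (ℕ.pred (8 ℕ.* suc i)) (p^≈ (suc i))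

  ν-inv : ∀ i → (1# - α * p ^ i) * ν i ≈ 1#
  ν-inv i = 1-q^-inv (1 ℕ.+ 8 ℕ.* i) (αp^≈ i)

  b₀≈p^ : ∀ i → j (b₀ i) ≈ p ^ suc i
  b₀≈p^ i = trans (j-^ (q₀ ^ᴰ 8) (suc i)) (^-congˡ (suc i) (j-^ q₀ 8))

  1-ap^≈ : ∀ i → ι (E.1# E.- X E.* const (b₀ i)) ≈ 1# - a * p ^ suc i
  1-ap^≈ i = ι-1- (trans (ι-* X _) (*-congˡ (b₀≈p^ i)))

  a-p^≈ : ∀ i → ι (X E.- const (b₀ i)) ≈ a - p ^ suc i
  a-p^≈ i = trans (ι-+ X _) (+-congˡ (trans (ι-neg _) (-‿cong (b₀≈p^ i))))

  ia-inv : ∀ i → (1# - a * p ^ suc i) * ia i ≈ 1#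
  ia-inv i = ι-inverse (≉0 (1-X-b₀-regular i)) (1-ap^≈ i)

  reciprocal-inv : ∀ {x x′} y → x * x′ ≈ 1# → (x - y) * (x - y) ⁻¹ ≈ 1# →
                   (1# - x′ * y) * (x * (x - y) ⁻¹) ≈ 1#
  reciprocal-inv {x} {x′} y xx′≈1 inv = begin
    (1# - x′ * y) * (x * (x - y) ⁻¹)
      ≈⟨ solve 4 (λ x x′ y i → (1: :- x′ :* y) :* (x :* i) := (x :- x :* x′ :* y) :* i) refl x x′ y _ ⟩
    (x - x * x′ * y) * (x - y) ⁻¹
      ≈⟨ *-congʳ (+-congˡ (-‿cong (trans (*-congʳ xx′≈1) (*-identityˡ y)))) ⟩
    (x - y) * (x - y) ⁻¹   ≈⟨ inv ⟩
    1# ∎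

  ia′-inv : ∀ i → (1# - a′ * p ^ suc i) * ia′ i ≈ 1#
  ia′-inv i = reciprocal-inv (p ^ suc i) aa′≈1 (ι-inverse (≉0 (X-b₀-regular i)) (a-p^≈ i))

  ic-inv : ∀ i → (1# - c * p ^ suc i) * ic i ≈ 1#
  ic-inv i = 1-q^-inv (ℕ.pred (2 ℕ.* n ℕ.+ 8 ℕ.* suc i)) (trans (*-congˡ (p^≈ (suc i))) (sym (^-homo-* q (2 ℕ.* n) (8 ℕ.* suc i))))

  c-p^-≉0 : ∀ i → const (c₀ D.- b₀ i) E.≉ E.0#
  c-p^-≉0 i = const-≉0 (c₀-b₀≉0 i)

  c-p^≈ : ∀ i → j (c₀ D.- b₀ i) ≈ c - p ^ suc i
  c-p^≈ i = trans (ι-+ (const c₀) (E.- const (b₀ i)))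
    (+-cong (j-^ q₀ (2 ℕ.* n)) (trans (ι-neg _) (-‿cong (b₀≈p^ i))))

  ic′-inv : ∀ i → (1# - c′ * p ^ suc i) * ic′ i ≈ 1#
  ic′-inv i = reciprocal-inv (p ^ suc i) (q^-inv (2 ℕ.* n)) (ι-inverse (c-p^-≉0 i) (c-p^≈ i))

  baseₚ : QBase commutativeRing
  baseₚ = record { p = p ; p′ = p′ ; pp′≈1 = q^-inv 8 ; ip = ip ; ip-inv = ip-inv }

  wellPoisedBase : WellPoisedBase commutativeRing
  wellPoisedBase = record
    { qBase = baseₚ ; α = α ; α′ = α′ ; αα′≈1 = q^-inv 2 ; p≈α⁴ = p≈α⁴ }

  open QSeries commutativeRing baseₚ
  open WellPoised commutativeRing wellPoisedBase

  module A = Parameter a a′ aa′≈1 ia ia′ ia-inv ia′-inv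
  module C = Parameter c c′ (q^-inv (2 ℕ.* n)) ic ic′ ic-inv ic′-inv

  -- Instantiated for the whole modulus P and for e alone; modulo e every nonzero constant may be
  -- inverted.
  module Integrality {m : E.Carrier}
    (q^-reg : ∀ i → Regular m (const (q₀ ^ᴰ i)))
    (a-reg : Regular m X)
    (1-ap^-reg : ∀ i → Regular m (E.1# E.- X E.* const (b₀ i)))
    (a-p^-reg : ∀ i → Regular m (X E.- const (b₀ i)))
    where

    q^-int : ∀ i → Integral m (q ^ i)
    q^-int i = Integral-^ i ⟦ const q₀ ⟧-integral

    q^⁻¹-int : ∀ i → Integral m ((q ^ i) ⁻¹)
    q^⁻¹-int i = Integral-inverse (q^-reg i) (j-^ q₀ i) (q^-inv i)

    a-int : Integral m a
    a-int = ⟦ X ⟧-integral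

    a′-int : Integral m a′
    a′-int = Integral-inverse a-reg refl aa′≈1

    ia-int : ∀ i → Integral m (ia i)
    ia-int i = Integral-inverse (1-ap^-reg i) (1-ap^≈ i) (ia-inv i)

    ia′-int : ∀ i → Integral m (ia′ i)
    ia′-int i = Integral-* a-int (Integral-inverse (a-p^-reg i) (a-p^≈ i)
      (ι-inverse (≉0 (a-p^-reg i)) (a-p^≈ i)))

    poch-int : ∀ {x} i → Integral m x → Integral m (poch x i)
    poch-int i x-int = Integral-∏ i
      (λ {l} _ → Integral-1- (Integral-* x-int (Integral-^ l (q^-int 8))))

    L-int : ∀ k → Integral m (A.L k)
    L-int k = Integral-* (factor a-int) (factor a′-int)
      where
      factor : ∀ {x} → Integral m x → Integral m (1# - x * α * p ^ k)
      factor x-int = Integral-1- (Integral-* (Integral-* x-int (q^-int 2)) (Integral-^ k (q^-int 8)))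

    L₀-int : Integral m A.L₀
    L₀-int = Integral-* (Integral-1- (Integral-* a-int (q^-int 2)))
                        (Integral-1- (Integral-* a′-int (q^-int 2)))

  i₁ i₂ i₃ w : Carrier
  i₁ = (1# - α) ⁻¹
  i₂ = (1# - q) ⁻¹
  i₃ = (1# + α) ⁻¹
  w = i₂ * i₂ * i₃

  i₁-inv : (1# - α) * i₁ ≈ 1#
  i₁-inv = 1-q^-inv 1 refl

  i₂-inv : (1# - q) * i₂ ≈ 1#
  i₂-inv = 1-q^-inv 0 (sym (*-identityʳ q))

  j-1+ : ∀ {x y} → j x ≈ y → j (D.1# D.+ x) ≈ 1# + y
  j-1+ {x} e = trans (ι-+ E.1# (const x)) (+-cong ι-1 e)

  z≈α : j z ≈ α
  z≈α = j-^ q₀ 2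

  1+z^≈ : ∀ i {x} → x ≈ α ^ suc i → j (D.1# D.+ z ^ᴰ suc i) ≈ 1# + x
  1+z^≈ i x≈ = j-1+ (trans (j-^ z (suc i)) (trans (^-congˡ (suc i) z≈α) (sym x≈)))

  1+α≈ : j (D.1# D.+ z ^ᴰ 1) ≈ 1# + α
  1+α≈ = 1+z^≈ 0 (sym (*-identityʳ α))

  i₃-inv : (1# + α) * i₃ ≈ 1#
  i₃-inv = ι-inverse (≉0 (1+z^-regular 0)) 1+α≈

  [n]-inv : (1# - α) * [n] ≈ 1# - α * p ^ N
  [n]-inv = begin
    (1# - α) * [n]                   ≈⟨ *-congʳ (j-1- z≈α) ⟨
    j (D.1# D.- z) * [n]             ≈⟨ j-* _ n₀ ⟨
    j ((D.1# D.- z) D.* n₀)          ≈⟨ ι-cong (∷-cong (geometric-sum z n) ≈-refl) ⟩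
    j (D.1# D.- z ^ᴰ n)              ≈⟨ j-1- (trans (j-^ z n) (^-congˡ n z≈α)) ⟩
    1# - α ^ n                       ≈⟨ 1-cong (trans (^-assocʳ q 2 n) c≈αp^) ⟩
    1# - α * p ^ N                   ∎
    where
    open Comaximality D.commutativeRing using (geometric-sum)
    open Polynomials D.commutativeRing using (∷-cong; ≈-refl)

  i₁[1-αp^N] : i₁ * (1# - α * p ^ N) ≈ [n]
  i₁[1-αp^N] = trans (*-congˡ (sym [n]-inv))
    (trans (solve 3 (λ i u n → i :* (u :* n) := n :* (u :* i)) refl i₁ (1# - α) [n])
      (sym (insert-1 [n] i₁-inv)))

  W : Carrier
  W = poch (α * α) N * ∏ ip N * α′ ^ N

  ∏Q≈ : ∀ i → ∏ A.Q i ≈ α ^ i * (poch α i * ∏ ip i)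
  ∏Q≈ zero    = solve 0 (1: := 1: :* (1: :* 1:)) refl
  ∏Q≈ (suc i) = trans (*-congʳ (∏Q≈ i)) (solve 6 (λ x P I α u i →
    x :* (P :* I) :* (α :* (u :* i)) := α :* x :* (P :* u :* (I :* i))) refl _ _ _ _ _ _)

  ιe≈ : ι e ≈ (1# - a * c) * (a - c)
  ιe≈ = trans (ι-* e₁ e₂) (*-cong (ι-1- (trans (ι-* X (const c₀)) (*-congˡ c≈)))
    (trans (ι-+ X _) (+-congˡ (trans (ι-neg (const c₀)) (-‿cong c≈)))))
    where
    c≈ : j c₀ ≈ c
    c≈ = j-^ q₀ (2 ℕ.* n)

  α^≈ : ∀ i → p ^ i ≈ α ^ (4 ℕ.* i)
  α^≈ i = trans (^-congˡ i (sym (^-assocʳ q 2 4))) (^-assocʳ α 4 i)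

  private
    factor : ∀ {v} → Regular P v → Regular e v
    factor = DomainProperties.Regular-modulus-factor E (const-≉0 n₀≉0)

    module IntP = Integrality {P} q^-regular X-regular-modulus 1-X-b₀-regular X-b₀-regular
    module IntE = Integrality {e} (λ i → constant-e (q^≉0 i))
      (factor X-regular-modulus) (λ i → factor (1-X-b₀-regular i)) (λ i → factor (X-b₀-regular i))

    ratio-integral : ∀ {x y y⁻¹} A l → gcd (suc l) n ℕ.∣ A → x ≈ α ^ A → y ≈ α ^ suc l →
      (1# - y) * y⁻¹ ≈ 1# → Integral P ((1# - x) * y⁻¹)
    ratio-integral {x} {y} {y⁻¹} A l g∣A x≈ y≈ inv = from (power-ratio-regular A l g∣A)
      where
      open Polynomials D.commutativeRing using (∷-cong; ≈-refl)

      j-z : ∀ i {x} → x ≈ α ^ i → j (D.1# D.- z ^ᴰ i) ≈ 1# - x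
      j-z i x≈ = j-1- (trans (j-^ z i) (trans (^-congˡ i z≈α) (sym x≈)))

      from : (∃[ u ] ∃[ v ] Regular P (const v) × (D.1# D.- z ^ᴰ A) D.* v D.≈ u D.* (D.1# D.- z ^ᴰ suc l)) →
             Integral P ((1# - x) * y⁻¹)
      from (u , v , v-reg , eq) = integral {numerator = const u} v-reg (begin
        (1# - x) * y⁻¹ * j v
          ≈⟨ *-congʳ (*-congʳ (j-z A x≈)) ⟨
        j (D.1# D.- z ^ᴰ A) * y⁻¹ * j v
          ≈⟨ solve 3 (λ u i v → u :* i :* v := u :* v :* i) refl _ _ _ ⟩
        j (D.1# D.- z ^ᴰ A) * j v * y⁻¹
          ≈⟨ *-congʳ (trans (sym (j-* _ v)) (trans (ι-cong (∷-cong eq ≈-refl)) (j-* u _))) ⟩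
        j u * j (D.1# D.- z ^ᴰ suc l) * y⁻¹
          ≈⟨ trans (*-assoc _ _ _) (*-congˡ (trans (*-congʳ (j-z (suc l) y≈)) inv)) ⟩
        j u * 1#
          ≈⟨ *-identityʳ _ ⟩
        j u ∎)

    αp^≈α^ : ∀ i → α * p ^ i ≈ α ^ suc (4 ℕ.* i)
    αp^≈α^ i = *-congˡ (α^≈ i)

    -- The denominators 1 - p^{i+1} are paired with the numerators 1 - αp^{N-1-i}: the
    -- exponents of α in the two add up to n.
    χ-integral : ∀ i m → m ℕ.+ i ≡ N → Integral P (poch (α * p ^ m) i * ∏ ip i)
    χ-integral zero    m _     = Integral-* Integral-1 Integral-1
    χ-integral (suc i) m m+1+i≡N = Integral-resp (begin
        (1# - α * p ^ m) * ip i * (poch (α * p ^ suc m) i * ∏ ip i)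
          ≈⟨ solve 4 (λ u i P I → u :* i :* (P :* I) := u :* P :* (I :* i)) refl _ _ _ _ ⟩
        (1# - α * p ^ m) * poch (α * p ^ suc m) i * (∏ ip i * ip i)
          ≈⟨ *-congʳ (*-congˡ (poch-cong i (shift α m))) ⟨
        (1# - α * p ^ m) * poch (α * p ^ m * p) i * (∏ ip i * ip i)
          ≈⟨ *-congʳ (poch-front (α * p ^ m) i) ⟨
        poch (α * p ^ m) (suc i) * (∏ ip i * ip i) ∎)
      (Integral-* (ratio-integral (suc (4 ℕ.* m)) (ℕ.pred (4 ℕ.* suc i))
          (∣m+n∣m⇒∣n (≡.subst (gcd (4 ℕ.* suc i) n ℕ.∣_) n≡ (gcd[m,n]∣n (4 ℕ.* suc i) n))
            (gcd[m,n]∣m (4 ℕ.* suc i) n))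
          (αp^≈α^ m) (α^≈ (suc i)) (ip-inv i))
        (χ-integral i (suc m) (≡.trans (≡.sym (ℕ.+-suc m i)) m+1+i≡N)))
      where
      n≡ : n ≡ 4 ℕ.* suc i ℕ.+ suc (4 ℕ.* m)
      n≡ = ≡.trans (≡.cong (λ k → suc (4 ℕ.* k)) (≡.trans (≡.sym m+1+i≡N) (ℕ.+-comm m (suc i))))
        (≡.trans (≡.cong suc (ℕ.*-distribˡ-+ 4 (suc i) m)) (≡.sym (ℕ.+-suc (4 ℕ.* suc i) (4 ℕ.* m))))

    χ : Carrier
    χ = poch α N * ∏ ip N

    χ-int : Integral P χ
    χ-int = Integral-resp (*-congʳ (poch-cong N (*-identityʳ α))) (χ-integral N 0 ≡.refl)

    module BaseP = IntegralQuotients E K P baseₚ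

    s : Carrier
    s = q ^ 4

    is iz : ℕ → Carrier
    is i = (1# - s ^ suc i) ⁻¹
    iz i = (1# + s ^ suc i) ⁻¹

    is-inv : ∀ i → (1# - s ^ suc i) * is i ≈ 1#
    is-inv i = 1-q^-inv (ℕ.pred (4 ℕ.* suc i)) (^-assocʳ q 4 (suc i))

    1+s^≈ : ∀ i → j (D.1# D.+ z ^ᴰ (2 ℕ.* suc i)) ≈ 1# + s ^ suc i
    1+s^≈ i = 1+z^≈ (ℕ.pred (2 ℕ.* suc i))
      (trans (^-congˡ (suc i) (sym (^-assocʳ q 2 2))) (^-assocʳ α 2 (suc i)))

    iz-inv : ∀ i → (1# + s ^ suc i) * iz i ≈ 1#
    iz-inv i = ι-inverse (≉0 (1+z^-regular (ℕ.pred (2 ℕ.* suc i)))) (1+s^≈ i)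

    iz-int : ∀ i → Integral P (iz i)
    iz-int i = Integral-inverse (1+z^-regular (ℕ.pred (2 ℕ.* suc i))) (1+s^≈ i) (iz-inv i)

    baseₛ : QBase commutativeRing
    baseₛ = record { p = s ; p′ = s ⁻¹ ; pp′≈1 = q^-inv 4 ; ip = is ; ip-inv = is-inv }

    module BaseS = IntegralQuotients E K P baseₛ

    p^≈s^s^ : ∀ i → p ^ i ≈ s ^ i * s ^ i
    p^≈s^s^ i = trans (^-congˡ i (^-homo-* q 4 4)) (^-distrib-* s s i)
      where open import Algebra.Properties.CommutativeSemiring.Exp commutativeSemiring using (^-distrib-*)

    ip≈ : ∀ i → ip i ≈ is i * iz i
    ip≈ i = ⁻¹-unique (begin
      (1# - p ^ suc i) * (is i * iz i)          ≈⟨ *-congʳ (1-cong (p^≈s^s^ (suc i))) ⟩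
      (1# - y * y) * (is i * iz i)
        ≈⟨ solve 3 (λ y i k → (1: :- y :* y) :* (i :* k) := (1: :- y) :* i :* ((1: :+ y) :* k))
             refl y (is i) (iz i) ⟩
      (1# - y) * is i * ((1# + y) * iz i)       ≈⟨ *-cong (is-inv i) (iz-inv i) ⟩
      1# * 1#                                   ≈⟨ *-identityˡ 1# ⟩
      1#                                        ∎)
      where y = s ^ suc i

    -- With s = q⁴ = α² and p = s², the quotient is a central Gaussian binomial coefficient in base
    -- s divided by the square of the product of the 1 + sʲ for 1 ≤ j ≤ N. These factors are regular
    -- because n is odd.
    W₀-int : Integral P (poch (α * α) N * ∏ ip N)
    W₀-int = Integral-resp (begin
        BaseSpoch (s ^ suc N) N * ∏ is N * (∏ iz N * ∏ iz N)
          ≈⟨ *-congʳ (*-congʳ (BaseS.central N)) ⟩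
        O * Z * ∏ is N * (∏ iz N * ∏ iz N)
          ≈⟨ solve 4 (λ O Z I J → O :* Z :* I :* (J :* J) := O :* (I :* J) :* (Z :* J)) refl O Z _ _ ⟩
        O * (∏ is N * ∏ iz N) * (Z * ∏ iz N)
          ≈⟨ *-cong (*-cong (∏-cong N (λ {i} _ → 1-cong (*-cong (^-homo-* q 2 2) (sym (p^≈s^s^ i)))))
               (trans (sym (∏-* is iz N)) (∏-cong N (λ {i} _ → sym (ip≈ i)))))
               (trans (sym (∏-* _ iz N)) (∏-one N (λ {i} _ → iz-inv i))) ⟩
        poch (α * α) N * ∏ ip N * 1#
          ≈⟨ *-identityʳ _ ⟩
        poch (α * α) N * ∏ ip N ∎)
      (Integral-* (BaseS.Quotients-s^ (IntP.q^-int 4) (suc N) N)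
        (Integral-* (Integral-∏ N (λ {i} _ → iz-int i)) (Integral-∏ N (λ {i} _ → iz-int i))))
      where
      BaseSpoch = QSeries.poch commutativeRing baseₛ
      O = ∏ (λ i → 1# - s * (s ^ i * s ^ i)) N
      Z = ∏ (λ i → 1# + s ^ suc i) N

    W-int : Integral P W
    W-int = Integral-* W₀-int (Integral-^ N (IntP.q^⁻¹-int 2))

    S₁ : Carrier
    S₁ = ∑ (λ i →
      p ^ i * poch (α * α * α) i * (∏ ia i * ∏ ia′ i) * (poch (p′ ^ N) i * ∏ ip i) *
      (χ * χ * α′ ^ N * ((1# - α * p ^ N) * ν i) * poch (α * p ^ N * p) i)) (suc N)

    -- Three groups have doubtful denominators. (p⁻ᴺ;p)ᵢ/(p;p)ᵢ is a Gaussian binomial coefficient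
    -- up to a unit, χ pairs its factors as above, and (1 - αpᴺ)/(1 - αpⁱ) is (1 - αⁿ)/(1 - α⁴ⁱ⁺¹),
    -- where gcd(4i + 1, n) divides n.
    S₁-int : Integral P S₁
    S₁-int = Integral-∑ (suc N) (λ {i} _ →
      Integral-* (Integral-* (Integral-* (Integral-* (Integral-^ i (IntP.q^-int 8))
          (IntP.poch-int i (Integral-* (Integral-* (IntP.q^-int 2) (IntP.q^-int 2)) (IntP.q^-int 2))))
          (Integral-* (Integral-∏ i (λ {l} _ → IntP.ia-int l)) (Integral-∏ i (λ {l} _ → IntP.ia′-int l))))
          (BaseP.Quotients-s′^ (IntP.q^⁻¹-int 8) N i))
        (Integral-* (Integral-* (Integral-* (Integral-* χ-int χ-int) (Integral-^ N (IntP.q^⁻¹-int 2)))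
            (ratio-integral n (4 ℕ.* i) (gcd[m,n]∣n (suc (4 ℕ.* i)) n) (αp^≈α^ N) (αp^≈α^ i) (ν-inv i)))
          (IntP.poch-int i (Integral-* (Integral-* (IntP.q^-int 2) (Integral-^ N (IntP.q^-int 8)))
            (IntP.q^-int 8)))))

    ψ-int : Integral P (A.ψ N)
    ψ-int = Integral-resp (sym (trans (∏-* _ _ N)
        (*-congʳ (trans (∏-* A.Q A.Q N) (*-cong (∏Q≈ N) (∏Q≈ N))))))
      (Integral-* (Integral-* Q-int Q-int) (Integral-∏ N (λ {i} _ →
        Integral-* (IntP.L-int i) (Integral-* (IntP.ia-int i) (IntP.ia′-int i)))))
      where
      Q-int : Integral P (α ^ N * χ)
      Q-int = Integral-* (Integral-^ N (IntP.q^-int 2)) χ-int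

  open A.Summation q i₁ i₂ i₃ (*-congˡ (*-identityʳ q)) i₁-inv i₂-inv i₃-inv public

  left right difference : Carrier
  left = ∑ summand (suc N)
  right = [n] * W * (1# - A.L₀ * w)
  difference = left - right

  private

    w-int : Integral P w
    w-int = Integral-* (Integral-* i₂-int i₂-int) (Integral-inverse (1+z^-regular 0) 1+α≈ i₃-inv)
      where
      i₂-int : Integral P i₂
      i₂-int = Integral-inverse 1-q-regular (j-1- refl) i₂-inv

    R : Carrier
    R = w * (A.ψ N * A.L N * p′ ^ N)

    -- T is left open because it is taken in two forms, as a multiple of [n] and as a multiple of e.
    difference≈ : ∀ {T} → i₁ * A.∑A N - [n] * W ≈ T →
                  difference ≈ T * (1# - A.L₀ * w) + [n] * [n] * R
    difference≈ {T} ∑≈T = begin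
      left - right
        ≈⟨ +-congʳ (∑-summand N) ⟩
      i₁ * A.∑A N * y + i₁ * i₁ * w * (A.ψ N * (v * v * A.L N * p′ ^ N)) - [n] * W * y
        ≈⟨ solve 9 (λ i S y w ψ v L x nW →
             i :* S :* y :+ i :* i :* w :* (ψ :* (v :* v :* L :* x)) :- nW :* y
             := (i :* S :- nW) :* y :+ i :* v :* (i :* v) :* (w :* (ψ :* L :* x)))
             refl i₁ (A.∑A N) y w (A.ψ N) v (A.L N) (p′ ^ N) ([n] * W) ⟩
      (i₁ * A.∑A N - [n] * W) * y + i₁ * v * (i₁ * v) * R
        ≈⟨ +-cong (*-congʳ ∑≈T) (*-congʳ (*-cong i₁[1-αp^N] i₁[1-αp^N])) ⟩
      T * y + [n] * [n] * R ∎
      where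
      y = 1# - A.L₀ * w
      v = 1# - α * p ^ N

    g : Carrier
    g = (S₁ - W) * (1# - A.L₀ * w) + [n] * R

    g-int : Integral P g
    g-int = Integral-+
      (Integral-* (Integral-+ S₁-int (Integral-neg W-int)) (Integral-1- (Integral-* IntP.L₀-int w-int)))
      (Integral-* ⟦ const n₀ ⟧-integral (Integral-* w-int
        (Integral-* (Integral-* ψ-int (IntP.L-int N)) (Integral-^ N (IntP.q^⁻¹-int 8)))))

    difference≈[n]g : difference ≈ [n] * g
    difference≈[n]g = trans (difference≈ (begin
        i₁ * A.∑A N - [n] * W
          ≈⟨ +-congʳ (*-congˡ (A.Truncated.∑A-expansion N ν ν-inv)) ⟩
        i₁ * ((1# - α * p ^ N) * S₁) - [n] * W
          ≈⟨ +-congʳ (trans (sym (*-assoc _ _ _)) (*-congʳ i₁[1-αp^N])) ⟩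
        [n] * S₁ - [n] * W
          ≈⟨ solve 3 (λ n S W → n :* S :- n :* W := n :* (S :- W)) refl [n] S₁ W ⟩
        [n] * (S₁ - W) ∎))
      (solve 4 (λ n S y R → n :* S :* y :+ n :* n :* R := n :* (S :* y :+ n :* R)) refl [n] _ _ R)

    L≈ : A.L N ≈ ι e * a′
    L≈ = begin
      (1# - a * α * p ^ N) * (1# - a′ * α * p ^ N)
        ≈⟨ *-cong (1-cong (aαp^ a)) (1-cong (aαp^ a′)) ⟩
      (1# - a * c) * (1# - a′ * c)
        ≈⟨ *-congˡ (+-congʳ (sym aa′≈1)) ⟩
      (1# - a * c) * (a * a′ - a′ * c)
        ≈⟨ solve 3 (λ a a′ c → (1: :- a :* c) :* (a :* a′ :- a′ :* c)
             := (1: :- a :* c) :* (a :- c) :* a′) refl a a′ c ⟩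
      (1# - a * c) * (a - c) * a′     ≈⟨ *-congʳ ιe≈ ⟨
      ι e * a′                        ∎
      where
      aαp^ : ∀ a → a * α * p ^ N ≈ a * c
      aαp^ a = trans (*-assoc a α _) (*-congˡ (sym c≈αp^))

    infix 4 _≋_
    _≋_ : Carrier → Carrier → Set _
    x ≋ y = ∃[ h ] Integral e h × x - y ≈ ι e * h

    ≋-refl : ∀ {x} → x ≋ x
    ≋-refl = 0# , Integral-resp ι-0 ⟦ E.0# ⟧-integral , trans (-‿inverseʳ _) (sym (zeroʳ _))

    ≋-+ : ∀ {x y u v} → x ≋ y → u ≋ v → x + u ≋ y + v
    ≋-+ {x} {y} {u} {v} (h , h-int , x-y) (k , k-int , u-v) = h + k , Integral-+ h-int k-int ,
      trans (solve 4 (λ x y u v → x :+ u :- (y :+ v) := (x :- y) :+ (u :- v)) refl x y u v)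
        (trans (+-cong x-y u-v) (sym (distribˡ _ h k)))

    ≋-* : ∀ {x y u v} → Integral e y → Integral e u → x ≋ y → u ≋ v → x * u ≋ y * v
    ≋-* {x} {y} {u} {v} y-int u-int (h , h-int , x-y) (k , k-int , u-v) =
      h * u + y * k , Integral-+ (Integral-* h-int u-int) (Integral-* y-int k-int) , (begin
        x * u - y * v
          ≈⟨ solve 4 (λ x y u v → x :* u :- y :* v := (x :- y) :* u :+ y :* (u :- v)) refl x y u v ⟩
        (x - y) * u + y * (u - v)       ≈⟨ +-cong (*-congʳ x-y) (*-congˡ u-v) ⟩
        ι e * h * u + y * (ι e * k)
          ≈⟨ solve 5 (λ e h u y k → e :* h :* u :+ y :* (e :* k) := e :* (h :* u :+ y :* k))
               refl (ι e) h u y k ⟩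
        ι e * (h * u + y * k) ∎)

    ∑-≋ : ∀ {f g} i → (∀ k → f k ≋ g k) → ∑ f i ≋ ∑ g i
    ∑-≋ zero    f≋g = ≋-refl
    ∑-≋ (suc i) f≋g = ≋-+ (∑-≋ i f≋g) (f≋g i)

    c-int : Integral e c
    c-int = IntE.q^-int (2 ℕ.* n)

    c′-int : Integral e c′
    c′-int = IntE.q^⁻¹-int (2 ℕ.* n)

    constant⁻¹-int : ∀ {r x y} → r D.≉ D.0# → j r ≈ x → x * y ≈ 1# → Integral e y
    constant⁻¹-int r≉0 r≈x = Integral-inverse (constant-e r≉0) r≈x

    1-q^⁻¹-int : ∀ {x x⁻¹} i → x ≈ q ^ suc i → (1# - x) * x⁻¹ ≈ 1# → Integral e x⁻¹
    1-q^⁻¹-int i x≈ = constant⁻¹-int (Base.1-q^≉0 B i) (j-1- (trans (j-^ q₀ (suc i)) (sym x≈)))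

    ip-int : ∀ i → Integral e (ip i)
    ip-int i = 1-q^⁻¹-int (ℕ.pred (8 ℕ.* suc i)) (p^≈ (suc i)) (ip-inv i)

    ic-int : ∀ i → Integral e (ic i)
    ic-int i = 1-q^⁻¹-int (ℕ.pred (2 ℕ.* n ℕ.+ 8 ℕ.* suc i))
      (trans (*-congˡ (p^≈ (suc i))) (sym (^-homo-* q (2 ℕ.* n) (8 ℕ.* suc i)))) (ic-inv i)

    ic′-int : ∀ i → Integral e (ic′ i)
    ic′-int i = Integral-* c-int (constant⁻¹-int (c₀-b₀≉0 i) (c-p^≈ i)
      (ι-inverse (c-p^-≉0 i) (c-p^≈ i)))

    -- The zeros a = c and a = 1/c of e give the same value of a + 1/a, so a single replacement of a
    -- by c settles both factors of e.
    a+a′≋c+c′ : (a + a′) - (c + c′) ≈ ι e * - (a′ * c′)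
    a+a′≋c+c′ = sym (begin
      ι e * - (a′ * c′)
        ≈⟨ *-congʳ ιe≈ ⟩
      (1# - a * c) * (a - c) * - (a′ * c′)
        ≈⟨ solve 4 (λ a a′ c c′ → (1: :- a :* c) :* (a :- c) :* (:- (a′ :* c′))
             := (c :* c′) :* a′ :- (a :* a′) :* c′ :+ (a :* a′ :* (c :* c′)) :* (a :- c)) refl a a′ c c′ ⟩
      c * c′ * a′ - a * a′ * c′ + a * a′ * (c * c′) * (a - c)
        ≈⟨ +-cong (+-cong (*-congʳ cc′≈1) (-‿cong (*-congʳ aa′≈1))) (*-congʳ (*-cong aa′≈1 cc′≈1)) ⟩
      1# * a′ - 1# * c′ + 1# * 1# * (a - c)
        ≈⟨ solve 4 (λ a a′ c c′ → 1: :* a′ :- 1: :* c′ :+ 1: :* 1: :* (a :- c)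
             := (a :+ a′) :- (c :+ c′)) refl a a′ c c′ ⟩
      (a + a′) - (c + c′) ∎)
      where cc′≈1 = q^-inv (2 ℕ.* n)

    linear-≋ : ∀ {F G} x y → Integral e y →
      F ≈ x - y * (a + a′) → G ≈ x - y * (c + c′) → F ≋ G
    linear-≋ {F} {G} x y y-int F≈ G≈ =
      - y * - (a′ * c′) ,
      Integral-* (Integral-neg y-int) (Integral-neg (Integral-* IntE.a′-int c′-int)) , (begin
        F - G                                             ≈⟨ +-cong F≈ (-‿cong G≈) ⟩
        x - y * (a + a′) - (x - y * (c + c′))
          ≈⟨ solve 4 (λ x y s t → x :- y :* s :- (x :- y :* t) := (:- y) :* (s :- t)) refl x y _ _ ⟩
        - y * ((a + a′) - (c + c′))                       ≈⟨ *-congˡ a+a′≋c+c′ ⟩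
        - y * (ι e * - (a′ * c′))
          ≈⟨ solve 3 (λ y e z → (:- y) :* (e :* z) := e :* ((:- y) :* z)) refl y (ι e) _ ⟩
        ι e * (- y * - (a′ * c′))                         ∎)

    inverse-≋ : ∀ {x y x⁻¹ y⁻¹} → Integral e x⁻¹ → Integral e y⁻¹ →
      x * x⁻¹ ≈ 1# → y * y⁻¹ ≈ 1# → x ≋ y → x⁻¹ ≋ y⁻¹
    inverse-≋ {x} {y} {x⁻¹} {y⁻¹} x⁻¹-int y⁻¹-int x-inv y-inv (h , h-int , x-y) =
      - (x⁻¹ * y⁻¹ * h) , Integral-neg (Integral-* (Integral-* x⁻¹-int y⁻¹-int) h-int) , (begin
        x⁻¹ - y⁻¹
          ≈⟨ +-cong (insert-1 x⁻¹ y-inv) (-‿cong (insert-1 y⁻¹ x-inv)) ⟩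
        x⁻¹ * (y * y⁻¹) - y⁻¹ * (x * x⁻¹)
          ≈⟨ solve 4 (λ x y i k → i :* (y :* k) :- k :* (x :* i) := :- (i :* k :* (x :- y))) refl x y x⁻¹ y⁻¹ ⟩
        - (x⁻¹ * y⁻¹ * (x - y))          ≈⟨ -‿cong (*-congˡ x-y) ⟩
        - (x⁻¹ * y⁻¹ * (ι e * h))
          ≈⟨ solve 3 (λ z e h → :- (z :* (e :* h)) := e :* (:- (z :* h))) refl _ (ι e) h ⟩
        ι e * - (x⁻¹ * y⁻¹ * h) ∎)

    L-≋ : ∀ k → A.L k ≋ C.L k
    L-≋ k = linear-≋ _ (α * p ^ k) (Integral-* (IntE.q^-int 2) (Integral-^ k (IntE.q^-int 8)))
      (A.linear-factors-α (p ^ k)) (C.linear-factors-α (p ^ k))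

    D⁻¹-≋ : ∀ k → A.D⁻¹ k ≋ C.D⁻¹ k
    D⁻¹-≋ k = inverse-≋ (Integral-* (IntE.ia-int k) (IntE.ia′-int k)) (Integral-* (ic-int k) (ic′-int k))
      (product-inverse (ia-inv k) (ia′-inv k)) (product-inverse (ic-inv k) (ic′-inv k))
      (linear-≋ _ (p ^ suc k) (Integral-^ (suc k) (IntE.q^-int 8))
        (A.linear-factors (p ^ suc k)) (C.linear-factors (p ^ suc k)))
      where
      product-inverse : ∀ {x y i l} → x * i ≈ 1# → y * l ≈ 1# → x * y * (i * l) ≈ 1#
      product-inverse xi yl = trans (solve 4 (λ x y i l → x :* y :* (i :* l) := x :* i :* (y :* l))
        refl _ _ _ _) (trans (*-cong xi yl) (*-identityˡ 1#))

    Q²-int : ∀ k → Integral e (A.Q k * A.Q k)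
    Q²-int k = Integral-* Q-int Q-int
      where
      Q-int : Integral e (A.Q k)
      Q-int = Integral-* (IntE.q^-int 2) (Integral-*
        (Integral-1- (Integral-* (IntE.q^-int 2) (Integral-^ k (IntE.q^-int 8)))) (ip-int k))

    CL-int : ∀ k → Integral e (C.L k)
    CL-int k = Integral-* (factor′ c-int) (factor′ c′-int)
      where
      factor′ : ∀ {x} → Integral e x → Integral e (1# - x * α * p ^ k)
      factor′ x-int = Integral-1- (Integral-* (Integral-* x-int (IntE.q^-int 2)) (Integral-^ k (IntE.q^-int 8)))

    ψ-≋ : ∀ k → A.ψ k ≋ C.ψ k
    ψ-≋ zero    = ≋-refl
    ψ-≋ (suc k) = ≋-* Cψ-int
      (Integral-* (Q²-int k) (Integral-* (IntE.L-int k) (Integral-* (IntE.ia-int k) (IntE.ia′-int k))))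
      (ψ-≋ k) (≋-* (Q²-int k) (Integral-* (IntE.L-int k) (Integral-* (IntE.ia-int k) (IntE.ia′-int k)))
        ≋-refl
        (≋-* (CL-int k) (Integral-* (IntE.ia-int k) (IntE.ia′-int k)) (L-≋ k) (D⁻¹-≋ k)))
      where
      Cψ-int : Integral e (C.ψ k)
      Cψ-int = Integral-∏ k (λ {i} _ →
        Integral-* (Q²-int i) (Integral-* (CL-int i) (Integral-* (ic-int i) (ic′-int i))))

    Aψ-int : ∀ k → Integral e (A.ψ k)
    Aψ-int k = Integral-∏ k (λ {i} _ →
      Integral-* (Q²-int i) (Integral-* (IntE.L-int i) (Integral-* (IntE.ia-int i) (IntE.ia′-int i))))

    ∑A-≋ : A.∑A N ≋ C.∑A N
    ∑A-≋ = ∑-≋ (suc N) (λ k → ≋-* (e-int k) (Aψ-int k) ≋-refl (ψ-≋ k))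
      where
      e-int : ∀ k → Integral e (1# - α * (p ^ k * p ^ k))
      e-int k = Integral-1- (Integral-* (IntE.q^-int 2)
        (Integral-* (Integral-^ k (IntE.q^-int 8)) (Integral-^ k (IntE.q^-int 8))))

  -- Two forms of `difference` meet in `common-multiple`: [n] times g, integral for the whole
  -- modulus, and e times an element integral only modulo e, where the inverses that depend on c are
  -- harmless.
  conclusion : ∃[ u ] ∃[ v ] Regular P v × P ∣ᴱ u × difference * ι v ≈ ι u
  conclusion = from ∑A-≋
    where
    w-intᵉ : Integral e w
    w-intᵉ = Integral-* (Integral-* i₂-int i₂-int)
        (Integral-inverse (factor (1+z^-regular 0)) 1+α≈ i₃-inv)
      where
      i₂-int : Integral e i₂
      i₂-int = 1-q^⁻¹-int 0 (sym (*-identityʳ q)) i₂-inv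

    from : A.∑A N ≋ C.∑A N → ∃[ u ] ∃[ v ] Regular P v × P ∣ᴱ u × difference * ι v ≈ ι u
    from (H , H-int , ∑A-∑C) = common-multiple n₀-regular difference≈[n]g g-int
      (trans (difference≈ (begin
          i₁ * A.∑A N - [n] * W
            -- The terminating evaluation at a = c is read backwards: [n]W is itself a sum of the
            -- same shape, divided by 1 - α.
            ≈⟨ +-congˡ (-‿cong (trans (*-congʳ (sym i₁[1-αp^N])) (trans (*-assoc _ _ _)
                 (*-congˡ (sym (C.Terminating.∑A-closed N c≈αp^)))))) ⟩
          i₁ * A.∑A N - i₁ * C.∑A N
            ≈⟨ solve 3 (λ i x y → i :* x :- i :* y := i :* (x :- y)) refl i₁ _ _ ⟩
          i₁ * (A.∑A N - C.∑A N)   ≈⟨ *-congˡ ∑A-∑C ⟩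
          i₁ * (ι e * H)           ∎))
        (trans (+-congˡ (*-congˡ (*-congˡ (*-congʳ (*-congˡ L≈)))))
          (solve 9 (λ i e H y n w ψ b x →
            i :* (e :* H) :* y :+ n :* n :* (w :* (ψ :* (e :* b) :* x))
            := e :* (i :* H :* y :+ n :* n :* (w :* (ψ :* b :* x))))
            refl i₁ (ι e) H (1# - A.L₀ * w) [n] w (A.ψ N) a′ (p′ ^ N))))
      (Integral-+ (Integral-* (Integral-* (1-q^⁻¹-int 1 refl i₁-inv) H-int)
          (Integral-1- (Integral-* IntE.L₀-int w-intᵉ)))
        (Integral-* (Integral-* ⟦ const n₀ ⟧-integral ⟦ const n₀ ⟧-integral)
          (Integral-* w-intᵉ (Integral-* (Integral-* (Aψ-int N) IntE.a′-int) (Integral-^ N (IntE.q^⁻¹-int 8))))))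

-- Translation of the expressions in the theorem

module Statement {o ℓ k ℓ′} (D : IntegralDomain o ℓ) (B : Base D) (N : ℕ)
  (K : FieldOfFractions (RegularPolynomials.E D) k ℓ′) where

  open FieldOfFractions K
  open Localization (RegularPolynomials.E D) K
  open Assembly D B N K
  open Moduli D B N using (n; e; n₀)
  open Polynomials (IntegralDomain.commutativeRing D) using (const)
  open Algebra.Properties.Semiring.Exp semiring using (_^_; ^-homo-*; ^-assocʳ; ^-congʳ; ^-congˡ)
  open Algebra.Properties.CommutativeMonoid.Sum *-commutativeMonoid using () renaming (sum to product)
  open Algebra.Properties.Semiring.Sum semiring using (sum; sum⁺-syntax; sum-cong-≋)
  open import Algebra.Properties.CommutativeSemiring.Exp commutativeSemiring using (^-distrib-*)
  open import Relation.Binary.Reasoning.Setoid setoid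
  open IntegerSolver commutativeRing
  open Iterated commutativeRing
  open QSeries commutativeRing baseₚ

  infixl 7 _/_

  _/_ : Carrier → Carrier → Carrier
  x / y = x * y ⁻¹

  ⦅_⨾_⦆[_] : Carrier → Carrier → ℕ → Carrier
  ⦅ x ⨾ b ⦆[ k ] = product {k} (λ i → 1# - x * b ^ toℕ i)

  [_]⟨_⟩ : ℕ → Carrier → Carrier
  [ m ]⟨ b ⟩ = (1# - b ^ m) / (1# - b)

  -- The expressions of the theorem over an abstract field; with concrete fractions substituted for
  -- it, they unfold to the stated ones.
  term : ℕ → Carrier
  term k = [ 8 ℕ.* k ℕ.+ 1 ]⟨ q ^ 2 ⟩ * [ 8 ℕ.* k ℕ.+ 1 ]⟨ q ⟩ ^ 2
      * ((⦅ q ^ 2 ⨾ q ^ 8 ⦆[ k ] ^ 2 * ⦅ a * q ^ 2 ⨾ q ^ 8 ⦆[ k ] * ⦅ q ^ 2 / a ⨾ q ^ 8 ⦆[ k ])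
        / (⦅ q ^ 8 ⨾ q ^ 8 ⦆[ k ] ^ 2 * ⦅ a * q ^ 8 ⨾ q ^ 8 ⦆[ k ] * ⦅ q ^ 8 / a ⨾ q ^ 8 ⦆[ k ]))
      * (q ^ (4 ℕ.* k)) ⁻¹

  value : ℕ → ℕ → ℕ → Carrier
  value n M m = [ n ]⟨ q ^ 2 ⟩
      * (⦅ q ^ 4 ⨾ q ^ 8 ⦆[ M ] / ⦅ q ^ 8 ⨾ q ^ 8 ⦆[ M ])
      * (q ^ m) ⁻¹
      * (1# - ((1# - a * q ^ 2) * (1# - q ^ 2 / a)) / ((1# - q) ^ 2 * (1# + q ^ 2)))

  modulus : ℕ → Carrier
  modulus n = [ n ]⟨ q ^ 2 ⟩ * (1# - a * q ^ (2 ℕ.* n)) * (a - q ^ (2 ℕ.* n))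

  private
    1: : ∀ {n} → Polynomial n
    1: = con (+ 1)

    -- The library product splits off the first factor, `∏` the last.
    product≈∏ : ∀ f i → product {i} (λ l → f (toℕ l)) ≈ ∏ f i
    product≈∏ f zero    = refl
    product≈∏ f (suc i) = trans (*-congˡ (product≈∏ (λ l → f (suc l)) i)) (sym (∏-front f i))

    sum≈∑ : ∀ f i → sum {i} (λ l → f (toℕ l)) ≈ ∑ f i
    sum≈∑ f zero    = refl
    sum≈∑ f (suc i) = trans (+-congˡ (sum≈∑ (λ l → f (suc l)) i)) (sym (∑-front f i))

    poch≈ : ∀ {x y} i → x ≈ y → ⦅ x ⨾ q ^ 8 ⦆[ i ] ≈ poch y i
    poch≈ {x} i x≈y = trans (product≈∏ (λ l → 1# - x * p ^ l) i) (poch-cong i x≈y)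

    ∏-inverse : ∀ {f g} i → (∀ l → f l * g l ≈ 1#) → ∏ f i * ∏ g i ≈ 1#
    ∏-inverse i inv = trans (sym (∏-* _ _ i)) (∏-one i (λ {l} _ → inv l))

    module _ (k : ℕ) where

      Pα Paα Pa′α I J J′ x y : Carrier
      Pα = poch α k
      Paα = poch (a * α) k
      Pa′α = poch (a′ * α) k
      I = ∏ ip k
      J = ∏ ia k
      J′ = ∏ ia′ k
      x = p ^ k
      y = q ^ (4 ℕ.* k)

      y≈ : y ≈ α ^ k * α ^ k
      y≈ = trans (sym (^-assocʳ q 4 k)) (trans (^-congˡ k (^-homo-* q 2 2)) (^-distrib-* α α k))

      x≈yy : x ≈ y * y
      x≈yy = trans (^-congˡ k (^-homo-* q 4 4)) (trans (^-distrib-* (q ^ 4) (q ^ 4) k)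
        (*-cong (^-assocʳ q 4 k) (^-assocʳ q 4 k)))

      ψ≈ : A.ψ k ≈ y * (Pα * I * (Pα * I) * (Paα * Pa′α * (J * J′)))
      ψ≈ = begin
        A.ψ k
          ≈⟨ trans (∏-* _ _ k) (*-cong (∏-* A.Q A.Q k)
               (trans (∏-* A.L A.D⁻¹ k) (*-cong (∏-* _ _ k) (∏-* ia ia′ k)))) ⟩
        ∏ A.Q k * ∏ A.Q k * (Paα * Pa′α * (J * J′))
          ≈⟨ *-congʳ (*-cong (∏Q≈ k) (∏Q≈ k)) ⟩
        α ^ k * (Pα * I) * (α ^ k * (Pα * I)) * (Paα * Pa′α * (J * J′))
          ≈⟨ solve 3 (λ u v w → u :* v :* (u :* v) :* w := u :* u :* (v :* v :* w)) refl _ _ _ ⟩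
        α ^ k * α ^ k * (Pα * I * (Pα * I) * (Paα * Pa′α * (J * J′)))
          ≈⟨ *-congʳ y≈ ⟨
        y * (Pα * I * (Pα * I) * (Paα * Pa′α * (J * J′))) ∎

      numerator≈ : ⦅ q ^ 2 ⨾ q ^ 8 ⦆[ k ] ^ 2 * ⦅ a * q ^ 2 ⨾ q ^ 8 ⦆[ k ] * ⦅ q ^ 2 / a ⨾ q ^ 8 ⦆[ k ]
        ≈ Pα ^ 2 * Paα * Pa′α
      numerator≈ = *-cong (*-cong (^-congˡ 2 (poch≈ k refl)) (poch≈ k refl)) (poch≈ k (*-comm α a′))

      denominator⁻¹≈ : (⦅ q ^ 8 ⨾ q ^ 8 ⦆[ k ] ^ 2 * ⦅ a * q ^ 8 ⨾ q ^ 8 ⦆[ k ] * ⦅ q ^ 8 / a ⨾ q ^ 8 ⦆[ k ]) ⁻¹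
        ≈ I * I * (J * J′)
      denominator⁻¹≈ = ⁻¹-unique (begin
        ⦅ q ^ 8 ⨾ q ^ 8 ⦆[ k ] ^ 2 * ⦅ a * q ^ 8 ⨾ q ^ 8 ⦆[ k ] * ⦅ q ^ 8 / a ⨾ q ^ 8 ⦆[ k ] * (I * I * (J * J′))
          ≈⟨ *-congʳ (*-cong (*-cong (^-congˡ 2 (poch≈ k refl)) (poch≈ k refl)) (poch≈ k (*-comm p a′))) ⟩
        poch p k ^ 2 * poch (a * p) k * poch (a′ * p) k * (I * I * (J * J′))
          ≈⟨ solve 6 (λ P A B I J K → P :* (P :* 1:) :* A :* B :* (I :* I :* (J :* K))
               := P :* I :* (P :* I) :* (A :* J :* (B :* K))) refl _ _ _ I J J′ ⟩
        poch p k * I * (poch p k * I) * (poch (a * p) k * J * (poch (a′ * p) k * J′))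
          ≈⟨ *-cong (*-cong P-inv P-inv) (*-cong
               (∏-inverse k (λ l → trans (*-congʳ (1-cong (*-assoc a p _))) (ia-inv l)))
               (∏-inverse k (λ l → trans (*-congʳ (1-cong (*-assoc a′ p _))) (ia′-inv l)))) ⟩
        1# * 1# * (1# * 1#)
          ≈⟨ solve 0 (1: :* 1: :* (1: :* 1:) := 1:) refl ⟩
        1# ∎)
        where
        P-inv : poch p k * I ≈ 1#
        P-inv = ∏-inverse k ip-inv

      -- In powers of q, ψ k contributes q⁴ᵏ and p′ᵏ is q⁻⁸ᵏ; together they are the factor q⁻⁴ᵏ of
      -- the theorem.
      ψx′≈ : A.ψ k * p′ ^ k ≈ (Pα ^ 2 * Paα * Pa′α) * (I * I * (J * J′)) * y ⁻¹
      ψx′≈ = begin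
        A.ψ k * p′ ^ k
          ≈⟨ *-cong ψ≈ x′≈ ⟩
        y * (Pα * I * (Pα * I) * (Paα * Pa′α * (J * J′))) * (y ⁻¹ * y ⁻¹)
          ≈⟨ solve 8 (λ y P I A B J K z →
               y :* (P :* I :* (P :* I) :* (A :* B :* (J :* K))) :* (z :* z)
               := P :* (P :* 1:) :* A :* B :* (I :* I :* (J :* K)) :* z :* (y :* z))
               refl y Pα I Paα Pa′α J J′ (y ⁻¹) ⟩
        Pα ^ 2 * Paα * Pa′α * (I * I * (J * J′)) * y ⁻¹ * (y * y ⁻¹)
          ≈⟨ insert-1 _ y-inv ⟨
        Pα ^ 2 * Paα * Pa′α * (I * I * (J * J′)) * y ⁻¹ ∎
        where
        y-inv : y * y ⁻¹ ≈ 1#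
        y-inv = q^-inv (4 ℕ.* k)

        x′≈ : p′ ^ k ≈ y ⁻¹ * y ⁻¹
        x′≈ = begin
          p′ ^ k                                 ≈⟨ insert-1 _ (trans (*-cong y-inv y-inv) (*-identityˡ 1#)) ⟩
          p′ ^ k * (y * y ⁻¹ * (y * y ⁻¹))
            ≈⟨ solve 3 (λ x y z → x :* (y :* z :* (y :* z)) := y :* y :* x :* (z :* z)) refl _ y (y ⁻¹) ⟩
          y * y * p′ ^ k * (y ⁻¹ * y ⁻¹)         ≈⟨ *-congʳ (trans (*-congʳ (sym x≈yy)) (^-inv k)) ⟩
          1# * (y ⁻¹ * y ⁻¹)                     ≈⟨ *-identityˡ _ ⟩
          y ⁻¹ * y ⁻¹                            ∎

      q^[8k+1] : q ^ (8 ℕ.* k ℕ.+ 1) ≈ q * x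
      q^[8k+1] = trans (^-homo-* q (8 ℕ.* k) 1) (trans (*-cong (sym (p^≈ k)) (*-identityʳ q)) (*-comm x q))

      α^[8k+1] : α ^ (8 ℕ.* k ℕ.+ 1) ≈ α * (x * x)
      α^[8k+1] = trans (^-assocʳ q 2 (8 ℕ.* k ℕ.+ 1)) (trans (^-congʳ q (ℕ.*-comm 2 (8 ℕ.* k ℕ.+ 1)))
        (trans (sym (^-assocʳ q (8 ℕ.* k ℕ.+ 1) 2)) (trans (^-congˡ 2 q^[8k+1])
          (solve 2 (λ q x → q :* x :* (q :* x :* 1:) := q :* (q :* 1:) :* (x :* x)) refl q x))))

      term≈ : term k ≈ summand k
      term≈ = begin
        term k
          ≈⟨ *-congʳ (*-cong (*-cong (*-congʳ (1-cong α^[8k+1])) (^-congˡ 2 (*-congʳ (1-cong q^[8k+1]))))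
               (*-cong numerator≈ denominator⁻¹≈)) ⟩
        (1# - α * (x * x)) * i₁ * ((1# - q * x) * i₂) ^ 2
          * (Pα ^ 2 * Paα * Pa′α * (I * I * (J * J′))) * y ⁻¹
          ≈⟨ solve 4 (λ u v w z → u :* (v :* (v :* 1:)) :* w :* z := u :* (v :* v) :* (w :* z)) refl _ _ _ _ ⟩
        (1# - α * (x * x)) * i₁ * ((1# - q * x) * i₂ * ((1# - q * x) * i₂))
          * (Pα ^ 2 * Paα * Pa′α * (I * I * (J * J′)) * y ⁻¹)
          ≈⟨ *-congˡ ψx′≈ ⟨
        summand k ∎

    [n]≈ : [ n ]⟨ q ^ 2 ⟩ ≈ [n]
    [n]≈ = trans (*-congʳ (1-cong (trans (^-assocʳ q 2 n) c≈αp^)))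
      (trans (*-comm _ i₁) i₁[1-αp^N])

    value≈ : value n N (2 ℕ.* N) ≈ right
    value≈ = begin
      value n N (2 ℕ.* N)
        ≈⟨ *-cong (*-cong (*-cong [n]≈ (*-cong (poch≈ N (^-homo-* q 2 2)) I≈)) z≈) (1-cong L₀w≈) ⟩
      [n] * (poch (α * α) N * ∏ ip N) * α′ ^ N * (1# - A.L₀ * w)
        ≈⟨ *-congʳ (*-assoc [n] _ _) ⟩
      right ∎
      where
      I≈ : ⦅ q ^ 8 ⨾ q ^ 8 ⦆[ N ] ⁻¹ ≈ ∏ ip N
      I≈ = ⁻¹-unique (trans (*-congʳ (poch≈ N refl)) (∏-inverse N ip-inv))

      z≈ : (q ^ (2 ℕ.* N)) ⁻¹ ≈ α′ ^ N
      z≈ = ⁻¹-unique (begin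
        q ^ (2 ℕ.* N) * α′ ^ N   ≈⟨ *-congʳ (^-assocʳ q 2 N) ⟨
        α ^ N * α′ ^ N           ≈⟨ ^-distrib-* α α′ N ⟨
        (α * α′) ^ N             ≈⟨ ^-congˡ N (q^-inv 2) ⟩
        1# ^ N                   ≈⟨ 1^ N ⟩
        1#                       ∎)
        where
        1^ : ∀ i → 1# ^ i ≈ 1#
        1^ zero    = refl
        1^ (suc i) = trans (*-identityˡ _) (1^ i)

      L₀w≈ : ((1# - a * q ^ 2) * (1# - q ^ 2 / a)) / ((1# - q) ^ 2 * (1# + q ^ 2)) ≈ A.L₀ * w
      L₀w≈ = *-cong (*-congˡ (1-cong (*-comm α a′))) (⁻¹-unique (begin
        (1# - q) ^ 2 * (1# + α) * w
          ≈⟨ solve 4 (λ u v i k → u :* (u :* 1:) :* v :* (i :* i :* k) := u :* i :* (u :* i) :* (v :* k))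
               refl (1# - q) (1# + α) i₂ i₃ ⟩
        (1# - q) * i₂ * ((1# - q) * i₂) * ((1# + α) * i₃)
          ≈⟨ *-cong (*-cong i₂-inv i₂-inv) i₃-inv ⟩
        1# * 1# * 1#
          ≈⟨ solve 0 (1: :* 1: :* 1: := 1:) refl ⟩
        1# ∎))

  difference′≈ : ∑[ i ≤ N ] term (toℕ i) - value n N (2 ℕ.* N) ≈ difference
  difference′≈ = +-cong (trans (sum≈∑ term (suc N)) (∑-cong (suc N) (λ {i} _ → term≈ i)))
    (-‿cong value≈)

  modulus≈ : ι P ≈ modulus n
  modulus≈ = trans (ι-* (const n₀) e) (trans (*-cong (sym [n]≈) ιe≈) (sym (*-assoc _ _ _)))

  -- The bounds are variables tied by equations because (n - 1)/4 equals N only provably; matching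
  -- on `≡.refl` identifies them before any sum is compared.
  congruent : ∀ n′ M m → n′ ≡ n → M ≡ N → m ≡ 2 ℕ.* N →
    ∀ (f : Fin (suc M) → Carrier) y z →
    (∀ i → f i ≡ term (toℕ i)) → y ≡ value n′ M m → z ≡ modulus n′ →
    ∑[ i ≤ M ] f i - y ≈ difference × ι P ≈ z
  congruent _ _ _ ≡.refl ≡.refl ≡.refl f _ _ f≡ ≡.refl ≡.refl =
    trans (+-congʳ (sum-cong-≋ (λ i → reflexive (f≡ i)))) difference′≈ , modulus≈

-- Instantiation at ℚ(q,a)

fieldOfFractions : ∀ {c ℓ} (D : IntegralDomain c ℓ) → FieldOfFractions D (c ⊔ ℓ) ℓ
fieldOfFractions D = record
  { commutativeRing = fractionField
  ; ι               = fromDomain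
  ; ι-cong          = λ x≈y → mk≈ (D.*-congʳ x≈y)
  ; ι-injective     = λ e → D.trans (D.sym (D.*-identityʳ _)) (D.trans (cross e) (D.*-identityʳ _))
  ; ι-+             = λ x y → mk≈ (D.*-cong
      (D.sym (D.+-cong (D.*-identityʳ x) (D.*-identityʳ y))) (D.*-identityʳ D.1#))
  ; ι-*             = λ x y → mk≈ (D.*-congˡ (D.*-identityʳ D.1#))
  ; ι-neg           = λ x → mk≈ D.refl
  ; ι-1             = mk≈ D.refl
  ; _⁻¹             = _⁻¹
  ; *-inverseʳ      = *-inverseʳ
  }
  where
  module D = IntegralDomain D
  open Fractions D

quotient≈ : ∀ {c ℓ} (D : IntegralDomain c ℓ) (let open Fractions D) →
  ∀ x u v (v≉0 : ¬ IntegralDomain._≈_ D v (IntegralDomain.0# D)) →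
  x * fromDomain v ≈ fromDomain u → x ≈ fraction u v v≉0
quotient≈ D x u v v≉0 xv≈u = Fractions.mk≈ (D.trans (D.sym (D.*-identityʳ _))
  (D.trans (Fractions.cross xv≈u) (D.*-congˡ (D.*-identityʳ (Fractions.den x)))))
  where module D = IntegralDomain D

polynomialBase : ∀ {c ℓ} (D : IntegralDomain c ℓ) (let open IntegralDomain D)
  (let open Algebra.Properties.Semiring.Mult semiring using () renaming (_×_ to _×ᵣ_)) →
  (∀ n → ∃[ u ] u * (suc n ×ᵣ 1#) ≈ 1#) → Base (RegularPolynomials.E D)
polynomialBase D ℕ⁻¹ = record
  { q      = X
  ; q≉0    = λ X≈0 → D.1≉0 (coeff-≈ X≈0 1)
  -- Xᵏ⁺¹ has constant term 0, so 1 - Xᵏ⁺¹ has constant term 1.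
  ; 1-q^≉0 = λ k 1-Xᵏ≈0 → D.1≉0 (begin
      D.1#                                            ≈⟨ solve 0 (con (+ 1) := con (+ 1) :- con (+ 0)) D.refl ⟩
      D.1# D.- D.0#                                   ≈⟨ D.+-congˡ (D.-‿cong (X*-coeff₀ (X ^ k))) ⟨
      D.1# D.- coeff (X * X ^ k) 0                    ≈⟨ D.+-congˡ (coeff-neg (X * X ^ k) 0) ⟨
      D.1# D.+ coeff (- (X * X ^ k)) 0                ≈⟨ coeff-+ (const D.1#) (- (X * X ^ k)) 0 ⟨
      coeff (const D.1# + - (X * X ^ k)) 0            ≈⟨ coeff-≈ 1-Xᵏ≈0 0 ⟩
      D.0#                                            ∎)
  ; ℕ⁻¹    = constant-inverse
  }
  where
  module D = IntegralDomain D
  open Polynomials D.commutativeRing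
  open RegularPolynomials D using (E; coeff₀-*)
  open Algebra.Properties.Semiring.Exp (IntegralDomain.semiring E) using (_^_)
  open Algebra.Properties.Semiring.Mult (IntegralDomain.semiring E) using () renaming (_×_ to _×ᴱ_)
  open Algebra.Properties.Semiring.Mult D.semiring using () renaming (_×_ to _×ᴰ_)
  open IntegerSolver D.commutativeRing using (solve; _:=_; _:-_; con)
  open import Relation.Binary.Reasoning.Setoid D.setoid

  X*-coeff₀ : ∀ r → coeff (X * r) 0 D.≈ D.0#
  X*-coeff₀ r = D.trans (coeff₀-* X r) (D.zeroˡ _)

  const-× : ∀ n → n ×ᴱ const D.1# ≈ const (n ×ᴰ D.1#)
  const-× zero    = ≈-sym 0∷[]≈[]
  const-× (suc n) = +-cong (≈-refl {const D.1#}) (const-× n)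

  constant-inverse : ∀ n → ∃[ u ] u * (suc n ×ᴱ const D.1#) ≈ const D.1#
  constant-inverse n with u , u-inv ← ℕ⁻¹ n = const u ,
    ≈-trans (*-congˡ (const u) (const-× (suc n))) (∷-cong (D.trans (D.+-identityʳ _) u-inv) ≈-refl)

open import Defs
open import Algebra.Properties.Semiring.Divisibility (IntegralDomain.semiring ℚ[q,a]) using (_∣_)

module _ where
  open Algebra.Properties.Semiring.Mult (IntegralDomain.semiring ℚ-domain) using () renaming (_×_ to _×ℚ_)

  ×1-nonNegative : ∀ n → 0ℚ ℚ.≤ n ×ℚ 1ℚ
  ×1-positive : ∀ n → 0ℚ ℚ.< suc n ×ℚ 1ℚ

  ×1-nonNegative zero    = ℚ.≤-refl
  ×1-nonNegative (suc n) = ℚ.<⇒≤ (×1-positive n)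
  ×1-positive n = ℚ.+-mono-<-≤ {0ℚ} {1ℚ} {0ℚ} (ℚ.positive⁻¹ 1ℚ) (×1-nonNegative n)

  ×1-inverse : ∀ n → ∃[ u ] u ℚ.* (suc n ×ℚ 1ℚ) ≡ 1ℚ
  ×1-inverse n = (ℚ.1/ (suc n ×ℚ 1ℚ)) {{nonZero}} , ℚ.*-inverseˡ (suc n ×ℚ 1ℚ) {{nonZero}}
    where nonZero = ℚ.≢-nonZero (λ e → ℚ.<⇒≢ (×1-positive n) (≡.sym e))

base : Base ℚ[q]
base = polynomialBase ℚ-domain ×1-inverse

module _ (N : ℕ) where

  open Assembly ℚ[q] base N (fieldOfFractions ℚ[q,a]) using (P; P≉0; difference; conclusion)
  open Statement ℚ[q] base N (fieldOfFractions ℚ[q,a]) using (term; value; modulus; congruent)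
  open DomainProperties ℚ[q,a] using (Regular; ≉0; Regular⇒Coprime)
  private module K = FieldOfFractions (fieldOfFractions ℚ[q,a])

  from-quotient : ∀ A B M → A - B ≈ difference × fromDomain P ≈ M →
    ∃[ u ] ∃[ v ] Regular P v × P ∣ u × difference K.* K.ι v K.≈ K.ι u → A ≡ B [mod M ]
  from-quotient A B M (A-B≈ , P≈M) (u , v , v-reg , P∣u , dv≈u) =
    -- The fraction left to unification is u/v, not necessarily in lowest terms; regularity of v
    -- yields the coprimality.
    P , P≈M , _ , K.trans A-B≈ (quotient≈ ℚ[q,a] difference u v (≉0 v-reg) dv≈u) ,
    Regular⇒Coprime P≉0 v-reg , P∣u

  congruence : ∀ n {M m} → n ≡ suc (4 ℕ.* N) → M ≡ N → m ≡ 2 ℕ.* N →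
    ∀ {f z : ℕ → Fraction} {y : ℕ → ℕ → Fraction} → (∀ k → f k ≡ term k) →
    (∀ M m → y M m ≡ value n M m) → (∀ n → z n ≡ modulus n) →
    ∑[ i ≤ M ] f (toℕ i) ≡ y M m [mod z n ]
  congruence n {M} {m} n≡ M≡ m≡ {f} {z} {y} f≡ y≡ z≡ =
    from-quotient (∑[ i ≤ M ] f (toℕ i)) (y M m) (z n)
      (congruent n M m n≡ M≡ m≡ (λ i → f (toℕ i)) (y M m) (z n)
        (λ i → f≡ (toℕ i)) (y≡ M m) (z≡ n))
      conclusion

  -- These hold by computation, whereas the whole sums are too large to be compared that way.
  term≡ : ∀ k →
      [ 8 ℕ.* k ℕ.+ 1 ]⟨ q ^ 2 ⟩ * [ 8 ℕ.* k ℕ.+ 1 ]⟨ q ⟩ ^ 2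
    * ((⦅ q ^ 2 ⨾ q ^ 8 ⦆[ k ] ^ 2 * ⦅ a * q ^ 2 ⨾ q ^ 8 ⦆[ k ] * ⦅ q ^ 2 / a ⨾ q ^ 8 ⦆[ k ])
      / (⦅ q ^ 8 ⨾ q ^ 8 ⦆[ k ] ^ 2 * ⦅ a * q ^ 8 ⨾ q ^ 8 ⦆[ k ] * ⦅ q ^ 8 / a ⨾ q ^ 8 ⦆[ k ]))
    * (q ^ (4 ℕ.* k)) ⁻¹
    ≡ term k
  term≡ k = ≡.refl

  value≡ : ∀ n M m →
      [ n ]⟨ q ^ 2 ⟩
    * (⦅ q ^ 4 ⨾ q ^ 8 ⦆[ M ] / ⦅ q ^ 8 ⨾ q ^ 8 ⦆[ M ])
    * (q ^ m) ⁻¹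
    * (1# - ((1# - a * q ^ 2) * (1# - q ^ 2 / a)) / ((1# - q) ^ 2 * (1# + q ^ 2)))
    ≡ value n M m
  value≡ n M m = ≡.refl

  modulus≡ : ∀ n → [ n ]⟨ q ^ 2 ⟩ * (1# - a * q ^ (2 ℕ.* n)) * (a - q ^ (2 ℕ.* n)) ≡ modulus n
  modulus≡ n = ≡.refl

theorem4 : (n : ℕ) → n > 0 → n % 4 ≡ 1 →
    (∑[ i ≤ (n ∸ 1) ℕ./ 4 ] (let k = toℕ i in
    [ 8 ℕ.* k ℕ.+ 1 ]⟨ q ^ 2 ⟩ * [ 8 ℕ.* k ℕ.+ 1 ]⟨ q ⟩ ^ 2
    * ((⦅ q ^ 2 ⨾ q ^ 8 ⦆[ k ] ^ 2 * ⦅ a * q ^ 2 ⨾ q ^ 8 ⦆[ k ] * ⦅ q ^ 2 / a ⨾ q ^ 8 ⦆[ k ])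
    / (⦅ q ^ 8 ⨾ q ^ 8 ⦆[ k ] ^ 2 * ⦅ a * q ^ 8 ⨾ q ^ 8 ⦆[ k ] * ⦅ q ^ 8 / a ⨾ q ^ 8 ⦆[ k ]))
    * (q ^ (4 ℕ.* k)) ⁻¹))
    ≡
    [ n ]⟨ q ^ 2 ⟩
    * (⦅ q ^ 4 ⨾ q ^ 8 ⦆[ (n ∸ 1) ℕ./ 4 ] / ⦅ q ^ 8 ⨾ q ^ 8 ⦆[ (n ∸ 1) ℕ./ 4 ])
    * (q ^ ((n ∸ 1) ℕ./ 2)) ⁻¹
    * (1# - ((1# - a * q ^ 2) * (1# - q ^ 2 / a)) / ((1# - q) ^ 2 * (1# + q ^ 2)))
    [mod [ n ]⟨ q ^ 2 ⟩ * (1# - a * q ^ (2 ℕ.* n)) * (a - q ^ (2 ℕ.* n)) ]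
theorem4 n _ n%4≡1 = result
  where
  N = n ℕ./ 4

  n≡ : n ≡ suc (4 ℕ.* N)
  n≡ = ≡.trans (m≡m%n+[m/n]*n n 4) (≡.cong₂ ℕ._+_ n%4≡1 (ℕ.*-comm N 4))

  4N≡ : 4 ℕ.* N ≡ 2 ℕ.* N ℕ.* 2
  4N≡ = ≡.trans (ℕ.*-assoc 2 2 N) (ℕ.*-comm 2 (2 ℕ.* N))

  M≡ : (n ∸ 1) ℕ./ 4 ≡ N
  M≡ = ≡.trans (≡.cong (λ m → (m ∸ 1) ℕ./ 4) (≡.trans n≡ (≡.cong suc (ℕ.*-comm 4 N)))) (m*n/n≡m N 4)

  m≡ : (n ∸ 1) ℕ./ 2 ≡ 2 ℕ.* N
  m≡ = ≡.trans (≡.cong (λ m → (m ∸ 1) ℕ./ 2) (≡.trans n≡ (≡.cong suc 4N≡))) (m*n/n≡m (2 ℕ.* N) 2)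

  result = congruence N n n≡ M≡ m≡ (term≡ N) (value≡ N n) (modulus≡ N)
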